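{- Let $k\ge 4$ be an integer and let $G$ be a connected graph on $n$ vertices with chromatic number $\chi(G)=k$. Then \[ P_G(k)\le k!\,(k-1)^{n-k}, \] with equality if and only if the $2$-core of $G$ is a $k$-clique.
   Context: All graphs are finite, simple and undirected. $P_G(k)$ denotes the number of proper $k$-colorings of $G$, i.e. functions $c:V(G)\to\{1,\dots,k\}$ with $c(u)\ne c(v)$ whenever $uv$ is an edge. The $2$-core of $G$ is the graph obtained by repeatedly deleting vertices of degree at most one until none remain. -}

module Defs where

open import Data.Nat using (ℕ; zero; suc; _≤_; _<_)
open import Data.Bool using (Bool; true; false; _∧_; not; if_then_else_)
open import Data.Fin using (Fin; zero; suc; _≟_)
open import Data.Fin.Properties using (all?)
open import Data.List using (List; []; _∷_; length; filter; concatMap; map; allFin)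
open import Data.Nat.ListAction using (sum)
open import Data.Product using (Σ; ∃; _×_; _,_)
open import Relation.Nullary using (¬_; Dec; does)
open import Relation.Nullary.Decidable using (¬?; _→-dec_)
open import Relation.Binary.PropositionalEquality using (_≡_; _≢_)
open import Relation.Binary.Construct.Closure.ReflexiveTransitive using (Star)

record Graph (n : ℕ) : Set where
  field
    adj    : Fin n → Fin n → Bool
    sym    : ∀ i j → adj i j ≡ adj j i
    irrefl : ∀ i → adj i i ≡ false

open Graph public

Adj : ∀ {n} → Graph n → Fin n → Fin n → Set
Adj G i j = adj G i j ≡ true

Proper : ∀ {n k} → Graph n → (Fin n → Fin k) → Set
Proper G c = ∀ i j → Adj G i j → c i ≢ c j

proper? : ∀ {n k} (G : Graph n) (c : Fin n → Fin k) → Dec (Proper G c)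
proper? G c = all? λ i → all? λ j →
  (adj G i j Data.Bool.≟ true) →-dec ¬? (c i ≟ c j)

allFunctions : ∀ n k → List (Fin n → Fin k)
allFunctions zero    k = (λ ()) ∷ []
allFunctions (suc n) k =
  concatMap (λ a → map (λ f → extend a f) (allFunctions n k)) (allFin k)
  where
  extend : Fin k → (Fin n → Fin k) → Fin (suc n) → Fin k
  extend a f zero    = a
  extend a f (suc i) = f i

chromPoly : ∀ {n} → Graph n → ℕ → ℕ
chromPoly {n} G k = length (filter (proper? G) (allFunctions n k))

Colorable : ∀ {n} → Graph n → ℕ → Set
Colorable G k = ∃ λ (c : _ → Fin k) → Proper G c

ChromaticNumber : ∀ {n} → Graph n → ℕ → Set
ChromaticNumber G k = Colorable G k × (∀ m → m < k → ¬ Colorable G m)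

Connected : ∀ {n} → Graph n → Set
Connected G = ∀ u v → Star (Adj G) u v

VSet : ℕ → Set
VSet n = Fin n → Bool

size : ∀ {n} → VSet n → ℕ
size S = sum (map (λ i → if S i then 1 else 0) (allFin _))

degIn : ∀ {n} → Graph n → VSet n → Fin n → ℕ
degIn G S v = size (λ j → S j ∧ adj G v j)

data DeleteStep {n} (G : Graph n) (S S' : VSet n) : Set where
  delete : (v : Fin n) → S v ≡ true → degIn G S v ≤ 1 →
           (∀ u → S' u ≡ (S u ∧ not (does (u ≟ v)))) →
           DeleteStep G S S'

IsTwoCore : ∀ {n} → Graph n → VSet n → Set
IsTwoCore G C =
  Star (DeleteStep G) (λ _ → true) C ×
  (∀ v → C v ≡ true → ¬ (degIn G C v ≤ 1))

IsClique : ∀ {n} → Graph n → ℕ → VSet n → Set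
IsClique G k C =
  size C ≡ k ×
  (∀ u v → C u ≡ true → C v ≡ true → u ≢ v → Adj G u v)

{-# OPTIONS --safe #-}

-- Put r = k - 1. Passing to a vertex-critical set T and colouring the remaining vertices along edges costs a factor r per
-- vertex, so it suffices to bound the colourings of T; if T has k vertices it is a clique. Otherwise count the colourings of
-- T by entropy, revealing the vertices in a random order: a vertex with d distinctly coloured neighbours has, when it is
-- revealed, k - i free colours with i uniform in {0, …, d}. In every k-colouring each colour class contains a vertex that
-- sees all other colours, since otherwise that class could be dissolved; these k vertices contribute at most k! altogether.
-- Any other vertex with two differently coloured neighbours contributes at most (k r (r-1))^(1/3) < r. The only vertices that
-- may contribute more than r are those with a monochromatic neighbourhood, and they are rare: every vertex has three
-- neighbours in T, and the colourings in which these agree factor through the graph with the three identified, so by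
-- induction they are at most a 1/r² fraction of the bound. Hence the bound is strict for |T| > k.
-- If equality holds, T is a clique and no vertex added later has two earlier neighbours, again because identifying those
-- would leave too few colourings; so the 2-core lies in T.

module Submission where

open import Defs using (Graph; adj; Adj; Proper; proper?; allFunctions; chromPoly; ChromaticNumber; Connected; VSet; size; degIn; DeleteStep; delete; IsTwoCore; IsClique) renaming (sym to adj-sym; irrefl to adj-irrefl)
open import Data.Bool using (Bool; true; false; if_then_else_; _∧_; _∨_; not)
import Data.Bool as Bool
open import Data.Bool.Properties using (∧-zeroʳ; ¬-not; not-¬)
open import Data.Empty using (⊥; ⊥-elim)
open import Data.Fin using (Fin; zero; suc; toℕ; punchIn; punchOut)
import Data.Fin as Fin
open import Data.Fin.Permutation.Components using (transpose; transpose-inverse)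
open import Data.Fin.Properties using (all?; any?; toℕ<n; toℕ-injective; ¬∀⟶∃¬; punchOut-injective; punchInᵢ≢i; punchIn-injective)
open import Data.List using (List; []; _∷_; _++_; map; length; filter; allFin; cartesianProductWith; concatMap)
open import Data.List.Membership.Propositional using (_∈_; _∉_; lose)
open import Data.List.Membership.Propositional.Properties using (∈-map⁺; ∈-map⁻; ∈-allFin; ∈-cartesianProductWith⁺; ∈-filter⁺; ∈-filter⁻)
open import Data.List.Membership.Propositional.Properties.WithK using (unique∧set⇒bag)
import Data.List.Membership.DecPropositional as DecMem
open import Data.List.Properties using (map-∘; map-cong; map-++; map-tabulate; length-tabulate; length-map)
open import Data.List.Relation.Binary.BagAndSetEquality using (∼bag⇒↭)
open import Data.List.Relation.Binary.Permutation.Propositional using (_↭_; ↭-sym; ↭⇒↭ₛ)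
import Data.List.Relation.Binary.Permutation.Propositional.Properties as Perm
import Data.List.Relation.Binary.Permutation.Setoid.Properties as SPerm
open import Data.List.Relation.Unary.All using (All; []; _∷_)
import Data.List.Relation.Unary.All as All
import Data.List.Relation.Unary.All.Properties as AllP
open import Data.List.Relation.Unary.AllPairs using (AllPairs; []; _∷_)
import Data.List.Relation.Unary.AllPairs as AllPairs
import Data.List.Relation.Unary.AllPairs.Properties as AllPairsP
open import Data.List.Relation.Unary.Any using (here; there; satisfied)
import Data.List.Relation.Unary.Any as Any
open import Data.List.Relation.Unary.Linked.Properties using (Linked⇒AllPairs)
open import Data.List.Relation.Unary.Unique.Propositional using (Unique)
import Data.List.Relation.Unary.Unique.Propositional.Properties as Uniq
open import Data.Nat
open import Data.Nat.DivMod using (_/_; m/n*n≡m)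
open import Data.Nat.Divisibility using (m∣m*n; ∣-trans; m≤n⇒m!∣n!)
open import Data.Nat.ListAction using (sum; product)
open import Data.Nat.ListAction.Properties using (sum-↭; product-↭; sum-++)
open import Data.Nat.Properties
open import Data.List.Sort ≤-decTotalOrder using (sort; sort-↭; sort-↗)
open import Data.Nat.Tactic.RingSolver using (solve-∀)
open import Data.Product using (_×_; _,_; proj₁; proj₂; ∃; ∃₂)
open import Data.Sum using (_⊎_; inj₁; inj₂)
open import Data.Vec using (Vec; []; _∷_; lookup; _[_]≔_; replicate; tabulate)
open import Data.Vec.Properties using (lookup∘update; lookup∘update′; lookup∘tabulate; tabulate∘lookup; tabulate-cong; ∷-injective)
open import Function using (_∘_; id; _⇔_; mk⇔)
open import Relation.Binary.Construct.Closure.ReflexiveTransitive using (Star; ε; _◅_)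
open import Relation.Binary.PropositionalEquality
open import Relation.Nullary using (Dec; yes; no; does; ¬_)
open import Relation.Nullary.Decidable using (¬?; _→-dec_; _×-dec_; _⊎-dec_; dec-true; dec-false; map′; from-yes)

-- Two obstacles shape the proof. Identifying vertices changes the graph and may raise its chromatic
-- number, so the bound is proved for all graphs on `Fin n` and all vertex sets that are connected
-- and not r-colourable; a vertex that is merged away stays in the type and leaves only the set.
-- Moreover, the estimate for agreeing neighbours is relative to the desired bound and not to the
-- number of colourings. It becomes a proportion once strictness is assumed to fail, which is why
-- the entropy part is an argument by contradiction.
--
-- Entropy appears exponentiated, so that everything stays in the natural numbers: logarithms become
-- powers, averages become products, and Gibbs' inequality becomes the inequality of arithmetic and
-- geometric means.
--
-- As k ≥ 4, three neighbours are available. A vertex where they agree gains at most a factor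
-- (k/r)^(1/4) over r, any other non-representative loses at least (r²/(r²-1))^(1/3). The gain has
-- order 1/r and the loss order 1/r², but agreement occurs in at most a 1/r² share of the colourings
-- for each vertex, which just suffices.

module Counting where

  private
    variable
      X Y : Set
      n k m r : ℕ

  ^-distribʳ-* : ∀ n a b → (a * b) ^ n ≡ a ^ n * b ^ n
  ^-distribʳ-* zero    a b = refl
  ^-distribʳ-* (suc n) a b = trans (cong (a * b *_) (^-distribʳ-* n a b)) (interchange a b _ _)
    where
    interchange : ∀ a b c d → a * b * (c * d) ≡ a * c * (b * d)
    interchange = solve-∀

  ⟪_⟫ : Bool → ℕ
  ⟪ b ⟫ = if b then 1 else 0

  𝟙 : Dec X → ℕ
  𝟙 d = ⟪ does d ⟫

  𝟙-yes : (p : Dec X) → X → 𝟙 p ≡ 1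
  𝟙-yes (yes _) _ = refl
  𝟙-yes (no ¬p) p = ⊥-elim (¬p p)

  𝟙-no : (p : Dec X) → ¬ X → 𝟙 p ≡ 0
  𝟙-no (yes p) ¬p = ⊥-elim (¬p p)
  𝟙-no (no _)  _  = refl

  𝟙-mono : (p : Dec X) (q : Dec Y) → (X → Y) → 𝟙 p ≤ 𝟙 q
  𝟙-mono (no _)  q f = z≤n
  𝟙-mono (yes p) q f = ≤-reflexive (sym (𝟙-yes q (f p)))

  𝟙-cong : (p : Dec X) (q : Dec Y) → (X → Y) → (Y → X) → 𝟙 p ≡ 𝟙 q
  𝟙-cong p q f g = ≤-antisym (𝟙-mono p q f) (𝟙-mono q p g)

  -- Finite sums and products

  ∑ ∏ : List X → (X → ℕ) → ℕ
  ∑ xs f = sum (map f xs)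
  ∏ xs f = product (map f xs)

  ∑-cong : (xs : List X) {f g : X → ℕ} → (∀ x → f x ≡ g x) → ∑ xs f ≡ ∑ xs g
  ∑-cong xs f≗g = cong sum (map-cong f≗g xs)

  ∏-cong : (xs : List X) {f g : X → ℕ} → (∀ x → f x ≡ g x) → ∏ xs f ≡ ∏ xs g
  ∏-cong xs f≗g = cong product (map-cong f≗g xs)

  ∑-mono-∈ : (xs : List X) {f g : X → ℕ} → (∀ {x} → x ∈ xs → f x ≤ g x) → ∑ xs f ≤ ∑ xs g
  ∑-mono-∈ []       f≤g = z≤n
  ∑-mono-∈ (x ∷ xs) f≤g = +-mono-≤ (f≤g (here refl)) (∑-mono-∈ xs (f≤g ∘ there))

  ∑-mono : (xs : List X) {f g : X → ℕ} → (∀ x → f x ≤ g x) → ∑ xs f ≤ ∑ xs g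
  ∑-mono xs f≤g = ∑-mono-∈ xs (λ {x} _ → f≤g x)

  ∏-mono-∈ : (xs : List X) {f g : X → ℕ} → (∀ {x} → x ∈ xs → f x ≤ g x) → ∏ xs f ≤ ∏ xs g
  ∏-mono-∈ []       f≤g = ≤-refl
  ∏-mono-∈ (x ∷ xs) f≤g = *-mono-≤ (f≤g (here refl)) (∏-mono-∈ xs (f≤g ∘ there))

  ∏-cong-∈ : (xs : List X) {f g : X → ℕ} → (∀ {x} → x ∈ xs → f x ≡ g x) → ∏ xs f ≡ ∏ xs g
  ∏-cong-∈ []       f≡g = refl
  ∏-cong-∈ (x ∷ xs) f≡g = cong₂ _*_ (f≡g (here refl)) (∏-cong-∈ xs (f≡g ∘ there))

  ∑-const : (xs : List X) (m : ℕ) → ∑ xs (λ _ → m) ≡ length xs * m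
  ∑-const []       m = refl
  ∑-const (x ∷ xs) m = cong (m +_) (∑-const xs m)

  ∏-const : (xs : List X) (m : ℕ) → ∏ xs (λ _ → m) ≡ m ^ length xs
  ∏-const []       m = refl
  ∏-const (x ∷ xs) m = cong (m *_) (∏-const xs m)

  ∑-+ : (xs : List X) (f g : X → ℕ) → ∑ xs (λ x → f x + g x) ≡ ∑ xs f + ∑ xs g
  ∑-+ []       f g = refl
  ∑-+ (x ∷ xs) f g = trans (cong (f x + g x +_) (∑-+ xs f g)) (interchange (f x) (g x) _ _)
    where
    interchange : ∀ a b c d → a + b + (c + d) ≡ a + c + (b + d)
    interchange = solve-∀

  ∏-* : (xs : List X) (f g : X → ℕ) → ∏ xs (λ x → f x * g x) ≡ ∏ xs f * ∏ xs g
  ∏-* []       f g = refl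
  ∏-* (x ∷ xs) f g = trans (cong (f x * g x *_) (∏-* xs f g)) (interchange (f x) (g x) _ _)
    where
    interchange : ∀ a b c d → a * b * (c * d) ≡ a * c * (b * d)
    interchange = solve-∀

  ∑-*ˡ : (xs : List X) (m : ℕ) (f : X → ℕ) → ∑ xs (λ x → m * f x) ≡ m * ∑ xs f
  ∑-*ˡ []       m f = sym (*-zeroʳ m)
  ∑-*ˡ (x ∷ xs) m f = trans (cong (m * f x +_) (∑-*ˡ xs m f)) (sym (*-distribˡ-+ m (f x) _))

  ∏-^ : (xs : List X) (f : X → ℕ) (m : ℕ) → ∏ xs (λ x → f x ^ m) ≡ ∏ xs f ^ m
  ∏-^ []       f m = sym (^-zeroˡ m)
  ∏-^ (x ∷ xs) f m = trans (cong (f x ^ m *_) (∏-^ xs f m)) (sym (^-distribʳ-* m (f x) _))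

  ∏-exp : (xs : List X) (m : ℕ) (f : X → ℕ) → ∏ xs (λ x → m ^ f x) ≡ m ^ ∑ xs f
  ∏-exp []       m f = refl
  ∏-exp (x ∷ xs) m f = trans (cong (m ^ f x *_) (∏-exp xs m f)) (sym (^-distribˡ-+-* m (f x) _))

  ∑-swap : (xs : List X) (ys : List Y) (f : X → Y → ℕ) →
           ∑ xs (λ x → ∑ ys (f x)) ≡ ∑ ys (λ y → ∑ xs (λ x → f x y))
  ∑-swap []       ys f = sym (trans (∑-const ys 0) (*-zeroʳ (length ys)))
  ∑-swap (x ∷ xs) ys f = trans (cong (∑ ys (f x) +_) (∑-swap xs ys f)) (sym (∑-+ ys (f x) _))

  ∏-swap : (xs : List X) (ys : List Y) (f : X → Y → ℕ) →
           ∏ xs (λ x → ∏ ys (f x)) ≡ ∏ ys (λ y → ∏ xs (λ x → f x y))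
  ∏-swap []       ys f = sym (trans (∏-const ys 1) (^-zeroˡ (length ys)))
  ∏-swap (x ∷ xs) ys f = trans (cong (∏ ys (f x) *_) (∏-swap xs ys f)) (sym (∏-* ys (f x) _))

  ∑-++ : (xs ys : List X) (f : X → ℕ) → ∑ (xs ++ ys) f ≡ ∑ xs f + ∑ ys f
  ∑-++ xs ys f = trans (cong sum (map-++ f xs ys)) (sum-++ (map f xs) (map f ys))

  ∑-map : (g : X → Y) (xs : List X) (f : Y → ℕ) → ∑ (map g xs) f ≡ ∑ xs (f ∘ g)
  ∑-map g xs f = cong sum (sym (map-∘ xs))

  ∏-map : (g : X → Y) (xs : List X) (f : Y → ℕ) → ∏ (map g xs) f ≡ ∏ xs (f ∘ g)
  ∏-map g xs f = cong product (sym (map-∘ xs))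

  ∑-cartesianProductWith : {Z : Set} (h : X → Y → Z) (xs : List X) (ys : List Y) (f : Z → ℕ) →
    ∑ (cartesianProductWith h xs ys) f ≡ ∑ xs (λ x → ∑ ys (λ y → f (h x y)))
  ∑-cartesianProductWith h []       ys f = refl
  ∑-cartesianProductWith h (x ∷ xs) ys f =
    trans (∑-++ (map (h x) ys) _ f)
          (cong₂ _+_ (∑-map (h x) ys f) (∑-cartesianProductWith h xs ys f))

  ∑-filter : {R : X → Set} (R? : ∀ x → Dec (R x)) (xs : List X) (f : X → ℕ) →
    ∑ (filter R? xs) f ≡ ∑ xs (λ x → 𝟙 (R? x) * f x)
  ∑-filter R? []       f = refl
  ∑-filter R? (x ∷ xs) f with R? x
  ... | yes _ = cong₂ _+_ (sym (+-identityʳ (f x))) (∑-filter R? xs f)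
  ... | no _  = ∑-filter R? xs f

  length-filter-∑ : {R : X → Set} (R? : ∀ x → Dec (R x)) (xs : List X) →
    length (filter R? xs) ≡ ∑ xs (λ x → 𝟙 (R? x))
  length-filter-∑ R? []       = refl
  length-filter-∑ R? (x ∷ xs) with R? x
  ... | yes _ = cong suc (length-filter-∑ R? xs)
  ... | no _  = length-filter-∑ R? xs

  ∑-↭ : {xs ys : List X} (f : X → ℕ) → xs ↭ ys → ∑ xs f ≡ ∑ ys f
  ∑-↭ f p = sum-↭ (Perm.map⁺ f p)

  ∏-↭ : {xs ys : List X} (f : X → ℕ) → xs ↭ ys → ∏ xs f ≡ ∏ ys f
  ∏-↭ f p = product-↭ (Perm.map⁺ f p)

  ∑-squeeze : (xs : List X) {f g : X → ℕ} → (∀ x → f x ≤ g x) → ∑ xs g ≤ ∑ xs f →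
              ∀ {x} → x ∈ xs → f x ≡ g x
  ∑-squeeze (x ∷ xs) {f} {g} f≤g gf (here refl) =
    ≤-antisym (f≤g x) (+-cancelʳ-≤ (∑ xs f) (g x) (f x)
      (≤-trans (+-monoʳ-≤ (g x) (∑-mono xs f≤g)) gf))
  ∑-squeeze (x ∷ xs) {f} {g} f≤g gf (there p) =
    ∑-squeeze xs f≤g (+-cancelˡ-≤ (f x) (∑ xs g) (∑ xs f)
      (≤-trans (+-monoˡ-≤ (∑ xs g) (f≤g x)) gf)) p

  ∑-≥ : (xs : List X) (f : X → ℕ) {x : X} → x ∈ xs → f x ≤ ∑ xs f
  ∑-≥ (x ∷ xs) f (here refl) = m≤m+n _ _
  ∑-≥ (x ∷ xs) f (there p)   = ≤-trans (∑-≥ xs f p) (m≤n+m _ _)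

  ∑-allFin-suc : ∀ n (f : Fin (suc n) → ℕ) → ∑ (allFin (suc n)) f ≡ f zero + ∑ (allFin n) (f ∘ suc)
  ∑-allFin-suc n f = cong (λ l → f zero + sum l)
    (trans (map-tabulate {n = n} suc f) (sym (map-tabulate {n = n} id (f ∘ suc))))

  ∏-allFin-suc : ∀ n (f : Fin (suc n) → ℕ) → ∏ (allFin (suc n)) f ≡ f zero * ∏ (allFin n) (f ∘ suc)
  ∏-allFin-suc n f = cong (λ l → f zero * product l)
    (trans (map-tabulate {n = n} suc f) (sym (map-tabulate {n = n} id (f ∘ suc))))

  ∑-allFin-const : ∀ n m → ∑ (allFin n) (λ _ → m) ≡ n * m
  ∑-allFin-const n m = trans (∑-const (allFin n) m) (cong (_* m) (length-tabulate {n = n} id))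

  ∏-allFin-const : ∀ n m → ∏ (allFin n) (λ _ → m) ≡ m ^ n
  ∏-allFin-const n m = trans (∏-const (allFin n) m) (cong (m ^_) (length-tabulate {n = n} id))

  ∑-zero : (xs : List X) (f : X → ℕ) → (∀ x → f x ≡ 0) → ∑ xs f ≡ 0
  ∑-zero xs f e = trans (∑-cong xs e) (trans (∑-const xs 0) (*-zeroʳ (length xs)))

  ∑-δ : ∀ n (j : Fin n) (f : Fin n → ℕ) → ∑ (allFin n) (λ i → 𝟙 (i Fin.≟ j) * f i) ≡ f j
  ∑-δ (suc n) zero    f = trans (∑-allFin-suc n (λ i → 𝟙 (i Fin.≟ zero) * f i))
    (trans (cong₂ _+_ (+-identityʳ (f zero)) (∑-zero (allFin n) _ λ _ → refl)) (+-identityʳ _))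
  ∑-δ (suc n) (suc j) f = trans (∑-allFin-suc n (λ i → 𝟙 (i Fin.≟ suc j) * f i))
    (trans (∑-cong (allFin n) (λ i → cong (_* f (suc i)) (𝟙-cong (suc i Fin.≟ suc j) (i Fin.≟ j) (λ { refl → refl }) (cong suc))))
           (∑-δ n j (f ∘ suc)))

  ∑-δ₁ : ∀ n (j : Fin n) → ∑ (allFin n) (λ i → 𝟙 (i Fin.≟ j)) ≡ 1
  ∑-δ₁ n j = trans (∑-cong (allFin n) (λ i → sym (*-identityʳ _))) (∑-δ n j (λ _ → 1))

  -- Inequality of arithmetic and geometric means

  -- Arithmetic and geometric means of y and z with weights 1 and n. The induction adds
  -- `n * (y * z ^ suc n)` to both sides, after which `2yz≤` suffices and no subtraction occurs.
  weighted-square : ∀ n y z → suc n * (y * z ^ n) ≤ y ^ suc n + n * z ^ suc n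
  weighted-square zero    y z = ≤-reflexive (lem y)
    where
    lem : ∀ y → 1 * (y * 1) ≡ y * 1 + 0
    lem = solve-∀
  weighted-square (suc n) y z = +-cancelʳ-≤ (n * (y * z ^ suc n)) _ _ (begin
    suc (suc n) * (y * z ^ suc n) + n * (y * z ^ suc n) ≡⟨ e₁ n y z (z ^ n) ⟩
    suc n * z ^ n * (2 * y * z)                         ≤⟨ *-monoʳ-≤ (suc n * z ^ n) (2yz≤ y z) ⟩
    suc n * z ^ n * (y * y + z * z)                     ≡⟨ e₂ n y z (z ^ n) ⟩
    y * (suc n * (y * z ^ n)) + suc n * z ^ suc (suc n) ≤⟨ +-monoˡ-≤ _ (*-monoʳ-≤ y (weighted-square n y z)) ⟩
    y * (y ^ suc n + n * z ^ suc n) + suc n * z ^ suc (suc n) ≡⟨ e₃ n y z (y ^ suc n) (z ^ n) ⟩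
    y ^ suc (suc n) + suc n * z ^ suc (suc n) + n * (y * z ^ suc n) ∎)
    where
    open ≤-Reasoning
    e₁ : ∀ n y z w → suc (suc n) * (y * (z * w)) + n * (y * (z * w)) ≡ suc n * w * (2 * y * z)
    e₁ = solve-∀
    e₂ : ∀ n y z w → suc n * w * (y * y + z * z) ≡ y * (suc n * (y * w)) + suc n * (z * (z * w))
    e₂ = solve-∀
    e₃ : ∀ n y z v w → y * (v + n * (z * w)) + suc n * (z * (z * w)) ≡ y * v + suc n * (z * (z * w)) + n * (y * (z * w))
    e₃ = solve-∀
    sq : ∀ a d → 2 * a * (a + d) ≤ a * a + (a + d) * (a + d)
    sq a d = ≤-trans (m≤m+n _ (d * d)) (≤-reflexive (e a d))
      where
      e : ∀ a d → 2 * a * (a + d) + d * d ≡ a * a + (a + d) * (a + d)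
      e = solve-∀
    2yz≤ : ∀ y z → 2 * y * z ≤ y * y + z * z
    2yz≤ y z with ≤-total y z
    ... | inj₁ y≤z = subst (λ z → 2 * y * z ≤ y * y + z * z) (m+[n∸m]≡n y≤z) (sq y (z ∸ y))
    ... | inj₂ z≤y = subst₂ _≤_ (c y z) (+-comm (z * z) (y * y))
        (subst (λ y → 2 * z * y ≤ z * z + y * y) (m+[n∸m]≡n z≤y) (sq z (y ∸ z)))
      where
      c : ∀ y z → 2 * z * y ≡ 2 * y * z
      c = solve-∀

  -- Think of s as the sum of n numbers. Up to the common factor n (n + 1), n (x + s) is the mean of
  -- all n + 1 numbers and z = (n + 1) s the mean of those n; `weighted-square` is applied to these
  -- two means.
  am-gm-step : ∀ n x s → suc n ^ suc n * (x * s ^ n) ≤ (x + s) ^ suc n * n ^ n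
  am-gm-step zero    x s = ≤-trans (≤-reflexive (e x)) (≤-trans (m≤m+n x s) (≤-reflexive (e′ x s)))
    where
    e : ∀ x → 1 * (x * 1) ≡ x
    e = solve-∀
    e′ : ∀ x s → x + s ≡ (x + s) * 1 * 1
    e′ = solve-∀
  am-gm-step n@(suc _) x s = *-cancelˡ-≤ n (begin
    n * (suc n ^ suc n * (x * s ^ n))            ≡⟨ e₁ n (suc n ^ n) x (s ^ n) ⟩
    n * suc n * x * (suc n ^ n * s ^ n)          ≡⟨ cong (n * suc n * x *_) (sym (^-distribʳ-* n (suc n) s)) ⟩
    n * suc n * x * (suc n * s) ^ n              ≤⟨ +-cancelʳ-≤ (n * z ^ suc n) _ _ main ⟩
    (n * (x + s)) ^ suc n                        ≡⟨ ^-distribʳ-* (suc n) n (x + s) ⟩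
    n ^ suc n * (x + s) ^ suc n                  ≡⟨ e₂ n (n ^ n) ((x + s) ^ suc n) ⟩
    n * ((x + s) ^ suc n * n ^ n)                ∎)
    where
    open ≤-Reasoning
    z = suc n * s
    e₁ : ∀ n p x q → n * (suc n * p * (x * q)) ≡ n * suc n * x * (p * q)
    e₁ = solve-∀
    e₂ : ∀ n p q → n * p * q ≡ n * (q * p)
    e₂ = solve-∀
    e₃ : ∀ n x s w → n * suc n * x * w + n * ((suc n * s) * w) ≡ suc n * (n * (x + s) * w)
    e₃ = solve-∀
    main : n * suc n * x * z ^ n + n * z ^ suc n ≤ (n * (x + s)) ^ suc n + n * z ^ suc n
    main = ≤-trans (≤-reflexive (e₃ n x s (z ^ n))) (weighted-square n (n * (x + s)) z)

  am-gm : (xs : List ℕ) → length xs ^ length xs * product xs ≤ sum xs ^ length xs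
  am-gm []       = ≤-refl
  am-gm (x ∷ []) = ≤-reflexive (e x)
    where
    e : ∀ x → 1 * (x * 1) ≡ (x + 0) * 1
    e = solve-∀
  am-gm (x ∷ xs@(_ ∷ _)) = *-cancelˡ-≤ (l ^ l) {{m^n≢0 l l}} (begin
    l ^ l * (suc l ^ suc l * (x * product xs)) ≡⟨ e (l ^ l) (suc l ^ suc l) x (product xs) ⟩
    suc l ^ suc l * (x * (l ^ l * product xs)) ≤⟨ *-monoʳ-≤ (suc l ^ suc l) (*-monoʳ-≤ x (am-gm xs)) ⟩
    suc l ^ suc l * (x * sum xs ^ l)           ≤⟨ am-gm-step l x (sum xs) ⟩
    (x + sum xs) ^ suc l * l ^ l               ≡⟨ *-comm _ (l ^ l) ⟩
    l ^ l * (x + sum xs) ^ suc l               ∎)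
    where
    open ≤-Reasoning
    l = length xs
    e : ∀ p q x w → p * (q * (x * w)) ≡ q * (x * (p * w))
    e = solve-∀

  ^-cancelˡ-≤ : ∀ n .{{_ : NonZero n}} {a b} → a ^ n ≤ b ^ n → a ≤ b
  ^-cancelˡ-≤ n {a} {b} h = ≮⇒≥ (λ b<a → <⇒≱ (^-monoˡ-< n b<a) h)

  -- Colour vectors and summation over one coordinate

  vecs : ∀ k n → List (Vec (Fin k) n)
  vecs k zero    = [] ∷ []
  vecs k (suc n) = cartesianProductWith _∷_ (allFin k) (vecs k n)

  ∈-vecs : (c : Vec (Fin k) n) → c ∈ vecs k n
  ∈-vecs []      = here refl
  ∈-vecs (a ∷ c) = ∈-cartesianProductWith⁺ _∷_ (∈-allFin a) (∈-vecs c)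

  vecs-unique : ∀ k n → Unique (vecs k n)
  vecs-unique k zero    = [] ∷ []
  vecs-unique k (suc n) = Uniq.cartesianProductWith⁺ _∷_ ∷-injective (Uniq.allFin⁺ k) (vecs-unique k n)

  ∑-vecs-const : ∀ k n m → ∑ (vecs k n) (λ _ → m) ≡ k ^ n * m
  ∑-vecs-const k zero    m = refl
  ∑-vecs-const k (suc n) m = trans (∑-cartesianProductWith _∷_ (allFin k) (vecs k n) (λ _ → m))
    (trans (∑-cong (allFin k) (λ _ → ∑-vecs-const k n m))
      (trans (∑-allFin-const k _) (sym (*-assoc k (k ^ n) m))))

  -- Every vector arises as `c [ v ]≔ a` from exactly k pairs (c , a). The factor k replaces a
  -- division by the number of colours of v.
  ∑-resample : ∀ (v : Fin n) (f : Vec (Fin k) n → ℕ) →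
    k * ∑ (vecs k n) f ≡ ∑ (vecs k n) (λ c → ∑ (allFin k) (λ a → f (c [ v ]≔ a)))
  ∑-resample {suc n} {k} zero f = begin
    k * ∑ (vecs k (suc n)) f
      ≡⟨ cong (k *_) (∑-cartesianProductWith _∷_ (allFin k) (vecs k n) f) ⟩
    k * ∑ (allFin k) (λ a → ∑ (vecs k n) (λ c → f (a ∷ c)))
      ≡⟨ cong (k *_) (∑-swap (allFin k) (vecs k n) (λ a c → f (a ∷ c))) ⟩
    k * ∑ (vecs k n) (λ c → ∑ (allFin k) (λ a → f (a ∷ c)))
      ≡⟨ ∑-allFin-const k _ ⟨
    ∑ (allFin k) (λ _ → ∑ (vecs k n) (λ c → ∑ (allFin k) (λ a → f (a ∷ c))))
      ≡⟨ ∑-cartesianProductWith _∷_ (allFin k) (vecs k n) (λ c → ∑ (allFin k) (λ a → f (c [ zero ]≔ a))) ⟨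
    ∑ (vecs k (suc n)) (λ c → ∑ (allFin k) (λ a → f (c [ zero ]≔ a))) ∎
    where open ≡-Reasoning
  ∑-resample {suc n} {k} (suc v) f = begin
    k * ∑ (vecs k (suc n)) f
      ≡⟨ cong (k *_) (∑-cartesianProductWith _∷_ (allFin k) (vecs k n) f) ⟩
    k * ∑ (allFin k) (λ b → ∑ (vecs k n) (λ c → f (b ∷ c)))
      ≡⟨ ∑-*ˡ (allFin k) k (λ b → ∑ (vecs k n) (λ c → f (b ∷ c))) ⟨
    ∑ (allFin k) (λ b → k * ∑ (vecs k n) (λ c → f (b ∷ c)))
      ≡⟨ ∑-cong (allFin k) (λ b → ∑-resample v (λ c → f (b ∷ c))) ⟩
    ∑ (allFin k) (λ b → ∑ (vecs k n) (λ c → ∑ (allFin k) (λ a → f (b ∷ (c [ v ]≔ a)))))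
      ≡⟨ ∑-cartesianProductWith _∷_ (allFin k) (vecs k n) (λ c → ∑ (allFin k) (λ a → f (c [ suc v ]≔ a))) ⟨
    ∑ (vecs k (suc n)) (λ c → ∑ (allFin k) (λ a → f (c [ suc v ]≔ a))) ∎
    where open ≡-Reasoning

  ∑-concatMap : (g : X → List Y) (xs : List X) (f : Y → ℕ) →
                ∑ (concatMap g xs) f ≡ ∑ xs (λ x → ∑ (g x) f)
  ∑-concatMap g []       f = refl
  ∑-concatMap g (x ∷ xs) f = trans (∑-++ (g x) _ f) (cong (∑ (g x) f +_) (∑-concatMap g xs f))

  ∑-allFunctions : ∀ n k (F : (Fin n → Fin k) → ℕ) → (∀ {f g} → f ≗ g → F f ≡ F g) →
    ∑ (allFunctions n k) F ≡ ∑ (vecs k n) (F ∘ lookup)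
  ∑-allFunctions zero    k F ext = cong (_+ 0) (ext (λ ()))
  ∑-allFunctions (suc n) k F ext = trans (∑-concatMap _ (allFin k) F)
    (trans (∑-cong (allFin k) (λ a →
       trans (∑-map _ (allFunctions n k) F)
         (trans (∑-allFunctions n k _ (λ h → ext (λ { zero → refl ; (suc i) → h i })))
                (∑-cong (vecs k n) (λ c → ext (λ { zero → refl ; (suc i) → refl }))))))
       (sym (∑-cartesianProductWith _∷_ (allFin k) (vecs k n) (F ∘ lookup))))

  -- Colourings that are proper on a vertex set

  _∈ˢ_ : Fin n → VSet n → Set
  v ∈ˢ D = D v ≡ true

  ProperOn : Graph n → VSet n → Vec (Fin k) n → Set
  ProperOn A D c = ∀ i j → i ∈ˢ D → j ∈ˢ D → Adj A i j → lookup c i ≢ lookup c j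

  abstract
    properOn? : (A : Graph n) (D : VSet n) (c : Vec (Fin k) n) → Dec (ProperOn A D c)
    properOn? A D c = all? λ i → all? λ j → (D i Bool.≟ true) →-dec ((D j Bool.≟ true) →-dec
      ((adj A i j Bool.≟ true) →-dec ¬? (lookup c i Fin.≟ lookup c j)))

  -- The vertices outside D carry arbitrary colours, so this is k ^ (n - size D) times the number of colourings of D.
  #col : ∀ k → Graph n → VSet n → ℕ
  #col {n} k A D = ∑ (vecs k n) (λ c → 𝟙 (properOn? A D c))

  chromPoly≡#col : ∀ k (A : Graph n) → chromPoly A k ≡ #col k A (λ _ → true)
  chromPoly≡#col {n} k A = begin
    chromPoly A k                                         ≡⟨ length-filter-∑ (proper? A) (allFunctions n k) ⟩
    ∑ (allFunctions n k) (λ c → 𝟙 (proper? A c))          ≡⟨ ∑-allFunctions n k (λ c → 𝟙 (proper? A c)) (λ {f} {g} h → 𝟙-cong (proper? A f) (proper? A g) (transport h) (transport (sym ∘ h))) ⟩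
    ∑ (vecs k n) (λ c → 𝟙 (proper? A (lookup c)))         ≡⟨ ∑-cong (vecs k n) (λ c → 𝟙-cong (proper? A (lookup c)) (properOn? A _ c) (λ p i j _ _ → p i j) (λ p i j → p i j refl refl)) ⟩
    #col k A (λ _ → true)                                 ∎
    where
    open ≡-Reasoning
    transport : {f g : Fin n → Fin k} → f ≗ g → Proper A f → Proper A g
    transport h p i j a e = p i j a (trans (h i) (trans e (sym (h j))))

  -- A relation and not an operation: without function extensionality it treats alike the removal
  -- and the addition of a vertex, the steps `DeleteStep` towards the 2-core and the initial
  -- segments of an ordering.
  record Ins (D : VSet n) (v : Fin n) (D′ : VSet n) : Set where
    field
      fresh : ¬ (v ∈ˢ D)
      new   : v ∈ˢ D′
      old   : ∀ {u} → u ∈ˢ D → u ∈ˢ D′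
      back  : ∀ {u} → u ∈ˢ D′ → u ≡ v ⊎ u ∈ˢ D

  open Ins public

  𝟙ˢ : (D : VSet n) (u : Fin n) → ⟪ D u ⟫ ≡ 𝟙 (D u Bool.≟ true)
  𝟙ˢ D u with D u
  ... | true  = refl
  ... | false = refl

  Ins-⟪⟫ : {D D′ : VSet n} {v : Fin n} → Ins D v D′ → ∀ u → ⟪ D′ u ⟫ ≡ 𝟙 (u Fin.≟ v) + ⟪ D u ⟫
  Ins-⟪⟫ {D = D} {D′} {v} I u with u Fin.≟ v | D′ u in e′ | D u in e
  ... | yes refl | _     | true  = ⊥-elim (fresh I e)
  ... | yes refl | true  | false = refl
  ... | yes refl | false | false with trans (sym (new I)) e′
  ...   | ()
  Ins-⟪⟫ I u | no _   | true  | true  = refl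
  Ins-⟪⟫ I u | no _   | false | false = refl
  Ins-⟪⟫ I u | no _   | false | true with trans (sym (old I e)) e′
  ...   | ()
  Ins-⟪⟫ I u | no u≢v | true  | false with back I e′
  ...   | inj₁ u≡v = ⊥-elim (u≢v u≡v)
  ...   | inj₂ u∈D with trans (sym u∈D) e
  ...     | ()

  size-Ins : {D D′ : VSet n} {v : Fin n} → Ins D v D′ → size D′ ≡ suc (size D)
  size-Ins {n} {D} {D′} {v} I = trans (∑-cong (allFin n) (Ins-⟪⟫ I))
    (trans (∑-+ (allFin n) (λ u → 𝟙 (u Fin.≟ v)) (λ u → ⟪ D u ⟫)) (cong (_+ size D) (∑-δ₁ n v)))

  _∖_ : VSet n → Fin n → VSet n
  (D ∖ v) u = D u ∧ not (does (u Fin.≟ v))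

  _⊕_ : VSet n → Fin n → VSet n
  (D ⊕ v) u = D u ∨ does (u Fin.≟ v)

  Ins-delete : {D D′ : VSet n} {v : Fin n} → v ∈ˢ D → (∀ u → D′ u ≡ (D ∖ v) u) → Ins D′ v D
  Ins-delete {D = D} {D′} {v} v∈D h = record
    { fresh = λ e → no-v (trans (sym (h v)) e)
    ; new   = v∈D
    ; old   = λ {u} e → left (trans (sym (h u)) e)
    ; back  = λ {u} → bk u }
    where
    no-v : (D ∖ v) v ≡ true → ⊥
    no-v e rewrite dec-true (v Fin.≟ v) refl with trans (sym (∧-zeroʳ (D v))) e
    ... | ()
    left : ∀ {a b} → a ∧ b ≡ true → a ≡ true
    left {true} e = refl
    bk : ∀ u → u ∈ˢ D → u ≡ v ⊎ u ∈ˢ D′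
    bk u u∈D with u Fin.≟ v in eq
    ... | yes p = inj₁ p
    ... | no q  = inj₂ (trans (h u) (trans (cong₂ _∧_ u∈D (cong (not ∘ does) eq)) refl))

  Ins-∖ : {D : VSet n} {v : Fin n} → v ∈ˢ D → Ins (D ∖ v) v D
  Ins-∖ v∈D = Ins-delete v∈D (λ _ → refl)

  Ins-⊕ : {D : VSet n} {v : Fin n} → ¬ (v ∈ˢ D) → Ins D v (D ⊕ v)
  Ins-⊕ {D = D} {v} v∉D = record
    { fresh = v∉D
    ; new   = nw
    ; old   = λ {u} e → cong (_∨ does (u Fin.≟ v)) e
    ; back  = λ {u} → bk u }
    where
    nw : (D ⊕ v) v ≡ true
    nw rewrite dec-true (v Fin.≟ v) refl with D v
    ... | true  = refl
    ... | false = refl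
    bk : ∀ u → (D ⊕ v) u ≡ true → u ≡ v ⊎ u ∈ˢ D
    bk u e with D u | u Fin.≟ v
    ... | true  | _     = inj₂ refl
    ... | false | yes p = inj₁ p

  Free : Graph n → VSet n → Fin n → Vec (Fin k) n → Fin k → Set
  Free A D v c a = ∀ y → y ∈ˢ D → Adj A v y → lookup c y ≢ a

  abstract
    free? : (A : Graph n) (D : VSet n) (v : Fin n) (c : Vec (Fin k) n) (a : Fin k) → Dec (Free A D v c a)
    free? A D v c a = all? λ y → (D y Bool.≟ true) →-dec ((adj A v y Bool.≟ true) →-dec ¬? (lookup c y Fin.≟ a))

  #free : Graph n → VSet n → Fin n → Vec (Fin k) n → ℕ
  #free {k = k} A D v c = ∑ (allFin k) (λ a → 𝟙 (free? A D v c a))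

  Free-cong : {A : Graph n} {D : VSet n} {v : Fin n} {c c′ : Vec (Fin k) n} →
              (∀ y → y ∈ˢ D → lookup c y ≡ lookup c′ y) → ∀ {a} → Free A D v c a → Free A D v c′ a
  Free-cong h F y y∈D vy e = F y y∈D vy (trans (h y y∈D) e)

  #free-cong : (A : Graph n) (D : VSet n) (v : Fin n) {c c′ : Vec (Fin k) n} →
               (∀ y → y ∈ˢ D → lookup c y ≡ lookup c′ y) → #free A D v c ≡ #free A D v c′
  #free-cong {k = k} A D v {c} {c′} h = ∑-cong (allFin k) (λ a → 𝟙-cong (free? A D v c a) (free? A D v c′ a)
    (Free-cong {A = A} {c = c} {c′} h) (Free-cong {A = A} {c = c′} {c} (λ y y∈ → sym (h y y∈))))

  adj-≢ : (A : Graph n) {u v : Fin n} → Adj A u v → u ≢ v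
  adj-≢ A {u} uv refl with trans (sym uv) (adj-irrefl A u)
  ... | ()

  ProperOn-extend : (A : Graph n) {D D′ : VSet n} {v : Fin n} → Ins D v D′ → (c : Vec (Fin k) n) (a : Fin k) →
    ProperOn A D c → Free A D v c a → ProperOn A D′ (c [ v ]≔ a)
  ProperOn-extend A {D} {v = v} I c a p F i j i∈ j∈ ij e with back I i∈ | back I j∈
  ... | inj₁ refl | inj₁ refl = adj-≢ A ij refl
  ... | inj₁ refl | inj₂ j∈D  = F j j∈D ij (trans (sym (lookup∘update′ (adj-≢ A ij ∘ sym) c a)) (trans (sym e) (lookup∘update v c a)))
  ... | inj₂ i∈D  | inj₁ refl = F i i∈D (trans (adj-sym A v i) ij) (trans (sym (lookup∘update′ (adj-≢ A ij) c a)) (trans e (lookup∘update v c a)))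
  ... | inj₂ i∈D  | inj₂ j∈D  = p i j i∈D j∈D ij (trans (sym (off i∈D)) (trans e (off j∈D)))
    where
    off : ∀ {y} → y ∈ˢ D → lookup (c [ v ]≔ a) y ≡ lookup c y
    off y∈ = lookup∘update′ (λ { refl → fresh I y∈ }) c a

  -- Recolouring v decouples the colour of v from the colouring of the rest.
  #col-step : (A : Graph n) {D D′ : VSet n} {v : Fin n} → Ins D v D′ →
    (w : Vec (Fin k) n → ℕ) → (∀ c a → w (c [ v ]≔ a) ≡ w c) →
    k * ∑ (vecs k n) (λ c → 𝟙 (properOn? A D′ c) * w c) ≡
    ∑ (vecs k n) (λ c → 𝟙 (properOn? A D c) * (#free A D v c * w c))
  #col-step {n} {k} A {D} {D′} {v} I w w-inv =
    trans (∑-resample v (λ c → 𝟙 (properOn? A D′ c) * w c)) (∑-cong (vecs k n) pointwise)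
    where
    off : ∀ c a {y} → y ∈ˢ D → lookup (c [ v ]≔ a) y ≡ lookup c y
    off c a {y} y∈ = lookup∘update′ (λ { refl → fresh I y∈ }) c a
    down : ∀ c a → ProperOn A D′ (c [ v ]≔ a) → ProperOn A D c
    down c a p i j i∈ j∈ ij e = p i j (old I i∈) (old I j∈) ij
      (trans (off c a i∈) (trans e (sym (off c a j∈))))
    fr : ∀ c a → ProperOn A D′ (c [ v ]≔ a) → Free A D v c a
    fr c a p y y∈ vy e = p v y (new I) (old I y∈) vy
      (trans (lookup∘update v c a) (trans (sym e) (sym (off c a y∈))))
    pointwise : ∀ c → ∑ (allFin k) (λ a → 𝟙 (properOn? A D′ (c [ v ]≔ a)) * w (c [ v ]≔ a)) ≡
                      𝟙 (properOn? A D c) * (#free A D v c * w c)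
    pointwise c with properOn? A D c
    ... | no ¬p = ∑-zero (allFin k) _ (λ a → cong (_* w (c [ v ]≔ a)) (𝟙-no (properOn? A D′ (c [ v ]≔ a)) (¬p ∘ down c a)))
    ... | yes p = begin
      ∑ (allFin k) (λ a → 𝟙 (properOn? A D′ (c [ v ]≔ a)) * w (c [ v ]≔ a))
        ≡⟨ ∑-cong (allFin k) (λ a → trans (cong₂ _*_ (𝟙-cong (properOn? A D′ (c [ v ]≔ a)) (free? A D v c a) (fr c a) (ProperOn-extend A I c a p)) (w-inv c a)) (*-comm _ (w c))) ⟩
      ∑ (allFin k) (λ a → w c * 𝟙 (free? A D v c a))
        ≡⟨ ∑-*ˡ (allFin k) (w c) _ ⟩
      w c * #free A D v c
        ≡⟨ *-comm (w c) _ ⟩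
      #free A D v c * w c
        ≡⟨ +-identityʳ _ ⟨
      1 * (#free A D v c * w c) ∎
      where open ≡-Reasoning

  #col-step₁ : (A : Graph n) {D D′ : VSet n} {v : Fin n} → Ins D v D′ →
    k * #col k A D′ ≡ ∑ (vecs k n) (λ c → 𝟙 (properOn? A D c) * #free A D v c)
  #col-step₁ {n} {k} A {D} {D′} {v} I = begin
    k * #col k A D′
      ≡⟨ cong (k *_) (∑-cong (vecs k n) (λ c → sym (*-identityʳ _))) ⟩
    k * ∑ (vecs k n) (λ c → 𝟙 (properOn? A D′ c) * 1)
      ≡⟨ #col-step A I (λ _ → 1) (λ _ _ → refl) ⟩
    ∑ (vecs k n) (λ c → 𝟙 (properOn? A D c) * (#free A D v c * 1))
      ≡⟨ ∑-cong (vecs k n) (λ c → cong (𝟙 (properOn? A D c) *_) (*-identityʳ _)) ⟩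
    ∑ (vecs k n) (λ c → 𝟙 (properOn? A D c) * #free A D v c) ∎
    where open ≡-Reasoning

  -- Bounds on the number of free colours

  abstract
    _∈ᶠ?_ : (b : Fin k) (as : List (Fin k)) → Dec (b ∈ as)
    b ∈ᶠ? as = DecMem._∈?_ Fin._≟_ b as

  ∉-count : (as : List (Fin k)) → Unique as → ∑ (allFin k) (λ b → 𝟙 (¬? (b ∈ᶠ? as))) + length as ≡ k
  ∉-count {k} [] _ = trans (+-identityʳ _)
    (trans (∑-cong (allFin k) (λ b → 𝟙-yes (¬? (b ∈ᶠ? [])) λ ())) (trans (∑-allFin-const k 1) (*-identityʳ k)))
  ∉-count {k} (a ∷ as) (a∉ ∷ u) = begin
    ∑ (allFin k) (λ b → 𝟙 (¬? (b ∈ᶠ? (a ∷ as)))) + suc (length as)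
      ≡⟨ shuffle _ (length as) ⟩
    (1 + ∑ (allFin k) (λ b → 𝟙 (¬? (b ∈ᶠ? (a ∷ as))))) + length as
      ≡⟨ cong (λ z → (z + ∑ (allFin k) (λ b → 𝟙 (¬? (b ∈ᶠ? (a ∷ as))))) + length as) (∑-δ₁ k a) ⟨
    (∑ (allFin k) (λ b → 𝟙 (b Fin.≟ a)) + ∑ (allFin k) (λ b → 𝟙 (¬? (b ∈ᶠ? (a ∷ as))))) + length as
      ≡⟨ cong (_+ length as) (∑-+ (allFin k) (λ b → 𝟙 (b Fin.≟ a)) _) ⟨
    ∑ (allFin k) (λ b → 𝟙 (b Fin.≟ a) + 𝟙 (¬? (b ∈ᶠ? (a ∷ as)))) + length as
      ≡⟨ cong (_+ length as) (∑-cong (allFin k) split) ⟩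
    ∑ (allFin k) (λ b → 𝟙 (¬? (b ∈ᶠ? as))) + length as
      ≡⟨ ∉-count as u ⟩
    k ∎
    where
    open ≡-Reasoning
    shuffle : ∀ x y → x + suc y ≡ 1 + x + y
    shuffle = solve-∀
    split : ∀ b → 𝟙 (b Fin.≟ a) + 𝟙 (¬? (b ∈ᶠ? (a ∷ as))) ≡ 𝟙 (¬? (b ∈ᶠ? as))
    split b with b Fin.≟ a
    ... | yes refl = trans (cong suc (𝟙-no (¬? (b ∈ᶠ? (b ∷ as))) (λ h → h (here refl))))
                           (sym (𝟙-yes (¬? (b ∈ᶠ? as)) (λ b∈ → All.lookup a∉ b∈ refl)))
    ... | no b≢a = 𝟙-cong (¬? (b ∈ᶠ? (a ∷ as))) (¬? (b ∈ᶠ? as)) (λ h → h ∘ there)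
                     (λ { h (here e) → b≢a e ; h (there p) → h p })

  #free-upper : (A : Graph n) (D : VSet n) (v : Fin n) (c : Vec (Fin k) n) (ys : List (Fin n)) →
    All (λ y → y ∈ˢ D × Adj A v y) ys → Unique (map (lookup c) ys) → #free A D v c + length ys ≤ k
  #free-upper {k = k} A D v c ys good u = begin
    #free A D v c + length ys
      ≤⟨ +-monoˡ-≤ _ (∑-mono (allFin k) (λ a → 𝟙-mono (free? A D v c a) (¬? (a ∈ᶠ? map (lookup c) ys)) (avoid a))) ⟩
    ∑ (allFin k) (λ a → 𝟙 (¬? (a ∈ᶠ? map (lookup c) ys))) + length ys
      ≡⟨ cong (∑ (allFin k) (λ a → 𝟙 (¬? (a ∈ᶠ? map (lookup c) ys))) +_) (length-map (lookup c) ys) ⟨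
    ∑ (allFin k) (λ a → 𝟙 (¬? (a ∈ᶠ? map (lookup c) ys))) + length (map (lookup c) ys)
      ≡⟨ ∉-count _ u ⟩
    k ∎
    where
    open ≤-Reasoning
    avoid : ∀ a → Free A D v c a → a ∉ map (lookup c) ys
    avoid a F p with ∈-map⁻ (lookup c) p
    ... | y , y∈ , refl = F y (proj₁ (All.lookup good y∈)) (proj₂ (All.lookup good y∈)) refl

  #free-upper₁ : (A : Graph n) (D : VSet n) (v : Fin n) (c : Vec (Fin (suc k)) n) {y : Fin n} →
    y ∈ˢ D → Adj A v y → #free A D v c ≤ k
  #free-upper₁ {k = k} A D v c {y} y∈ vy = s≤s⁻¹ (subst (_≤ suc k) (+-comm (#free A D v c) 1)
    (#free-upper A D v c (y ∷ []) ((y∈ , vy) ∷ []) ([] ∷ [])))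

  #free-upper₀ : (A : Graph n) (D : VSet n) (v : Fin n) (c : Vec (Fin k) n) → #free A D v c ≤ k
  #free-upper₀ A D v c = subst (_≤ _) (+-identityʳ (#free A D v c)) (#free-upper A D v c [] [] [])

  -- A neighbour blocks just one colour: `N a` counts the neighbours of colour a, and it is positive
  -- whenever a is not free.
  #free-lower : (A : Graph n) (D : VSet n) (v : Fin n) (c : Vec (Fin k) n) → k ≤ #free A D v c + degIn A D v
  #free-lower {n} {k} A D v c = begin
    k                                                 ≡⟨ trans (∑-allFin-const k 1) (*-identityʳ k) ⟨
    ∑ (allFin k) (λ _ → 1)                            ≤⟨ ∑-mono (allFin k) one ⟩
    ∑ (allFin k) (λ a → 𝟙 (free? A D v c a) + N a)    ≡⟨ ∑-+ (allFin k) (λ a → 𝟙 (free? A D v c a)) N ⟩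
    #free A D v c + ∑ (allFin k) N                    ≡⟨ cong (#free A D v c +_) (∑-swap (allFin k) (allFin n) _) ⟩
    #free A D v c + ∑ (allFin n) (λ y → ∑ (allFin k) (λ a → ⟪ D y ∧ adj A v y ⟫ * 𝟙 (a Fin.≟ lookup c y)))
      ≡⟨ cong (#free A D v c +_) (∑-cong (allFin n) (λ y → trans (∑-*ˡ (allFin k) ⟪ D y ∧ adj A v y ⟫ _)
           (trans (cong (⟪ D y ∧ adj A v y ⟫ *_) (∑-δ₁ k (lookup c y))) (*-identityʳ _)))) ⟩
    #free A D v c + degIn A D v                       ∎
    where
    open ≤-Reasoning
    N : Fin k → ℕ
    N a = ∑ (allFin n) (λ y → ⟪ D y ∧ adj A v y ⟫ * 𝟙 (a Fin.≟ lookup c y))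
    one : ∀ a → 1 ≤ 𝟙 (free? A D v c a) + N a
    one a with free? A D v c a
    ... | yes _ = s≤s z≤n
    ... | no ¬F with any? (λ y → (D y Bool.≟ true) ×-dec ((adj A v y Bool.≟ true) ×-dec (lookup c y Fin.≟ a)))
    ...   | no ¬ex = ⊥-elim (¬F (λ y y∈ vy e → ¬ex (y , y∈ , vy , e)))
    ...   | yes (y , y∈ , vy , e) = ≤-trans (≤-reflexive (sym val)) (∑-≥ (allFin n) _ (∈-allFin y))
      where
      val : ⟪ D y ∧ adj A v y ⟫ * 𝟙 (a Fin.≟ lookup c y) ≡ 1
      val rewrite y∈ | vy = trans (+-identityʳ _) (𝟙-yes (a Fin.≟ lookup c y) (sym e))

  -- Vertex sets, colourability and connectivity

  _⊆ˢ_ : VSet n → VSet n → Set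
  D ⊆ˢ E = ∀ {u} → u ∈ˢ D → u ∈ˢ E

  ⟪⟫-mono : ∀ {a b} → (a ≡ true → b ≡ true) → ⟪ a ⟫ ≤ ⟪ b ⟫
  ⟪⟫-mono {false} h = z≤n
  ⟪⟫-mono {true}  h rewrite h refl = ≤-refl

  ∧-true : ∀ {a b} → a ∧ b ≡ true → a ≡ true × b ≡ true
  ∧-true {true} e = refl , e

  size-mono : {D E : VSet n} → D ⊆ˢ E → size D ≤ size E
  size-mono {n} h = ∑-mono (allFin n) (λ u → ⟪⟫-mono h)

  ∈ˢ-size : (D : VSet n) (u : Fin n) → u ∈ˢ D → 1 ≤ size D
  ∈ˢ-size {n} D u u∈ = ≤-trans (≤-reflexive (cong ⟪_⟫ (sym u∈))) (∑-≥ (allFin n) (λ i → ⟪ D i ⟫) (∈-allFin u))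

  degIn-mono : (A : Graph n) {D E : VSet n} (v : Fin n) → (∀ {u} → u ∈ˢ D → Adj A v u → u ∈ˢ E) → degIn A D v ≤ degIn A E v
  degIn-mono A {D} {E} v h = size-mono {D = λ u → D u ∧ adj A v u} {λ u → E u ∧ adj A v u} (λ e → let a , b = ∧-true e in cong₂ _∧_ (h a b) b)

  ⊈⇒∃ : {D E : VSet n} → size D < size E → ∃ λ v → v ∈ˢ E × D v ≡ false
  ⊈⇒∃ {D = D} {E} lt with any? (λ v → (E v Bool.≟ true) ×-dec (D v Bool.≟ false))
  ... | yes p = p
  ... | no ¬p = ⊥-elim (<⇒≱ lt (size-mono (λ {u} u∈E → ¬-not (λ u∉D → ¬p (u , u∈E , u∉D)))))

  elements : VSet n → List (Fin n)
  elements {n} D = filter (λ u → D u Bool.≟ true) (allFin n)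

  elements-unique : (D : VSet n) → Unique (elements D)
  elements-unique {n} D = Uniq.filter⁺ _ (Uniq.allFin⁺ n)

  length-elements : (D : VSet n) → length (elements D) ≡ size D
  length-elements {n} D = trans (length-filter-∑ _ (allFin n)) (∑-cong (allFin n) (λ u → sym (𝟙ˢ D u)))

  elements-∈ : (D : VSet n) → All (_∈ˢ D) (elements D)
  elements-∈ {n} D = All.tabulate (λ u∈ → proj₂ (∈-filter⁻ (λ u → D u Bool.≟ true) {xs = allFin n} u∈))

  two-elements : (D : VSet n) → 2 ≤ size D → ∃₂ λ x y → x ≢ y × x ∈ˢ D × y ∈ˢ D
  two-elements D h with elements D | elements-unique D | length-elements D | elements-∈ D
  ... | []        | _               | e | _             = ⊥-elim (<⇒≱ h (≤-trans (≤-reflexive (sym e)) z≤n))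
  ... | _ ∷ []    | _               | e | _             = ⊥-elim (<⇒≱ h (≤-reflexive (sym e)))
  ... | x ∷ y ∷ _ | (x≢y ∷ _) ∷ _   | e | x∈ ∷ y∈ ∷ _   = x , y , x≢y , x∈ , y∈

  three-elements : (D : VSet n) → 3 ≤ size D →
    ∃ λ x → ∃₂ λ y z → Unique (x ∷ y ∷ z ∷ []) × All (_∈ˢ D) (x ∷ y ∷ z ∷ [])
  three-elements D h with elements D | elements-unique D | length-elements D | elements-∈ D
  ... | []            | _ | e | _ = ⊥-elim (<⇒≱ h (≤-trans (≤-reflexive (sym e)) z≤n))
  ... | _ ∷ []        | _ | e | _ = ⊥-elim (<⇒≱ h (≤-trans (≤-reflexive (sym e)) (s≤s z≤n)))
  ... | _ ∷ _ ∷ []    | _ | e | _ = ⊥-elim (<⇒≱ h (≤-reflexive (sym e)))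
  ... | x ∷ y ∷ z ∷ _ | (x≢y ∷ x≢z ∷ _) ∷ (y≢z ∷ _) ∷ _ | e | x∈ ∷ y∈ ∷ z∈ ∷ _ =
    x , y , z , (x≢y ∷ x≢z ∷ []) ∷ (y≢z ∷ []) ∷ [] ∷ [] , x∈ ∷ y∈ ∷ z∈ ∷ []

  ColOn : Graph n → VSet n → ℕ → Set
  ColOn {n} A D m = ∃ λ (c : Vec (Fin m) n) → ProperOn A D c

  colOn? : (A : Graph n) (D : VSet n) (m : ℕ) → Dec (ColOn A D m)
  colOn? {n} A D m = map′ satisfied (λ (c , p) → lose (∈-vecs c) p) (Any.any? (properOn? A D) (vecs m n))

  ProperOn-⊆ : {A : Graph n} {D E : VSet n} {c : Vec (Fin k) n} → D ⊆ˢ E → ProperOn A E c → ProperOn A D c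
  ProperOn-⊆ h p i j i∈ j∈ = p i j (h i∈) (h j∈)

  ∑𝟙-witness : {X : Set} {R : X → Set} (R? : ∀ x → Dec (R x)) (xs : List X) → 1 ≤ ∑ xs (λ x → 𝟙 (R? x)) → ∃ R
  ∑𝟙-witness R? (x ∷ xs) h with R? x
  ... | yes p = x , p
  ... | no _  = ∑𝟙-witness R? xs h

  ColOn-extend : (A : Graph n) {D D′ : VSet n} {v : Fin n} → Ins D v D′ → degIn A D v < m → ColOn A D m → ColOn A D′ m
  ColOn-extend {m = m} A {D} {v = v} I deg<m (c , p) =
    let a , F = ∑𝟙-witness (free? A D v c) (allFin m) some
    in c [ v ]≔ a , ProperOn-extend A I c a p F
    where
    some : 1 ≤ #free A D v c
    some = +-cancelʳ-≤ (degIn A D v) 1 _ (≤-trans deg<m (#free-lower A D v c))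

  -- Connectivity of S by crossing edges instead of walks. A cut can be pulled back along an
  -- identification of vertices, and the crossing edge is exactly what is needed to grow a set by
  -- one adjacent vertex.
  CutConn : Graph n → VSet n → Set
  CutConn A S = ∀ (Q : VSet _) {u v} → u ∈ˢ S → v ∈ˢ S → Q u ≡ true → Q v ≡ false →
    ∃₂ λ x y → x ∈ˢ S × y ∈ˢ S × Q x ≡ true × Q y ≡ false × Adj A x y

  -- If Q separates v from y, their edge crosses the cut. Otherwise y lies on the side of v and
  -- serves as the endpoint inside D.
  CutConn-⊕ : (A : Graph n) {D D′ : VSet n} {v y : Fin n} → Ins D v D′ → y ∈ˢ D → Adj A y v → CutConn A D → CutConn A D′
  CutConn-⊕ A {D} {D′} {v} {y} I y∈ yv conn Q {a} {b} a∈ b∈ Qa Qb with Q v in ev | Q y in ey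
  ... | true  | false = v , y , new I , old I y∈ , ev , ey , trans (adj-sym A v y) yv
  ... | false | true  = y , v , old I y∈ , new I , ey , ev , yv
  ... | true  | true  with back I b∈
  ...   | inj₁ refl with trans (sym ev) Qb
  ...     | ()
  CutConn-⊕ A I y∈ yv conn Q a∈ b∈ Qa Qb | true | true | inj₂ b∈D =
    let p , q , p∈ , q∈ , rest = conn Q y∈ b∈D ey Qb in p , q , old I p∈ , old I q∈ , rest
  CutConn-⊕ A I y∈ yv conn Q a∈ b∈ Qa Qb | false | false with back I a∈
  ...   | inj₁ refl with trans (sym Qa) ev
  ...     | ()
  CutConn-⊕ A I y∈ yv conn Q a∈ b∈ Qa Qb | false | false | inj₂ a∈D =
    let p , q , p∈ , q∈ , rest = conn Q a∈D y∈ Qa ey in p , q , old I p∈ , old I q∈ , rest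

  -- Vertex-critical sets

  Critical : Graph n → ℕ → VSet n → Set
  Critical A r T = ¬ ColOn A T r × (∀ {v} → v ∈ˢ T → ColOn A (T ∖ v) r)

  ∃-critical : (A : Graph n) (r : ℕ) (S : VSet n) → ¬ ColOn A S r → ∃ λ T → T ⊆ˢ S × Critical A r T
  ∃-critical A r S = go (size S) S ≤-refl
    where
    go : ∀ s S → size S ≤ s → ¬ ColOn A S r → ∃ λ T → T ⊆ˢ S × Critical A r T
    go s S le ¬col with any? (λ v → (S v Bool.≟ true) ×-dec ¬? (colOn? A (S ∖ v) r))
    go s S le ¬col | no none = S , id , ¬col , crit
      where
      crit : ∀ {v} → v ∈ˢ S → ColOn A (S ∖ v) r
      crit {v} v∈ with colOn? A (S ∖ v) r
      ... | yes col = col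
      ... | no ¬c   = ⊥-elim (none (v , v∈ , ¬c))
    go zero S le ¬col | yes (v , v∈ , ¬c) = ⊥-elim (<⇒≱ (∈ˢ-size S v v∈) le)
    go (suc s) S le ¬col | yes (v , v∈ , ¬c) =
      let I = Ins-∖ {D = S} {v} v∈
          T , T⊆ , crit = go s (S ∖ v) (s≤s⁻¹ (≤-trans (≤-reflexive (sym (size-Ins I))) le)) ¬c
      in T , (λ u∈ → old I (T⊆ u∈)) , crit

  critical-degree : (A : Graph n) {T : VSet n} → Critical A r T → ∀ {v} → v ∈ˢ T → r ≤ degIn A T v
  critical-degree A {T} (¬col , crit) {v} v∈ = let I = Ins-∖ {D = T} {v} v∈ in ≮⇒≥ (λ lt →
    ¬col (ColOn-extend A I (≤-<-trans (degIn-mono A v (λ u∈ _ → old I u∈)) lt) (crit v∈)))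

  -- Two colourings that each miss one side of an uncrossed cut can be glued along it.
  critical-connected : (A : Graph n) {T : VSet n} → Critical A r T → CutConn A T
  critical-connected {n} {r} A {T} (¬col , crit) Q {u} {v} u∈ v∈ Qu Qv
    with any? (λ x → any? (λ y → (T x Bool.≟ true) ×-dec (T y Bool.≟ true) ×-dec (Q x Bool.≟ true) ×-dec (Q y Bool.≟ false) ×-dec (adj A x y Bool.≟ true)))
  ... | yes p = p
  ... | no none = ⊥-elim (¬col (tabulate col , proper))
    where
    c₁ = proj₁ (crit v∈)
    c₂ = proj₁ (crit u∈)
    col : Fin n → Fin r
    col x = if Q x then lookup c₁ x else lookup c₂ x
    stay : ∀ {x w b} → w ∈ˢ T → x ∈ˢ T → Q w ≡ not b → Q x ≡ b → x ∈ˢ (T ∖ w)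
    stay {x} {w} w∈ x∈ Qw Qx with back (Ins-∖ {D = T} {w} w∈) {x} x∈
    ... | inj₂ p    = p
    ... | inj₁ refl = ⊥-elim (not-¬ Qx Qw)
    proper : ProperOn A T (tabulate col)
    proper i j i∈ j∈ ij e = proper′ (trans (sym (lookup∘tabulate col i)) (trans e (lookup∘tabulate col j)))
      where
      proper′ : col i ≢ col j
      proper′ e with Q i in ei | Q j in ej
      ... | true  | true  = proj₂ (crit v∈) i j (stay v∈ i∈ Qv ei) (stay v∈ j∈ Qv ej) ij e
      ... | false | false = proj₂ (crit u∈) i j (stay u∈ i∈ Qu ei) (stay u∈ j∈ Qu ej) ij e
      ... | true  | false = none (i , j , i∈ , j∈ , ei , ej , ij)
      ... | false | true  = none (j , i , j∈ , i∈ , ej , ei , trans (adj-sym A j i) ij)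

  critical-nonempty : (A : Graph n) {T : VSet n} → Critical A (suc r) T → ∃ λ v → v ∈ˢ T
  critical-nonempty {n} A {T} (¬col , _) with any? (λ v → T v Bool.≟ true)
  ... | yes p = p
  ... | no ¬p = ⊥-elim (¬col (replicate n zero , λ i j i∈ → ⊥-elim (¬p (i , i∈))))

  closed-nbhd : (A : Graph n) (T : VSet n) {v : Fin n} → v ∈ˢ T → ∀ u → 𝟙 (u Fin.≟ v) + ⟪ T u ∧ adj A v u ⟫ ≤ ⟪ T u ⟫
  closed-nbhd A T {v} v∈ u with u Fin.≟ v
  ... | yes refl rewrite v∈ | adj-irrefl A v = ≤-refl
  ... | no _ = ⟪⟫-mono (proj₁ ∘ ∧-true)

  closed-nbhd-∑ : (A : Graph n) (T : VSet n) (v : Fin n) →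
    ∑ (allFin n) (λ u → 𝟙 (u Fin.≟ v) + ⟪ T u ∧ adj A v u ⟫) ≡ suc (degIn A T v)
  closed-nbhd-∑ {n} A T v = trans (∑-+ (allFin n) (λ u → 𝟙 (u Fin.≟ v)) _) (cong (_+ degIn A T v) (∑-δ₁ n v))

  critical-size : (A : Graph n) {T : VSet n} → Critical A (suc r) T → suc (suc r) ≤ size T
  critical-size {n} A {T} crit = let v , v∈ = critical-nonempty A crit in
    ≤-trans (s≤s (critical-degree A crit v∈))
      (≤-trans (≤-reflexive (sym (closed-nbhd-∑ A T v))) (∑-mono (allFin n) (closed-nbhd A T v∈)))

  -- By `critical-degree` every closed neighbourhood in T has at least r + 1 elements, so it fills T
  -- and the inequality `closed-nbhd` is an equality at every vertex.
  critical-clique : (A : Graph n) {T : VSet n} → Critical A r T → size T ≡ suc r →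
    ∀ u v → u ∈ˢ T → v ∈ˢ T → u ≢ v → Adj A u v
  critical-clique {n} A {T} crit sz u v u∈ v∈ u≢v = proj₂ (∧-true {T v} (fin eq))
    where
    eq : 𝟙 (v Fin.≟ u) + ⟪ T v ∧ adj A u v ⟫ ≡ ⟪ T v ⟫
    eq = ∑-squeeze (allFin n) (closed-nbhd A T u∈)
      (≤-trans (≤-reflexive sz) (≤-trans (s≤s (critical-degree A crit u∈)) (≤-reflexive (sym (closed-nbhd-∑ A T u)))))
      (∈-allFin v)
    fin : 𝟙 (v Fin.≟ u) + ⟪ T v ∧ adj A u v ⟫ ≡ ⟪ T v ⟫ → T v ∧ adj A u v ≡ true
    fin e with v Fin.≟ u
    ... | yes p = ⊥-elim (u≢v (sym p))
    fin e | no _ rewrite v∈ with adj A u v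
    ...   | true = refl

  does⇒ : {P : Set} (d : Dec P) → does d ≡ true → P
  does⇒ (yes p) _ = p

  does-cong : {P Q : Set} (p : Dec P) (q : Dec Q) → (P → Q) → (Q → P) → does p ≡ does q
  does-cong (yes p) q f g = sym (dec-true q (f p))
  does-cong (no ¬p) q f g = sym (dec-false q (¬p ∘ g))

  ∈-∖ : {S : VSet n} {x y : Fin n} → y ∈ˢ S → x ∈ˢ S → x ≢ y → x ∈ˢ (S ∖ y)
  ∈-∖ {S = S} {x} {y} y∈ x∈ x≢y with back (Ins-∖ {D = S} {y} y∈) {x} x∈
  ... | inj₁ e = ⊥-elim (x≢y e)
  ... | inj₂ p = p

  -- Identifying two non-adjacent vertices

  module Merge (A : Graph n) (y₁ y₂ : Fin n) (y₁≢y₂ : y₁ ≢ y₂) (non-adj : ¬ Adj A y₁ y₂) where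

    -- The vertex `y₁` receives the neighbours of `y₂`. Nothing is taken away from `y₂`; it is the
    -- vertex set that loses it, so the vertex type survives the identification.
    MergedAdj : Fin n → Fin n → Set
    MergedAdj x y = Adj A x y ⊎ (x ≡ y₁ × Adj A y₂ y) ⊎ (y ≡ y₁ × Adj A y₂ x)

    mergedAdj? : ∀ x y → Dec (MergedAdj x y)
    mergedAdj? x y = (adj A x y Bool.≟ true) ⊎-dec
      (((x Fin.≟ y₁) ×-dec (adj A y₂ y Bool.≟ true)) ⊎-dec ((y Fin.≟ y₁) ×-dec (adj A y₂ x Bool.≟ true)))

    flip-merged : ∀ {x y} → MergedAdj x y → MergedAdj y x
    flip-merged {x} {y} (inj₁ xy)        = inj₁ (trans (adj-sym A y x) xy)
    flip-merged         (inj₂ (inj₁ p))  = inj₂ (inj₂ p)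
    flip-merged         (inj₂ (inj₂ p))  = inj₂ (inj₁ p)

    loop-free : ∀ {x} → ¬ MergedAdj x x
    loop-free (inj₁ xx) = adj-≢ A xx refl
    loop-free (inj₂ (inj₁ (refl , e))) = non-adj (trans (adj-sym A y₁ y₂) e)
    loop-free (inj₂ (inj₂ (refl , e))) = non-adj (trans (adj-sym A y₁ y₂) e)

    merged : Graph n
    merged = record
      { adj    = λ x y → does (mergedAdj? x y)
      ; sym    = λ x y → does-cong (mergedAdj? x y) (mergedAdj? y x) flip-merged flip-merged
      ; irrefl = λ x → dec-false (mergedAdj? x x) loop-free }

    merged⁺ : ∀ {x y} → MergedAdj x y → Adj merged x y
    merged⁺ {x} {y} = dec-true (mergedAdj? x y)

    merged⁻ : ∀ {x y} → Adj merged x y → MergedAdj x y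
    merged⁻ {x} {y} = does⇒ (mergedAdj? x y)

    φ : Fin n → Fin n
    φ x = if does (x Fin.≟ y₂) then y₁ else x

    φ-adj : ∀ {x y} → Adj A x y → Adj merged (φ x) (φ y)
    φ-adj {x} {y} xy with x Fin.≟ y₂ | y Fin.≟ y₂
    ... | yes refl | yes refl = ⊥-elim (adj-≢ A xy refl)
    ... | yes refl | no _     = merged⁺ (inj₂ (inj₁ (refl , xy)))
    ... | no _     | yes refl = merged⁺ (inj₂ (inj₂ (refl , trans (adj-sym A y₂ x) xy)))
    ... | no _     | no _     = merged⁺ (inj₁ xy)

    module _ {S : VSet n} (y₁∈ : y₁ ∈ˢ S) (y₂∈ : y₂ ∈ˢ S) where

      private I = Ins-∖ {D = S} {y₂} y₂∈

      φ-∈ : ∀ {x} → x ∈ˢ S → φ x ∈ˢ (S ∖ y₂)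
      φ-∈ {x} x∈ with x Fin.≟ y₂
      ... | yes _ = ∈-∖ {S = S} y₂∈ y₁∈ y₁≢y₂
      ... | no x≢ = ∈-∖ {S = S} y₂∈ x∈ x≢

      φ-id : ∀ {x} → x ∈ˢ (S ∖ y₂) → φ x ≡ x
      φ-id {x} x∈ = cong (λ b → if b then y₁ else x) (dec-false (x Fin.≟ y₂) (λ { refl → fresh I x∈ }))

      merged-uncolourable : ¬ ColOn A S m → ¬ ColOn merged (S ∖ y₂) m
      merged-uncolourable {m} ¬col (c , p) = ¬col (tabulate (lookup c ∘ φ) , λ i j i∈ j∈ ij e →
        p (φ i) (φ j) (φ-∈ i∈) (φ-∈ j∈) (φ-adj ij)
          (trans (sym (lookup∘tabulate (lookup c ∘ φ) i)) (trans e (lookup∘tabulate (lookup c ∘ φ) j))))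

      merged-connected : CutConn A S → CutConn merged (S ∖ y₂)
      merged-connected conn Q u∈ v∈ Qu Qv =
        let x , y , x∈ , y∈ , Qx , Qy , xy =
              conn (Q ∘ φ) (old I u∈) (old I v∈) (trans (cong Q (φ-id u∈)) Qu) (trans (cong Q (φ-id v∈)) Qv)
        in φ x , φ y , φ-∈ x∈ , φ-∈ y∈ , Qx , Qy , φ-adj xy

      merged-proper : (c : Vec (Fin k) n) → ProperOn A S (c [ y₂ ]≔ lookup c y₁) → ProperOn merged (S ∖ y₂) c
      merged-proper c p i j i∈ j∈ ij e with merged⁻ {i} {j} ij
      ... | inj₁ q = p i j (old I i∈) (old I j∈) q (trans (off i∈) (trans e (sym (off j∈))))
        where
        off : ∀ {x} → x ∈ˢ (S ∖ y₂) → lookup (c [ y₂ ]≔ lookup c y₁) x ≡ lookup c x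
        off x∈ = lookup∘update′ (λ { refl → fresh I x∈ }) c _
      ... | inj₂ (inj₁ (refl , q)) = p y₂ j y₂∈ (old I j∈) q
        (trans (lookup∘update y₂ c _) (trans e (sym (lookup∘update′ (λ { refl → fresh I j∈ }) c _))))
      ... | inj₂ (inj₂ (refl , q)) = p y₂ i y₂∈ (old I i∈) q
        (trans (lookup∘update y₂ c _) (trans (sym e) (sym (lookup∘update′ (λ { refl → fresh I i∈ }) c _))))

      -- When `y₂` is resampled, exactly one of its k colours agrees with `y₁`, and what remains is
      -- proper for the identified graph. The weight may not see the colour of `y₂`, which is given
      -- up here.
      merged-count : (w : Vec (Fin k) n → ℕ) → (∀ c a → w (c [ y₂ ]≔ a) ≡ w c) →
        k * ∑ (vecs k n) (λ c → 𝟙 (properOn? A S c) * (𝟙 (lookup c y₂ Fin.≟ lookup c y₁) * w c)) ≤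
        ∑ (vecs k n) (λ c → 𝟙 (properOn? merged (S ∖ y₂) c) * w c)
      merged-count {k} w w-inv = ≤-trans (≤-reflexive (∑-resample y₂ _)) (∑-mono (vecs k n) pointwise)
        where
        open ≤-Reasoning
        shuffle : ∀ x y z → x * (y * z) ≡ y * (x * z)
        shuffle = solve-∀
        pointwise : ∀ c → ∑ (allFin k) (λ a → 𝟙 (properOn? A S (c [ y₂ ]≔ a)) *
          (𝟙 (lookup (c [ y₂ ]≔ a) y₂ Fin.≟ lookup (c [ y₂ ]≔ a) y₁) * w (c [ y₂ ]≔ a))) ≤
          𝟙 (properOn? merged (S ∖ y₂) c) * w c
        pointwise c = begin
          ∑ (allFin k) (λ a → 𝟙 (properOn? A S (c [ y₂ ]≔ a)) *
            (𝟙 (lookup (c [ y₂ ]≔ a) y₂ Fin.≟ lookup (c [ y₂ ]≔ a) y₁) * w (c [ y₂ ]≔ a)))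
            ≡⟨ ∑-cong (allFin k) (λ a → trans (cong₂ (λ p q → 𝟙 (properOn? A S (c [ y₂ ]≔ a)) * (p * q))
                 (cong₂ (λ p q → 𝟙 (p Fin.≟ q)) (lookup∘update y₂ c a) (lookup∘update′ y₁≢y₂ c a)) (w-inv c a))
                 (shuffle (𝟙 (properOn? A S (c [ y₂ ]≔ a))) (𝟙 (a Fin.≟ lookup c y₁)) (w c))) ⟩
          ∑ (allFin k) (λ a → 𝟙 (a Fin.≟ lookup c y₁) * (𝟙 (properOn? A S (c [ y₂ ]≔ a)) * w c))
            ≡⟨ ∑-δ k (lookup c y₁) (λ a → 𝟙 (properOn? A S (c [ y₂ ]≔ a)) * w c) ⟩
          𝟙 (properOn? A S (c [ y₂ ]≔ lookup c y₁)) * w c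
            ≤⟨ *-monoˡ-≤ (w c) (𝟙-mono (properOn? A S _) (properOn? merged (S ∖ y₂) c) (merged-proper c)) ⟩
          𝟙 (properOn? merged (S ∖ y₂) c) * w c ∎

  adjacent-distinct : (A : Graph n) {S : VSet n} {x y : Fin n} → x ∈ˢ S → y ∈ˢ S → Adj A x y →
    (w : Vec (Fin k) n → ℕ) →
    ∑ (vecs k n) (λ c → 𝟙 (properOn? A S c) * (𝟙 (lookup c y Fin.≟ lookup c x) * w c)) ≡ 0
  adjacent-distinct {n} {k} A {S} {x} {y} x∈ y∈ xy w = ∑-zero (vecs k n) _ pointwise
    where
    pointwise : ∀ c → 𝟙 (properOn? A S c) * (𝟙 (lookup c y Fin.≟ lookup c x) * w c) ≡ 0
    pointwise c with properOn? A S c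
    ... | no _  = refl
    ... | yes p = trans (+-identityʳ _) (cong (_* w c) (𝟙-no (lookup c y Fin.≟ lookup c x) (λ e → p x y x∈ y∈ xy (sym e))))

  -- Growing a vertex set along edges

  #col-⊆ : ∀ k (A : Graph n) {D E : VSet n} → D ⊆ˢ E → #col k A E ≤ #col k A D
  #col-⊆ {n} k A {D} {E} h = ∑-mono (vecs k n) (λ c → 𝟙-mono (properOn? A E c) (properOn? A D c) (ProperOn-⊆ {A = A} {c = c} h))

  #col-leaf : (A : Graph n) {D D′ : VSet n} {v y : Fin n} → Ins D v D′ → y ∈ˢ D → Adj A y v →
    suc r * #col (suc r) A D′ ≤ r * #col (suc r) A D
  #col-leaf {n} {r} A {D} {D′} {v} {y} I y∈ yv = begin
    suc r * #col (suc r) A D′                                          ≡⟨ #col-step₁ A I ⟩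
    ∑ (vecs _ n) (λ c → 𝟙 (properOn? A D c) * #free A D v c)           ≤⟨ ∑-mono (vecs _ n) (λ c → ≤-trans
       (*-monoʳ-≤ (𝟙 (properOn? A D c)) (#free-upper₁ A D v c y∈ (trans (adj-sym A v y) yv))) (≤-reflexive (*-comm _ r))) ⟩
    ∑ (vecs _ n) (λ c → r * 𝟙 (properOn? A D c))                       ≡⟨ ∑-*ˡ (vecs _ n) r _ ⟩
    r * #col (suc r) A D                                               ∎
    where open ≤-Reasoning

  ⊕-⊆ : {D S : VSet n} {v : Fin n} → ¬ (v ∈ˢ D) → D ⊆ˢ S → v ∈ˢ S → (D ⊕ v) ⊆ˢ S
  ⊕-⊆ {D = D} {S} {v} v∉ D⊆ v∈ {u} u∈ with back (Ins-⊕ {D = D} {v} v∉) {u} u∈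
  ... | inj₁ refl = v∈
  ... | inj₂ u∈D  = D⊆ u∈D

  false⇒∉ : {D : VSet n} {v : Fin n} → D v ≡ false → ¬ (v ∈ˢ D)
  false⇒∉ e e′ with trans (sym e) e′
  ... | ()

  #col-grow : (A : Graph n) {S : VSet n} → CutConn A S → ∀ j {D : VSet n} {u} → D ⊆ˢ S → u ∈ˢ D → j + size D ≡ size S →
    suc r ^ j * #col (suc r) A S ≤ r ^ j * #col (suc r) A D
  #col-grow A conn zero D⊆ u∈ e = *-monoʳ-≤ 1 (#col-⊆ _ A D⊆)
  #col-grow {n} {r} A {S} conn (suc j) {D} D⊆ u∈ e with ⊈⇒∃ {D = D} {S} (≤-trans (s≤s (m≤n+m _ j)) (≤-reflexive e))
  ... | v , v∈ , v∉ with conn D (D⊆ u∈) v∈ u∈ v∉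
  ... | x , y , x∈S , y∈S , x∈ , y∉ , xy = begin
    suc r * suc r ^ j * #col (suc r) A S    ≡⟨ *-assoc (suc r) (suc r ^ j) _ ⟩
    suc r * (suc r ^ j * #col (suc r) A S)  ≤⟨ *-monoʳ-≤ (suc r) (#col-grow A conn j (⊕-⊆ {D = D} {S} (false⇒∉ {D = D} y∉) D⊆ y∈S) (old I u∈)
       (trans (cong (j +_) (size-Ins I)) (trans (+-suc j (size D)) e))) ⟩
    suc r * (r ^ j * #col (suc r) A (D ⊕ y)) ≡⟨ shuffle (suc r) (r ^ j) _ ⟩
    r ^ j * (suc r * #col (suc r) A (D ⊕ y)) ≤⟨ *-monoʳ-≤ (r ^ j) (#col-leaf A I x∈ xy) ⟩
    r ^ j * (r * #col (suc r) A D)           ≡⟨ shuffle′ (r ^ j) r _ ⟩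
    r * r ^ j * #col (suc r) A D             ∎
    where
    open ≤-Reasoning
    I = Ins-⊕ {D = D} {y} (false⇒∉ {D = D} y∉)
    shuffle : ∀ a b c → a * (b * c) ≡ b * (a * c)
    shuffle = solve-∀
    shuffle′ : ∀ a b c → a * (b * c) ≡ b * a * c
    shuffle′ = solve-∀

  -- The falling factorial k ! / m ! with the division cleared. Here m is the number of colours that
  -- the clique leaves over, so a vertex taken out of D had m + 1 colours to choose from.
  #col-clique : ∀ j m {k} (A : Graph n) (D : VSet n) → (∀ u v → u ∈ˢ D → v ∈ˢ D → u ≢ v → Adj A u v) →
    size D ≡ j → j + m ≡ k → #col k A D * (k ^ j * m !) ≡ k ! * k ^ n
  #col-clique {n} zero m {k} A D clique sz refl = begin
    #col m A D * (1 * m !)    ≡⟨ cong₂ _*_ (∑-cong (vecs m n) (λ c → 𝟙-yes (properOn? A D c) (λ i j i∈ → ⊥-elim (<⇒≱ (∈ˢ-size D i i∈) (≤-reflexive sz))))) (*-identityˡ (m !)) ⟩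
    ∑ (vecs m n) (λ _ → 1) * m ! ≡⟨ cong (_* m !) (trans (∑-vecs-const m n 1) (*-identityʳ (m ^ n))) ⟩
    m ^ n * m !               ≡⟨ *-comm (m ^ n) (m !) ⟩
    m ! * m ^ n               ∎
    where open ≡-Reasoning
  #col-clique {n} (suc j) m {k} A D clique sz e with ⊈⇒∃ {D = λ _ → false} {D} (≤-trans (≤-reflexive (cong suc (∑-zero (allFin n) (λ _ → 0) (λ _ → refl)))) (≤-trans (s≤s z≤n) (≤-reflexive (sym sz))))
  ... | v , v∈ , _ = begin
    #col k A D * (k * k ^ j * m !)          ≡⟨ shuffle (#col k A D) k (k ^ j) (m !) ⟩
    k * #col k A D * (k ^ j * m !)          ≡⟨ cong (_* (k ^ j * m !)) step ⟩
    suc m * #col k A (D ∖ v) * (k ^ j * m !) ≡⟨ shuffle′ (suc m) (#col k A (D ∖ v)) (k ^ j) (m !) ⟩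
    #col k A (D ∖ v) * (k ^ j * (suc m * m !)) ≡⟨ #col-clique j (suc m) A (D ∖ v) clique′ sz′ (trans (+-suc j m) e) ⟩
    k ! * k ^ n                             ∎
    where
    open ≡-Reasoning
    shuffle : ∀ a b c d → a * (b * c * d) ≡ b * a * (c * d)
    shuffle = solve-∀
    shuffle′ : ∀ a b c d → a * b * (c * d) ≡ b * (c * (a * d))
    shuffle′ = solve-∀
    I = Ins-∖ {D = D} {v} v∈
    clique′ : ∀ u w → u ∈ˢ (D ∖ v) → w ∈ˢ (D ∖ v) → u ≢ w → Adj A u w
    clique′ u w u∈ w∈ = clique u w (old I u∈) (old I w∈)
    sz′ : size (D ∖ v) ≡ j
    sz′ = suc-injective (trans (sym (size-Ins I)) sz)
    E = elements (D ∖ v)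
    free : ∀ c → ProperOn A (D ∖ v) c → #free A (D ∖ v) v c ≡ suc m
    free c p = ≤-antisym
      (+-cancelʳ-≤ j _ _ (≤-trans (subst (λ l → #free A (D ∖ v) v c + l ≤ k) (trans (length-elements (D ∖ v)) sz′)
          (#free-upper A (D ∖ v) v c E
            (All.map (λ {y} y∈ → y∈ , clique v y v∈ (old I y∈) (λ { refl → fresh I y∈ })) (elements-∈ (D ∖ v)))
            (distinct E (elements-unique (D ∖ v)) (elements-∈ (D ∖ v)))))
        (≤-reflexive (trans (sym e) (cong suc (+-comm j m))))))
      (+-cancelʳ-≤ j _ _ (≤-trans (≤-reflexive (trans (cong suc (+-comm m j)) e))
        (≤-trans (#free-lower A (D ∖ v) v c) (+-monoʳ-≤ _ (≤-trans (size-mono {D = λ u → (D ∖ v) u ∧ adj A v u} {D ∖ v} (proj₁ ∘ ∧-true)) (≤-reflexive sz′))))))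
      where
      distinct : ∀ ys → Unique ys → All (_∈ˢ (D ∖ v)) ys → Unique (map (lookup c) ys)
      distinct []       _        _          = []
      distinct (y ∷ ys) (y∉ ∷ u) (y∈ ∷ ys∈) = go ys y∉ ys∈ ∷ distinct ys u ys∈
        where
        go : ∀ zs → All (y ≢_) zs → All (_∈ˢ (D ∖ v)) zs → All (lookup c y ≢_) (map (lookup c) zs)
        go []       _          _          = []
        go (z ∷ zs) (y≢z ∷ ne) (z∈ ∷ zs∈) = p y z y∈ z∈ (clique′ y z y∈ z∈ y≢z) ∷ go zs ne zs∈
    step : k * #col k A D ≡ suc m * #col k A (D ∖ v)
    step = trans (#col-step₁ A I) (trans (∑-cong (vecs k n) pw) (∑-*ˡ (vecs k n) (suc m) _))
      where
      pw : ∀ c → 𝟙 (properOn? A (D ∖ v) c) * #free A (D ∖ v) v c ≡ suc m * 𝟙 (properOn? A (D ∖ v) c)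
      pw c with properOn? A (D ∖ v) c
      ... | yes p = trans (+-identityʳ _) (trans (free c p) (sym (*-identityʳ (suc m))))
      ... | no _  = sym (*-zeroʳ (suc m))

  -- Otherwise every vertex of colour a could be recoloured, which would save the colour a.
  colourful : (A : Graph n) {S : VSet n} → ¬ ColOn A S (suc r) → (c : Vec (Fin (suc (suc r))) n) → ProperOn A S c → ∀ a →
    ∃ λ v → v ∈ˢ S × lookup c v ≡ a × (∀ i → ∃ λ y → y ∈ˢ S × Adj A v y × lookup c y ≡ punchIn a i)
  colourful {n} {r} A {S} ¬col c p a
    with any? (λ v → (S v Bool.≟ true) ×-dec (lookup c v Fin.≟ a) ×-dec all? (λ i → any? (λ y →
           (S y Bool.≟ true) ×-dec (adj A v y Bool.≟ true) ×-dec (lookup c y Fin.≟ punchIn a i))))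
  ... | yes q = q
  ... | no none = ⊥-elim (¬col (tabulate hue , proper))
    where
    Recolour : Fin n → Fin (suc (suc r)) → Set
    Recolour x b = a ≢ b × (x ∈ˢ S → (lookup c x ≢ a × b ≡ lookup c x) ⊎ (lookup c x ≡ a × Free A S x c b))
    recolour : ∀ x → ∃ (Recolour x)
    recolour x with lookup c x Fin.≟ a
    ... | no c≢a = lookup c x , (c≢a ∘ sym) , λ _ → inj₁ (c≢a , refl)
    ... | yes c≡a with S x Bool.≟ true
    ...   | no x∉ = punchIn a zero , (punchInᵢ≢i a zero ∘ sym) , λ x∈ → ⊥-elim (x∉ x∈)
    ...   | yes x∈ with ¬∀⟶∃¬ _ _ (λ i → any? (λ y →
              (S y Bool.≟ true) ×-dec (adj A x y Bool.≟ true) ×-dec (lookup c y Fin.≟ punchIn a i)))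
              (λ all → none (x , x∈ , c≡a , all))
    ...     | i , missing = punchIn a i , (punchInᵢ≢i a i ∘ sym) ,
                λ _ → inj₂ (c≡a , λ y y∈ xy e → missing (y , y∈ , xy , e))
    hue : Fin n → Fin (suc r)
    hue x = punchOut (proj₁ (proj₂ (recolour x)))
    proper : ProperOn A S (tabulate hue)
    proper i j i∈ j∈ ij e = clash (proj₂ (proj₂ (recolour i)) i∈) (proj₂ (proj₂ (recolour j)) j∈)
      where
      same : proj₁ (recolour i) ≡ proj₁ (recolour j)
      same = punchOut-injective (proj₁ (proj₂ (recolour i))) (proj₁ (proj₂ (recolour j)))
        (trans (sym (lookup∘tabulate hue i)) (trans e (lookup∘tabulate hue j)))
      bᵢ = proj₁ (recolour i)
      bⱼ = proj₁ (recolour j)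
      clash : (lookup c i ≢ a × bᵢ ≡ lookup c i) ⊎ (lookup c i ≡ a × Free A S i c bᵢ) →
              (lookup c j ≢ a × bⱼ ≡ lookup c j) ⊎ (lookup c j ≡ a × Free A S j c bⱼ) → ⊥
      clash (inj₁ (_ , bi)) (inj₁ (_ , bj)) = p i j i∈ j∈ ij (trans (sym bi) (trans same bj))
      clash (inj₁ (_ , bi)) (inj₂ (_ , Fj)) = Fj i i∈ (trans (adj-sym A j i) ij) (trans (sym bi) same)
      clash (inj₂ (_ , Fi)) (inj₁ (_ , bj)) = Fi j j∈ ij (trans (sym bj) (sym same))
      -- The vertices of colour a are pairwise non-adjacent, so they can all be recoloured at once.
      clash (inj₂ (ci , _)) (inj₂ (cj , _)) = p i j i∈ j∈ ij (trans ci (sym cj))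

  bijection-↭ : {xs : List X} (σ ρ : X → X) → (∀ x → σ (ρ x) ≡ x) → (∀ x → ρ (σ x) ≡ x) → Unique xs →
                (∀ {x} → x ∈ xs → σ x ∈ xs) → (∀ {x} → x ∈ xs → ρ x ∈ xs) → map σ xs ↭ xs
  bijection-↭ {xs = xs} σ ρ σρ ρσ u closed closed′ =
    ∼bag⇒↭ (unique∧set⇒bag (Uniq.map⁺ inj u) u (mk⇔ to from))
    where
    inj : ∀ {x y} → σ x ≡ σ y → x ≡ y
    inj {x} {y} e = trans (sym (ρσ x)) (trans (cong ρ e) (ρσ y))
    to : ∀ {z} → z ∈ map σ xs → z ∈ xs
    to p with ∈-map⁻ σ p
    ... | x , x∈ , refl = closed x∈
    from : ∀ {z} → z ∈ xs → z ∈ map σ xs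
    from {z} p = subst (_∈ map σ xs) (σρ z) (∈-map⁺ σ (closed′ p))

  -- Vertex labellings

  Injective : Vec (Fin n) n → Set
  Injective ℓ = ∀ i j → lookup ℓ i ≡ lookup ℓ j → i ≡ j

  abstract
    injective? : (ℓ : Vec (Fin n) n) → Dec (Injective ℓ)
    injective? ℓ = all? λ i → all? λ j → (lookup ℓ i Fin.≟ lookup ℓ j) →-dec (i Fin.≟ j)

  -- Each injective labelling stands for one order of the vertices. Averages over a random order
  -- turn into products over this list.
  labellings : ∀ n → List (Vec (Fin n) n)
  labellings n = filter injective? (vecs n n)

  labelling-injective : ∀ {ℓ} → ℓ ∈ labellings n → Injective ℓ
  labelling-injective {n} ℓ∈ = proj₂ (∈-filter⁻ injective? {xs = vecs n n} ℓ∈)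

  ∈-labellings : (ℓ : Vec (Fin n) n) → Injective ℓ → ℓ ∈ labellings n
  ∈-labellings ℓ inj = ∈-filter⁺ injective? (∈-vecs ℓ) inj

  labellings-nonempty : ∀ n → 1 ≤ length (labellings n)
  labellings-nonempty n with labellings n | ∈-labellings (tabulate {n = n} id)
    (λ i j e → trans (sym (lookup∘tabulate id i)) (trans e (lookup∘tabulate id j)))
  ... | _ ∷ _ | _ = s≤s z≤n

  label : Vec (Fin n) n → Fin n → ℕ
  label ℓ v = toℕ (lookup ℓ v)

  rank : Vec (Fin n) n → List (Fin n) → Fin n → ℕ
  rank ℓ W w = ∑ W (λ u → 𝟙 (label ℓ u <? label ℓ w))

  ∏< : ℕ → (ℕ → ℕ) → ℕ
  ∏< zero    g = 1
  ∏< (suc m) g = g 0 * ∏< m (g ∘ suc)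

  ranks-sorted : (ms : List ℕ) (g : ℕ → ℕ) → AllPairs _<_ ms →
    ∏ ms (λ x → g (∑ ms (λ y → 𝟙 (y <? x)))) ≡ ∏< (length ms) g
  ranks-sorted []       g _        = refl
  ranks-sorted (m ∷ ms) g (m< ∷ s) = cong₂ _*_ (cong g least)
    (trans (∏-cong-∈ ms (λ {x} x∈ → cong (λ i → g (i + ∑ ms (λ y → 𝟙 (y <? x)))) (𝟙-yes (m <? x) (All.lookup m< x∈))))
           (ranks-sorted ms (g ∘ suc) s))
    where
    least : ∑ (m ∷ ms) (λ y → 𝟙 (y <? m)) ≡ 0
    least = cong₂ _+_ (𝟙-no (m <? m) (<-irrefl refl))
      (n≤0⇒n≡0 (≤-trans (∑-mono-∈ ms {g = λ _ → 0} (λ {y} y∈ → ≤-reflexive (𝟙-no (y <? m) (<⇒≯ (All.lookup m< y∈)))))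
        (≤-reflexive (∑-zero ms (λ _ → 0) (λ _ → refl)))))

  -- Distinct numbers have the ranks 0, 1, 2, ... in some order, and sorting puts them in this order
  -- without changing the product.
  ranks-product : (ms : List ℕ) (g : ℕ → ℕ) → Unique ms →
    ∏ ms (λ x → g (∑ ms (λ y → 𝟙 (y <? x)))) ≡ ∏< (length ms) g
  ranks-product ms g u = begin
    ∏ ms (λ x → g (∑ ms (λ y → 𝟙 (y <? x))))  ≡⟨ ∏-cong ms (λ x → cong g (∑-↭ _ (↭-sym (sort-↭ ms)))) ⟩
    ∏ ms (λ x → g (∑ ss (λ y → 𝟙 (y <? x))))  ≡⟨ ∏-↭ _ (↭-sym (sort-↭ ms)) ⟩
    ∏ ss (λ x → g (∑ ss (λ y → 𝟙 (y <? x))))  ≡⟨ ranks-sorted ss g strict ⟩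
    ∏< (length ss) g                          ≡⟨ cong (λ l → ∏< l g) (Perm.↭-length (sort-↭ ms)) ⟩
    ∏< (length ms) g                          ∎
    where
    open ≡-Reasoning
    ss = sort ms
    strict : AllPairs _<_ ss
    strict = AllPairs.zipWith (λ (le , ne) → ≤∧≢⇒< le ne)
      (Linked⇒AllPairs ≤-trans (sort-↗ ms) , SPerm.Unique-resp-↭ (setoid ℕ) (↭⇒↭ₛ (↭-sym (sort-↭ ms))) u)

  transpose-∈ : {W : List (Fin n)} {v w : Fin n} → v ∈ W → w ∈ W → ∀ {x} → x ∈ W → transpose v w x ∈ W
  transpose-∈ {v = v} {w} v∈ w∈ {x} x∈ with does (x Fin.≟ v)
  ... | true = w∈
  ... | false with does (x Fin.≟ w)
  ...   | true  = v∈
  ...   | false = x∈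

  transpose-right : (v w : Fin n) → transpose v w w ≡ v
  transpose-right v w with w Fin.≟ v
  ... | yes w≡v = w≡v
  ... | no _ rewrite dec-true (w Fin.≟ w) refl = refl

  relabel : (Fin n → Fin n) → Vec (Fin n) n → Vec (Fin n) n
  relabel τ ℓ = tabulate (lookup ℓ ∘ τ)

  relabel-inverse : (τ τ′ : Fin n → Fin n) → (∀ x → τ (τ′ x) ≡ x) → ∀ ℓ → relabel τ′ (relabel τ ℓ) ≡ ℓ
  relabel-inverse τ τ′ inv ℓ = trans (tabulate-cong (λ i → trans (lookup∘tabulate (lookup ℓ ∘ τ) (τ′ i)) (cong (lookup ℓ) (inv i))))
    (tabulate∘lookup ℓ)

  relabel-∈ : (τ τ′ : Fin n → Fin n) → (∀ x → τ′ (τ x) ≡ x) → ∀ {ℓ} → ℓ ∈ labellings n → relabel τ ℓ ∈ labellings n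
  relabel-∈ τ τ′ inv {ℓ} ℓ∈ = ∈-labellings _ (λ i j e → trans (sym (inv i)) (trans (cong τ′
    (labelling-injective ℓ∈ _ _ (trans (sym (lookup∘tabulate (lookup ℓ ∘ τ) i)) (trans e (lookup∘tabulate (lookup ℓ ∘ τ) j)))))
    (inv j)))

  -- Relabelling by the transposition of v and w permutes the set of labellings. It also permutes W,
  -- because both vertices lie in W, so the new rank of w is the old rank of v.
  rank-exchange : {W : List (Fin n)} → Unique W → ∀ {v w} → v ∈ W → w ∈ W → (g : ℕ → ℕ) →
    ∏ (labellings n) (λ ℓ → g (rank ℓ W w)) ≡ ∏ (labellings n) (λ ℓ → g (rank ℓ W v))
  rank-exchange {n} {W} u {v} {w} v∈ w∈ g = begin
    ∏ Ω (λ ℓ → g (rank ℓ W w))                  ≡⟨ ∏-↭ _ (↭-sym perm) ⟩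
    ∏ (map (relabel τ) Ω) (λ ℓ → g (rank ℓ W w)) ≡⟨ ∏-map (relabel τ) Ω _ ⟩
    ∏ Ω (λ ℓ → g (rank (relabel τ ℓ) W w))      ≡⟨ ∏-cong Ω (λ ℓ → cong g (moved ℓ)) ⟩
    ∏ Ω (λ ℓ → g (rank ℓ W v))                  ∎
    where
    open ≡-Reasoning
    Ω = labellings n
    τ τ′ : Fin n → Fin n
    τ  = transpose v w
    τ′ = transpose w v
    ττ′ : ∀ x → τ (τ′ x) ≡ x
    ττ′ x = transpose-inverse v w
    τ′τ : ∀ x → τ′ (τ x) ≡ x
    τ′τ x = transpose-inverse w v
    perm : map (relabel τ) Ω ↭ Ω
    perm = bijection-↭ (relabel τ) (relabel τ′) (relabel-inverse τ′ τ τ′τ) (relabel-inverse τ τ′ ττ′)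
      (Uniq.filter⁺ injective? (vecs-unique n n)) (relabel-∈ τ τ′ τ′τ) (relabel-∈ τ′ τ ττ′)
    lab : ∀ ℓ x → label (relabel τ ℓ) x ≡ label ℓ (τ x)
    lab ℓ x = cong toℕ (lookup∘tabulate (lookup ℓ ∘ τ) x)
    moved : ∀ ℓ → rank (relabel τ ℓ) W w ≡ rank ℓ W v
    moved ℓ = begin
      ∑ W (λ u → 𝟙 (label (relabel τ ℓ) u <? label (relabel τ ℓ) w))
        ≡⟨ ∑-cong W (λ u → cong₂ (λ a b → 𝟙 (a <? b)) (lab ℓ u) (trans (lab ℓ w) (cong (label ℓ) (transpose-right v w)))) ⟩
      ∑ W (λ u → 𝟙 (label ℓ (τ u) <? label ℓ v))
        ≡⟨ ∑-map τ W (λ u → 𝟙 (label ℓ u <? label ℓ v)) ⟨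
      ∑ (map τ W) (λ u → 𝟙 (label ℓ u <? label ℓ v))
        ≡⟨ ∑-↭ _ (bijection-↭ τ τ′ ττ′ τ′τ u (transpose-∈ v∈ w∈) (transpose-∈ w∈ v∈)) ⟩
      ∑ W (λ u → 𝟙 (label ℓ u <? label ℓ v)) ∎

  -- The rank of v within W is uniformly distributed over all labellings, because exchanging two labels in W exchanges
  -- the ranks of their owners; uniformity is expressed through products instead of expectations of logarithms.
  rank-uniform : {W : List (Fin n)} → Unique W → ∀ {v} → v ∈ W → (g : ℕ → ℕ) →
    ∏ (labellings n) (λ ℓ → g (rank ℓ W v)) ^ length W ≡ ∏< (length W) g ^ length (labellings n)
  rank-uniform {n} {W} u {v} v∈ g = begin
    ∏ Ω (λ ℓ → g (rank ℓ W v)) ^ length W               ≡⟨ ∏-const W _ ⟨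
    ∏ W (λ _ → ∏ Ω (λ ℓ → g (rank ℓ W v)))              ≡⟨ ∏-cong-∈ W (λ w∈ → sym (rank-exchange u v∈ w∈ g)) ⟩
    ∏ W (λ w → ∏ Ω (λ ℓ → g (rank ℓ W w)))              ≡⟨ ∏-swap W Ω _ ⟩
    ∏ Ω (λ ℓ → ∏ W (λ w → g (rank ℓ W w)))              ≡⟨ ∏-cong-∈ Ω (λ {ℓ} ℓ∈ → total ℓ (labelling-injective ℓ∈)) ⟩
    ∏ Ω (λ _ → ∏< (length W) g)                         ≡⟨ ∏-const Ω _ ⟩
    ∏< (length W) g ^ length Ω                          ∎
    where
    open ≡-Reasoning
    Ω = labellings n
    total : ∀ ℓ → Injective ℓ → ∏ W (λ w → g (rank ℓ W w)) ≡ ∏< (length W) g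
    total ℓ inj = begin
      ∏ W (λ w → g (rank ℓ W w))
        ≡⟨ ∏-cong W (λ w → cong g (sym (∑-map (label ℓ) W (λ y → 𝟙 (y <? label ℓ w))))) ⟩
      ∏ W (λ w → g (∑ (map (label ℓ) W) (λ y → 𝟙 (y <? label ℓ w))))
        ≡⟨ ∏-map (label ℓ) W (λ x → g (∑ (map (label ℓ) W) (λ y → 𝟙 (y <? x)))) ⟨
      ∏ (map (label ℓ) W) (λ x → g (∑ (map (label ℓ) W) (λ y → 𝟙 (y <? x))))
        ≡⟨ ranks-product (map (label ℓ) W) g (Uniq.map⁺ (λ e → inj _ _ (toℕ-injective e)) u) ⟩
      ∏< (length (map (label ℓ) W)) g
        ≡⟨ cong (λ l → ∏< l g) (length-map (label ℓ) W) ⟩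
      ∏< (length W) g ∎

  before : Vec (Fin n) n → VSet n → ℕ → VSet n
  before ℓ T t u = T u ∧ does (label ℓ u <? t)

  before⁻ : (ℓ : Vec (Fin n) n) (T : VSet n) (t : ℕ) {u : Fin n} → u ∈ˢ before ℓ T t → u ∈ˢ T × label ℓ u < t
  before⁻ ℓ T t {u} e = let a , b = ∧-true e in a , does⇒ (label ℓ u <? t) b

  before⁺ : (ℓ : Vec (Fin n) n) (T : VSet n) (t : ℕ) {u : Fin n} → u ∈ˢ T → label ℓ u < t → u ∈ˢ before ℓ T t
  before⁺ ℓ T t {u} a b = cong₂ _∧_ a (dec-true (label ℓ u <? t) b)

  #freeAt : Graph n → VSet n → Vec (Fin n) n → Fin n → Vec (Fin k) n → ℕ
  #freeAt A T ℓ v c = #free A (before ℓ T (label ℓ v)) v c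

  -- With N labellings, the N-th root of this product is the geometric mean over all orders of the
  -- number of colours that v finds free: the exponential of its expected entropy contribution.
  #freeProd : Graph n → VSet n → Fin n → Vec (Fin k) n → ℕ
  #freeProd {n} A T v c = ∏ (labellings n) (λ ℓ → #freeAt A T ℓ v c)

  rank-head : (ℓ : Vec (Fin n) n) (v : Fin n) (ys : List (Fin n)) →
    rank ℓ (v ∷ ys) v ≡ length (filter (λ y → label ℓ y <? label ℓ v) ys)
  rank-head ℓ v ys = trans (cong (_+ rank ℓ ys v) (𝟙-no (label ℓ v <? label ℓ v) (<-irrefl refl)))
    (sym (length-filter-∑ (λ y → label ℓ y <? label ℓ v) ys))

  module _ (A : Graph n) (T : VSet n) (v : Fin n) (ys : List (Fin n)) (nbrs : All (λ y → y ∈ˢ T × Adj A v y) ys) where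

    private
      head-unique : Unique ys → Unique (v ∷ ys)
      head-unique u = All.map (λ (_ , vy) → adj-≢ A vy) nbrs ∷ u

      earlier : ∀ ℓ → List (Fin n)
      earlier ℓ = filter (λ y → label ℓ y <? label ℓ v) ys

      earlier-nbrs : ∀ ℓ → All (λ y → y ∈ˢ before ℓ T (label ℓ v) × Adj A v y) (earlier ℓ)
      earlier-nbrs ℓ = All.tabulate (λ {y} y∈ →
        let y∈ys , lt = ∈-filter⁻ (λ y → label ℓ y <? label ℓ v) {xs = ys} y∈
            y∈T , vy = All.lookup nbrs y∈ys
        in before⁺ ℓ T (label ℓ v) y∈T lt , vy)

    -- The neighbours `ys` that precede v block one colour each, and their number is the rank of v
    -- in `v ∷ ys`, which is uniform on 0, ..., `length ys`.
    rainbow-bound : (c : Vec (Fin k) n) → Unique (map (lookup c) ys) →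
      #freeProd A T v c ^ suc (length ys) ≤ ∏< (suc (length ys)) (k ∸_) ^ length (labellings n)
    rainbow-bound {k} c u = ≤-trans
      (^-monoˡ-≤ (suc (length ys)) (∏-mono-∈ (labellings n) (λ {ℓ} _ → bound ℓ)))
      (≤-reflexive (rank-uniform (head-unique (AllPairs.map (λ ne e → ne (cong (lookup c) e)) u′)) (here refl) (k ∸_)))
      where
      u′ : AllPairs (λ x y → lookup c x ≢ lookup c y) ys
      u′ = AllPairsP.map⁻ u
      bound : ∀ ℓ → #freeAt A T ℓ v c ≤ k ∸ rank ℓ (v ∷ ys) v
      bound ℓ = m+n≤o⇒m≤o∸n _ (subst (λ i → #freeAt A T ℓ v c + i ≤ k) (sym (rank-head ℓ v ys))
        (#free-upper A _ v c (earlier ℓ) (earlier-nbrs ℓ) (AllPairsP.map⁺ (AllPairsP.filter⁺ _ u′))))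

    -- Nothing is assumed about the colours of `ys`, so only two situations are told apart: v
    -- precedes all of `ys`, with at most k free colours, or some neighbour comes earlier and at
    -- most r are free. The first has frequency 1 / (1 + `length ys`).
    nbrs-bound : (c : Vec (Fin (suc r)) n) → Unique ys →
      #freeProd A T v c ^ suc (length ys) ≤ (suc r * r ^ length ys) ^ length (labellings n)
    nbrs-bound {r} c u = ≤-trans
      (^-monoˡ-≤ (suc (length ys)) (∏-mono-∈ (labellings n) (λ {ℓ} _ → bound ℓ)))
      (≤-reflexive (trans (rank-uniform (head-unique u) (here refl) g)
        (cong (λ z → (suc r * z) ^ length (labellings n)) (const (length ys)))))
      where
      g : ℕ → ℕ
      g zero    = suc r
      g (suc _) = r
      const : ∀ m → ∏< m (λ _ → r) ≡ r ^ m
      const zero    = refl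
      const (suc m) = cong (r *_) (const m)
      bound′ : ∀ ℓ (zs : List (Fin n)) → All (λ y → y ∈ˢ before ℓ T (label ℓ v) × Adj A v y) zs →
               #freeAt A T ℓ v c ≤ g (length zs)
      bound′ ℓ []      _              = #free-upper₀ A _ v c
      bound′ ℓ (z ∷ _) ((z∈ , vz) ∷ _) = #free-upper₁ A _ v c z∈ vz
      bound : ∀ ℓ → #freeAt A T ℓ v c ≤ g (rank ℓ (v ∷ ys) v)
      bound ℓ = subst (λ i → #freeAt A T ℓ v c ≤ g i) (sym (rank-head ℓ v ys)) (bound′ ℓ (earlier ℓ) (earlier-nbrs ℓ))

  -- Entropy bound for colourings

  -- k ! / m plays the role of the probability 1 / m with which a random greedy colouring picks a given free colour.
  cofactor : ℕ → ℕ → ℕ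
  cofactor k zero    = 0
  cofactor k (suc m) = k ! / suc m

  cofactor-* : ∀ k m → 1 ≤ m → m ≤ k → m * cofactor k m ≡ k !
  cofactor-* k (suc m) _ le = trans (*-comm (suc m) (cofactor k (suc m))) (m/n*n≡m (∣-trans (m∣m*n (m !)) (m≤n⇒m!∣n! le)))

  cofactor-≤ : ∀ k m → m ≤ k → m * cofactor k m ≤ k !
  cofactor-≤ k zero    _  = z≤n
  cofactor-≤ k (suc m) le = ≤-reflexive (cofactor-* k (suc m) (s≤s z≤n) le)

  ∏-δ : ∀ n (j : Fin n) (f : Fin n → ℕ) → ∏ (allFin n) (λ i → f i ^ 𝟙 (i Fin.≟ j)) ≡ f j
  ∏-δ (suc n) zero    f = trans (∏-allFin-suc n (λ i → f i ^ 𝟙 (i Fin.≟ zero)))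
    (trans (cong₂ _*_ (*-identityʳ (f zero)) (trans (∏-allFin-const n 1) (^-zeroˡ n))) (*-identityʳ _))
  ∏-δ (suc n) (suc j) f = trans (∏-allFin-suc n (λ i → f i ^ 𝟙 (i Fin.≟ suc j)))
    (trans (+-identityʳ _) (trans (∏-cong (allFin n) (λ i → cong (f (suc i) ^_)
      (𝟙-cong (suc i Fin.≟ suc j) (i Fin.≟ j) (λ { refl → refl }) (cong suc)))) (∏-δ n j (f ∘ suc))))

  colourings : Graph n → VSet n → ∀ k → List (Vec (Fin k) n)
  colourings {n} A T k = filter (properOn? A T) (vecs k n)

  length-colourings : (A : Graph n) (T : VSet n) (k : ℕ) → length (colourings A T k) ≡ #col k A T
  length-colourings {n} A T k = length-filter-∑ (properOn? A T) (vecs k n)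

  module _ (A : Graph n) (T : VSet n) (k : ℕ) (ℓ : Vec (Fin n) n) (inj : Injective ℓ) where

    private
      D : ℕ → VSet n
      D = before ℓ T

      f : Fin n → Vec (Fin k) n → ℕ
      f u c = cofactor k (#freeAt A T ℓ u c)

      -- Colour the vertices of T in the order `ℓ`, each time with a uniformly random free colour.
      -- For c proper on `D t`, `U t c` is the probability of producing c on `D t`, scaled by k !
      -- for each vertex coloured so far.
      U : ℕ → Vec (Fin k) n → ℕ
      U t c = ∏ (allFin n) (λ u → f u c ^ ⟪ D t u ⟫)

      Total : ℕ → ℕ
      Total t = ∑ (vecs k n) (λ c → 𝟙 (properOn? A (D t) c) * U t c)

      advance-fresh : ∀ {t v} → v ∈ˢ T → label ℓ v ≡ t → Ins (D t) v (D (suc t))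
      advance-fresh {t} {v} v∈ refl = record
        { fresh = λ e → <-irrefl refl (proj₂ (before⁻ ℓ T t {v} e))
        ; new   = before⁺ ℓ T (suc t) {v} v∈ ≤-refl
        ; old   = λ {u} e → let a , b = before⁻ ℓ T t {u} e in before⁺ ℓ T (suc t) {u} a (m≤n⇒m≤1+n b)
        ; back  = λ {u} → bk u }
        where
        bk : ∀ u → u ∈ˢ D (suc t) → u ≡ v ⊎ u ∈ˢ D t
        bk u e with before⁻ ℓ T (suc t) {u} e
        ... | a , b with label ℓ u ≟ t
        ...   | yes q = inj₁ (inj _ _ (toℕ-injective q))
        ...   | no q  = inj₂ (before⁺ ℓ T t {u} a (≤∧≢⇒< (s≤s⁻¹ b) q))

      advance-same : ∀ {t} → ¬ (∃ λ v → v ∈ˢ T × label ℓ v ≡ t) → ∀ u → D (suc t) u ≡ D t u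
      advance-same {t} none u with T u in e
      ... | false = refl
      ... | true  = does-cong (label ℓ u <? suc t) (label ℓ u <? t)
                      (λ lt → ≤∧≢⇒< (s≤s⁻¹ lt) (λ q → none (u , e , q))) m≤n⇒m≤1+n

      -- The free colours at u depend only on vertices before u, and v comes after u.
      f-local : ∀ {t u v} c a → u ∈ˢ D t → label ℓ v ≡ t → f u (c [ v ]≔ a) ≡ f u c
      f-local {t} {u} {v} c a u∈ refl = cong (cofactor k) (#free-cong A _ u (λ y y∈ →
        lookup∘update′ (λ { refl → <-asym (proj₂ (before⁻ ℓ T (label ℓ u) {y} y∈)) (proj₂ (before⁻ ℓ T t {u} u∈)) }) c a))

      U-local : ∀ {t v} c a → label ℓ v ≡ t → U t (c [ v ]≔ a) ≡ U t c
      U-local {t} {v} c a e = ∏-cong (allFin n) pw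
        where
        pw : ∀ u → f u (c [ v ]≔ a) ^ ⟪ D t u ⟫ ≡ f u c ^ ⟪ D t u ⟫
        pw u with D t u in eq
        ... | true  = cong (_^ 1) (f-local c a eq e)
        ... | false = refl

      -- The probabilities of the greedy process sum to at most 1; the sum can be smaller because
      -- the process may get stuck with no free colour. The powers of k account for the arbitrary
      -- colours outside `D t`.
      Total-bound : ∀ t → k ^ size (D t) * Total t ≤ (k !) ^ size (D t) * k ^ n
      Total-bound zero = ≤-reflexive (trans (cong₂ (λ s x → k ^ s * x) s₀ t₀)
        (trans (+-identityʳ (k ^ n)) (sym (trans (cong (λ s → (k !) ^ s * k ^ n) s₀) (+-identityʳ (k ^ n))))))
        where
        empty : ∀ u → D 0 u ≡ false
        empty u with T u
        ... | true  = refl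
        ... | false = refl
        s₀ : size (D 0) ≡ 0
        s₀ = ∑-zero (allFin n) _ (λ u → cong ⟪_⟫ (empty u))
        t₀ : Total 0 ≡ k ^ n
        t₀ = trans (∑-cong (vecs k n) (λ c → cong₂ _*_
               (𝟙-yes (properOn? A (D 0) c) (λ i j i∈ → ⊥-elim (false⇒∉ {D = D 0} (empty i) i∈)))
               (trans (∏-cong (allFin n) (λ u → cong (λ b → f u c ^ ⟪ b ⟫) (empty u))) (trans (∏-allFin-const n 1) (^-zeroˡ n)))))
             (trans (∑-vecs-const k n 1) (*-identityʳ (k ^ n)))
      Total-bound (suc t) with any? (λ v → (T v Bool.≟ true) ×-dec (label ℓ v ≟ t))
      -- No vertex of T has label t, so nothing is coloured in this turn.
      ... | no none = subst₂ (λ s x → k ^ s * x ≤ (k !) ^ s * k ^ n) (sym s≡) (sym t≡) (Total-bound t)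
        where
        same = advance-same none
        s≡ : size (D (suc t)) ≡ size (D t)
        s≡ = ∑-cong (allFin n) (λ u → cong ⟪_⟫ (same u))
        t≡ : Total (suc t) ≡ Total t
        t≡ = ∑-cong (vecs k n) (λ c → cong₂ _*_
          (𝟙-cong (properOn? A (D (suc t)) c) (properOn? A (D t) c)
            (ProperOn-⊆ {A = A} {D t} {D (suc t)} {c} (λ {u} e → trans (same u) e))
            (ProperOn-⊆ {A = A} {D (suc t)} {D t} {c} (λ {u} e → trans (sym (same u)) e)))
          (∏-cong (allFin n) (λ u → cong (λ b → f u c ^ ⟪ b ⟫) (same u))))
      ... | yes (v , v∈ , refl) = begin
        k ^ size (D (suc t)) * Total (suc t)      ≡⟨ cong (λ s → k ^ s * Total (suc t)) (size-Ins I) ⟩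
        k * k ^ size (D t) * Total (suc t)        ≡⟨ shuffle k (k ^ size (D t)) _ ⟩
        k ^ size (D t) * (k * Total (suc t))      ≤⟨ *-monoʳ-≤ (k ^ size (D t)) step ⟩
        k ^ size (D t) * (k ! * Total t)          ≡⟨ shuffle′ (k ^ size (D t)) (k !) (Total t) ⟩
        k ! * (k ^ size (D t) * Total t)          ≤⟨ *-monoʳ-≤ (k !) (Total-bound t) ⟩
        k ! * ((k !) ^ size (D t) * k ^ n)        ≡⟨ *-assoc (k !) _ _ ⟨
        k ! * (k !) ^ size (D t) * k ^ n          ≡⟨ cong (λ s → (k !) ^ s * k ^ n) (size-Ins I) ⟨
        (k !) ^ size (D (suc t)) * k ^ n          ∎
        where
        open ≤-Reasoning
        I : Ins (D t) v (D (suc t))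
        I = advance-fresh v∈ refl
        shuffle : ∀ a b c → a * b * c ≡ b * (a * c)
        shuffle = solve-∀
        shuffle′ : ∀ a b c → a * (b * c) ≡ b * (a * c)
        shuffle′ = solve-∀
        U-suc : ∀ c → U (suc t) c ≡ f v c * U t c
        U-suc c = trans (∏-cong (allFin n) (λ u → trans (cong (f u c ^_) (Ins-⟪⟫ I u)) (^-distribˡ-+-* (f u c) (𝟙 (u Fin.≟ v)) _)))
          (trans (∏-* (allFin n) (λ u → f u c ^ 𝟙 (u Fin.≟ v)) _) (cong (_* U t c) (∏-δ n v (λ u → f u c))))
        local : ∀ c a → f v (c [ v ]≔ a) * U t (c [ v ]≔ a) ≡ f v c * U t c
        local c a = cong₂ _*_ (cong (cofactor k) (#free-cong A _ v (λ y y∈ → lookup∘update′ (λ { refl → fresh I y∈ }) c a)))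
          (U-local c a refl)
        step : k * Total (suc t) ≤ k ! * Total t
        step = begin
          k * Total (suc t)
            ≡⟨ cong (k *_) (∑-cong (vecs k n) (λ c → cong (𝟙 (properOn? A (D (suc t)) c) *_) (U-suc c))) ⟩
          k * ∑ (vecs k n) (λ c → 𝟙 (properOn? A (D (suc t)) c) * (f v c * U t c))
            ≡⟨ #col-step A I (λ c → f v c * U t c) local ⟩
          ∑ (vecs k n) (λ c → 𝟙 (properOn? A (D t) c) * (#freeAt A T ℓ v c * (f v c * U t c)))
            ≤⟨ ∑-mono (vecs k n) (λ c → ≤-trans
                 (*-monoʳ-≤ (𝟙 (properOn? A (D t) c)) (≤-trans (≤-reflexive (sym (*-assoc (#freeAt A T ℓ v c) (f v c) (U t c))))
                   (*-monoˡ-≤ (U t c) (cofactor-≤ k (#freeAt A T ℓ v c) (#free-upper₀ A _ v c)))))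
                 (≤-reflexive (shuffle′ (𝟙 (properOn? A (D t) c)) (k !) (U t c)))) ⟩
          ∑ (vecs k n) (λ c → k ! * (𝟙 (properOn? A (D t) c) * U t c))
            ≡⟨ ∑-*ˡ (vecs k n) (k !) _ ⟩
          k ! * Total t ∎

    private
      Cs = colourings A T k
      P = #col k A T

      full : ∀ u → D n u ≡ T u
      full u with T u
      ... | true  = dec-true (label ℓ u <? n) (toℕ<n (lookup ℓ u))
      ... | false = refl

      V W : Vec (Fin k) n → ℕ
      V c = ∏ (allFin n) (λ u → f u c ^ ⟪ T u ⟫)
      W c = ∏ (allFin n) (λ u → #freeAt A T ℓ u c ^ ⟪ T u ⟫)

      ∑V : k ^ size T * ∑ Cs V ≤ (k !) ^ size T * k ^ n
      ∑V = subst₂ (λ s x → k ^ s * x ≤ (k !) ^ s * k ^ n) (∑-cong (allFin n) (λ u → cong ⟪_⟫ (full u))) total≡ (Total-bound n)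
        where
        total≡ : Total n ≡ ∑ Cs V
        total≡ = trans (∑-cong (vecs k n) (λ c → cong₂ _*_
          (𝟙-cong (properOn? A (D n) c) (properOn? A T c)
            (ProperOn-⊆ {A = A} {T} {D n} {c} (λ {u} e → trans (full u) e))
            (ProperOn-⊆ {A = A} {D n} {T} {c} (λ {u} e → trans (sym (full u)) e)))
          (∏-cong (allFin n) (λ u → cong (λ b → f u c ^ ⟪ b ⟫) (full u)))))
          (sym (∑-filter (properOn? A T) (vecs k n) V))

      VW : ∀ {c} → c ∈ Cs → W c * V c ≡ (k !) ^ size T
      VW {c} c∈ = trans (sym (∏-* (allFin n) (λ u → #freeAt A T ℓ u c ^ ⟪ T u ⟫) _))
        (trans (∏-cong (allFin n) pw) (∏-exp (allFin n) (k !) (λ u → ⟪ T u ⟫)))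
        where
        proper = proj₂ (∈-filter⁻ (properOn? A T) {xs = vecs k n} c∈)
        -- As c is proper, the colour of u itself is free when u is reached; hence no factor of
        -- `W c` is 0 and `cofactor` is an exact quotient.
        own : ∀ u → u ∈ˢ T → 1 ≤ #freeAt A T ℓ u c
        own u u∈ = ≤-trans (≤-reflexive (sym (𝟙-yes (free? A _ u c (lookup c u))
            (λ y y∈ uy e → proper u y u∈ (proj₁ (before⁻ ℓ T (label ℓ u) {y} y∈)) uy (sym e)))))
          (∑-≥ (allFin k) (λ a → 𝟙 (free? A _ u c a)) (∈-allFin (lookup c u)))
        pw : ∀ u → #freeAt A T ℓ u c ^ ⟪ T u ⟫ * f u c ^ ⟪ T u ⟫ ≡ (k !) ^ ⟪ T u ⟫
        pw u with T u in e
        ... | false = refl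
        ... | true  = trans (cong₂ _*_ (*-identityʳ (#freeAt A T ℓ u c)) (*-identityʳ (f u c)))
                        (trans (cofactor-* k (#freeAt A T ℓ u c) (own u e) (#free-upper₀ A _ u c)) (sym (*-identityʳ (k !))))

    -- The inequality of means for the weights `V c` bounds their product from above by means of
    -- `∑V`. Since `W c * V c` is constant, this bounds the product of the `W c` from below. In
    -- logarithms: the entropy of a uniform colouring is at most the mean, over all colourings, of
    -- the summed logarithms of the free colours.
    entropy-bound : (k ^ size T * #col k A T) ^ #col k A T ≤
      (k ^ n) ^ #col k A T * ∏ (colourings A T k) (λ c → ∏ (allFin n) (λ u → #freeAt A T ℓ u c ^ ⟪ T u ⟫))
    entropy-bound = *-cancelʳ-≤ _ _ (((k !) ^ size T) ^ P) {{m^n≢0 ((k !) ^ size T) P {{m^n≢0 (k !) (size T) {{>-nonZero (1≤n! k)}}}}}} (begin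
      (K * P) ^ P * F ^ P                          ≡⟨ cong ((K * P) ^ P *_) F^P ⟩
      (K * P) ^ P * (∏ Cs W * ∏ Cs V)   ≡⟨ cong (_* (∏ Cs W * ∏ Cs V)) (^-distribʳ-* P K P) ⟩
      K ^ P * P ^ P * (∏ Cs W * ∏ Cs V) ≡⟨ s₁ (K ^ P) (P ^ P) (∏ Cs W) (∏ Cs V) ⟩
      ∏ Cs W * (K ^ P * (P ^ P * ∏ Cs V)) ≤⟨ *-monoʳ-≤ (∏ Cs W) (*-monoʳ-≤ (K ^ P) amgm) ⟩
      ∏ Cs W * (K ^ P * ∑ Cs V ^ P)  ≡⟨ cong (∏ Cs W *_) (^-distribʳ-* P K _) ⟨
      ∏ Cs W * (K * ∑ Cs V) ^ P      ≤⟨ *-monoʳ-≤ (∏ Cs W) (^-monoˡ-≤ P ∑V) ⟩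
      ∏ Cs W * (F * k ^ n) ^ P               ≡⟨ cong (∏ Cs W *_) (^-distribʳ-* P F (k ^ n)) ⟩
      ∏ Cs W * (F ^ P * (k ^ n) ^ P)         ≡⟨ s₂ (∏ Cs W) (F ^ P) ((k ^ n) ^ P) ⟩
      (k ^ n) ^ P * ∏ Cs W * F ^ P           ∎)
      where
      open ≤-Reasoning
      K = k ^ size T
      F = (k !) ^ size T
      s₁ : ∀ a b c d → a * b * (c * d) ≡ c * (a * (b * d))
      s₁ = solve-∀
      s₂ : ∀ a b c → a * (b * c) ≡ c * a * b
      s₂ = solve-∀
      F^P : F ^ P ≡ ∏ Cs W * ∏ Cs V
      F^P = trans (cong (F ^_) (sym (length-colourings A T k))) (trans (sym (∏-const Cs F))
        (trans (∏-cong-∈ Cs (λ c∈ → sym (VW c∈))) (∏-* Cs W V)))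
      amgm : P ^ P * ∏ Cs V ≤ ∑ Cs V ^ P
      amgm = subst (λ p → p ^ p * ∏ Cs V ≤ ∑ Cs V ^ p) (trans (length-map V Cs) (length-colourings A T k))
        (am-gm (map V Cs))

open Counting

private
  variable
    n : ℕ

-- Numerical inequalities behind strictness

bernoulli : ∀ a m → a ^ suc m + suc m * a ^ m ≤ suc a ^ suc m
bernoulli a zero    = ≤-reflexive (e a)
  where
  e : ∀ a → a * 1 + 1 ≡ suc a * 1
  e = solve-∀
bernoulli a (suc m) = begin
  a * (a * a ^ m) + suc (suc m) * (a * a ^ m) ≤⟨ m≤m+n _ (suc m * a ^ m) ⟩
  a * (a * a ^ m) + suc (suc m) * (a * a ^ m) + suc m * a ^ m ≡⟨ e a m (a ^ m) ⟩
  suc a * (a * a ^ m + suc m * a ^ m)         ≤⟨ *-monoʳ-≤ (suc a) (bernoulli a m) ⟩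
  suc a * suc a ^ suc m ∎
  where
  open ≤-Reasoning
  e : ∀ a m w → a * (a * w) + suc (suc m) * (a * w) + suc m * w ≡ suc a * (a * w + suc m * w)
  e = solve-∀

-- With k = r + 1 and a = r² - 1 the first hypothesis reads (1 + 1/r)² ≤ (1 + 1/(r² - 1))^p: it compares the loss caused by
-- a monochromatic neighbourhood with the gain from a bichromatic one.
exponent-bound : ∀ a r k p E M → (k ^ 2) * a ^ p ≤ (r ^ 2) * suc a ^ p →
  .{{_ : NonZero r}} →
  suc a ^ (4 * E) * r ^ (3 * M) ≤ a ^ (4 * E) * k ^ (3 * M) → 8 * E ≤ 3 * p * M
exponent-bound a r k p E M cmp h = ≮⇒≥ λ lt → contra (8 * E ∸ 3 * p * M) (m<n⇒0<n∸m lt) (sym (m+[n∸m]≡n (<⇒≤ lt)))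
  where
  open ≤-Reasoning
  R = suc a
  contra : ∀ d → 0 < d → 8 * E ≡ 3 * p * M + d → ⊥
  contra d@(suc _) _ e = <⇒≱ (^-monoˡ-< d (n<1+n a)) (*-cancelˡ-≤ (r ^ (6 * M) * R ^ (3 * p * M)) {{m*n≢0 _ _ {{m^n≢0 r (6 * M)}} {{m^n≢0 R (3 * p * M)}}}} (begin
    r ^ (6 * M) * R ^ (3 * p * M) * R ^ d     ≡⟨ s₁ (r ^ (6 * M)) _ _ ⟩
    (R ^ (3 * p * M) * R ^ d) * r ^ (6 * M)   ≡⟨ cong (_* r ^ (6 * M)) (trans (sym (^-distribˡ-+-* R (3 * p * M) d)) (cong (R ^_) (sym e))) ⟩
    R ^ (8 * E) * r ^ (6 * M)                 ≡⟨ squares R r ⟩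
    (R ^ (4 * E) * r ^ (3 * M)) ^ 2           ≤⟨ ^-monoˡ-≤ 2 h ⟩
    (a ^ (4 * E) * k ^ (3 * M)) ^ 2           ≡⟨ squares a k ⟨
    a ^ (8 * E) * k ^ (6 * M)                 ≡⟨ cong (_* k ^ (6 * M)) (trans (cong (a ^_) e) (^-distribˡ-+-* a (3 * p * M) d)) ⟩
    (a ^ (3 * p * M) * a ^ d) * k ^ (6 * M)   ≡⟨ s₂ (a ^ (3 * p * M)) (a ^ d) (k ^ (6 * M)) ⟩
    (k ^ (6 * M) * a ^ (3 * p * M)) * a ^ d   ≡⟨ cong (_* a ^ d) (cubes k a) ⟨
    (k ^ 2 * a ^ p) ^ (3 * M) * a ^ d         ≤⟨ *-monoˡ-≤ (a ^ d) (^-monoˡ-≤ (3 * M) cmp) ⟩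
    (r ^ 2 * R ^ p) ^ (3 * M) * a ^ d         ≡⟨ cong (_* a ^ d) (cubes r R) ⟩
    r ^ (6 * M) * R ^ (3 * p * M) * a ^ d     ∎))
    where
    s₁ : ∀ x y z → x * y * z ≡ (y * z) * x
    s₁ = solve-∀
    s₂ : ∀ x y z → x * y * z ≡ z * x * y
    s₂ = solve-∀
    x₁ : ∀ E → 8 * E ≡ 4 * E * 2
    x₁ = solve-∀
    x₂ : ∀ M → 6 * M ≡ 3 * M * 2
    x₂ = solve-∀
    x₃ : ∀ M → 2 * (3 * M) ≡ 6 * M
    x₃ = solve-∀
    x₄ : ∀ p M → p * (3 * M) ≡ 3 * p * M
    x₄ = solve-∀
    squares : ∀ x y → x ^ (8 * E) * y ^ (6 * M) ≡ (x ^ (4 * E) * y ^ (3 * M)) ^ 2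
    squares x y = trans (cong₂ _*_ (trans (cong (x ^_) (x₁ E)) (sym (^-*-assoc x (4 * E) 2)))
                                   (trans (cong (y ^_) (x₂ M)) (sym (^-*-assoc y (3 * M) 2))))
                        (sym (^-distribʳ-* 2 (x ^ (4 * E)) (y ^ (3 * M))))
    cubes : ∀ x y → (x ^ 2 * y ^ p) ^ (3 * M) ≡ x ^ (6 * M) * y ^ (3 * p * M)
    cubes x y = trans (^-distribʳ-* (3 * M) (x ^ 2) (y ^ p))
      (cong₂ _*_ (trans (^-*-assoc x 2 (3 * M)) (cong (x ^_) (x₃ M))) (trans (^-*-assoc y p (3 * M)) (cong (y ^_) (x₄ p M))))

-- In the application |T| = σ + k, and E + M counts the pairs of a colouring and a
-- non-representative vertex, M those where three neighbours agree. From E + M = σ P follows 8 σ P ≤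
-- (3 p + 8) M, while r² M ≤ (σ + k) P. The last hypothesis makes these incompatible for σ ≥ 2; it
-- can fail at σ = 1, where M = 0 takes over.
count-contradiction : ∀ r k p E M P σ → 1 ≤ P → 1 ≤ σ →
  8 * E ≤ 3 * p * M → E + M ≡ σ * P → (σ ≡ 1 → M ≡ 0) → r * r * M ≤ (σ + k) * P →
  (2 ≤ σ → (3 * p + 8) * (σ + k) < 8 * σ * (r * r)) → ⊥
count-contradiction r k p E M P 1 1≤P _ h₁ h₂ h₃ h₄ h₅ with h₃ refl
... | refl = <⇒≱ 1≤P (≤-trans (m≤m+n P (7 * P)) (≤-trans (≤-reflexive (trans (cong (8 *_) (sym (+-identityʳ P))) (cong (8 *_) (trans (sym h₂) (+-identityʳ E))))) (≤-trans h₁ (≤-reflexive (*-zeroʳ (3 * p))))))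
count-contradiction r k p E M P σ@(suc (suc _)) 1≤P _ h₁ h₂ h₃ h₄ h₅ =
  <⇒≱ (h₅ (s≤s (s≤s z≤n))) (*-cancelʳ-≤ _ _ P {{>-nonZero 1≤P}} (begin
    8 * σ * (r * r) * P               ≡⟨ s₁ σ r P ⟩
    8 * (σ * P) * (r * r)             ≡⟨ cong (λ x → 8 * x * (r * r)) h₂ ⟨
    8 * (E + M) * (r * r)             ≡⟨ cong (_* (r * r)) (*-distribˡ-+ 8 E M) ⟩
    (8 * E + 8 * M) * (r * r)         ≤⟨ *-monoˡ-≤ (r * r) (+-monoˡ-≤ (8 * M) h₁) ⟩
    (3 * p * M + 8 * M) * (r * r)     ≡⟨ s₂ p M r ⟩
    (3 * p + 8) * (r * r * M)         ≤⟨ *-monoʳ-≤ (3 * p + 8) h₄ ⟩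
    (3 * p + 8) * ((σ + k) * P)       ≡⟨ *-assoc (3 * p + 8) (σ + k) P ⟨
    (3 * p + 8) * (σ + k) * P         ∎))
  where
  open ≤-Reasoning
  s₁ : ∀ σ r P → 8 * σ * (r * r) * P ≡ 8 * (σ * P) * (r * r)
  s₁ = solve-∀
  s₂ : ∀ p M r → (3 * p * M + 8 * M) * (r * r) ≡ (3 * p + 8) * (r * r * M)
  s₂ = solve-∀

final-contradiction : ∀ q E M P σ → 2 ≤ q → let r = suc q; k = suc r in
  1 ≤ P → 1 ≤ σ → E + M ≡ σ * P → (σ ≡ 1 → M ≡ 0) → r * r * M ≤ (σ + k) * P →
  (r * r) ^ (4 * E) * r ^ (3 * M) ≤ (k * q) ^ (4 * E) * k ^ (3 * M) → ⊥
-- For k = 4 the general exponent p = 2 r = 6 is too large: at σ = 2 it would need 26 · 6 < 144. The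
-- numerical check (4/3)² ≤ (9/8)⁵ permits p = 5, and 23 · 6 = 138 is small enough.
final-contradiction 2 E M P σ _ 1≤P 1≤σ h₂ h₃ h₄ h =
  count-contradiction 3 4 5 E M P σ 1≤P 1≤σ
    (exponent-bound 8 3 4 5 E M (from-yes (16 * 8 ^ 5 ≤? 9 * 9 ^ 5)) h) h₂ h₃ h₄ big
  where
  big : 2 ≤ σ → 23 * (σ + 4) < 8 * σ * 9
  big le = subst (λ σ → 23 * (σ + 4) < 8 * σ * 9) (m+[n∸m]≡n le) (≤-trans (m≤m+n _ (5 + 49 * s)) (≤-reflexive (e s)))
    where
    s = σ ∸ 2
    e : ∀ s → suc (23 * (2 + s + 4)) + (5 + 49 * s) ≡ 8 * (2 + s) * 9
    e = solve-∀
final-contradiction q@(suc (suc (suc ρ))) E M P σ _ 1≤P 1≤σ h₂ h₃ h₄ h =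
  count-contradiction r k (r * 2) E M P σ 1≤P 1≤σ
    (exponent-bound a r k (r * 2) E M cmp (subst (λ x → x ^ (4 * E) * r ^ (3 * M) ≤ a ^ (4 * E) * k ^ (3 * M)) (sq q) h)) h₂ h₃ h₄ big
  where
  r = suc q
  k = suc r
  a = k * q
  sq : ∀ q → suc q * suc q ≡ suc (suc (suc q) * q)
  sq = solve-∀
  -- Here a = r² - 1, so Bernoulli's inequality gives (1 + 1/a)^r ≥ 1 + r/a ≥ 1 + 1/r. Squaring
  -- yields the exponent 2 r of the general case.
  base : k * a ^ r ≤ r * suc a ^ r
  base = begin
    k * a ^ r                             ≡⟨⟩
    a ^ r + r * a ^ r                     ≤⟨ m≤m+n _ (a ^ q) ⟩
    a ^ r + r * a ^ r + a ^ q             ≡⟨ s₁ a r (a ^ q) ⟩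
    r * (a * a ^ q) + suc a * a ^ q       ≡⟨ cong (λ x → r * (a * a ^ q) + x * a ^ q) (sq q) ⟨
    r * (a * a ^ q) + r * r * a ^ q       ≡⟨ s₂ a r (a ^ q) ⟩
    r * (a ^ r + r * a ^ q)               ≤⟨ *-monoʳ-≤ r (bernoulli a q) ⟩
    r * suc a ^ r                         ∎
    where
    open ≤-Reasoning
    s₁ : ∀ a r w → a * w + r * (a * w) + w ≡ r * (a * w) + suc a * w
    s₁ = solve-∀
    s₂ : ∀ a r w → r * (a * w) + r * r * w ≡ r * (a * w + r * w)
    s₂ = solve-∀
  cmp : (k ^ 2) * a ^ (r * 2) ≤ (r ^ 2) * suc a ^ (r * 2)
  cmp = subst₂ _≤_ (sqr k a) (sqr r (suc a)) (^-monoˡ-≤ 2 base)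
    where
    sqr : ∀ x y → (x * y ^ r) ^ 2 ≡ x ^ 2 * y ^ (r * 2)
    sqr x y = trans (^-distribʳ-* 2 x (y ^ r)) (cong (x ^ 2 *_) (^-*-assoc y r 2))
  big : 2 ≤ σ → (3 * (r * 2) + 8) * (σ + k) < 8 * σ * (r * r)
  big le = subst (λ σ → (3 * (r * 2) + 8) * (σ + k) < 8 * σ * (r * r)) (m+[n∸m]≡n le)
    (≤-trans (m≤m+n _ (31 + 54 * ρ + 10 * (ρ * ρ) + 96 * s + 58 * (s * ρ) + 8 * (s * (ρ * ρ)))) (≤-reflexive (e ρ s)))
    where
    s = σ ∸ 2
    e : ∀ ρ s → suc ((3 * ((4 + ρ) * 2) + 8) * (2 + s + (5 + ρ))) + (31 + 54 * ρ + 10 * (ρ * ρ) + 96 * s + 58 * (s * ρ) + 8 * (s * (ρ * ρ)))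
              ≡ 8 * (2 + s) * ((4 + ρ) * (4 + ρ))
    e = solve-∀
final-contradiction 0 E M P σ () 
final-contradiction 1 E M P σ (s≤s ())

-- lhs A S ≤ rhs n (size S) says #col k A S ≤ k ! * r ^ (size S - k) * k ^ (n - size S), multiplied out.

module Bounds (q : ℕ) where

  r k : ℕ
  r = suc q
  k = suc r

  -- Both conditions survive an identification of non-adjacent vertices. Chromatic number exactly k
  -- would not, because it may increase.
  Nice : Graph n → VSet n → Set
  Nice A S = ¬ ColOn A S r × CutConn A S

  lhs : Graph n → VSet n → ℕ
  lhs A S = r ^ k * (k ^ size S * #col k A S)

  rhs : ℕ → ℕ → ℕ
  rhs n s = k ! * (r ^ s * k ^ n)

  -- The size condition travels with the induction because it makes a set of k - 1 vertices
  -- impossible. This is what forbids three agreeing neighbours when T has k + 1 vertices.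
  UpperBound : Graph n → VSet n → Set
  UpperBound {n} A S = k ≤ size S × lhs A S ≤ rhs n (size S)

  agree : Fin n → Fin n → Vec (Fin k) n → ℕ
  agree x y c = 𝟙 (lookup c y Fin.≟ lookup c x)

  agree-local : ∀ {x y z : Fin n} → x ≢ z → y ≢ z → ∀ c a → agree x y (c [ z ]≔ a) ≡ agree x y c
  agree-local x≢z y≢z c a = cong₂ (λ p q → 𝟙 (p Fin.≟ q)) (lookup∘update′ y≢z c a) (lookup∘update′ x≢z c a)

  merge-cases : (A : Graph n) {S : VSet n} {x y : Fin n} → Nice A S → x ≢ y → x ∈ˢ S → y ∈ˢ S →
    (∀ (w : Vec (Fin k) n → ℕ) → ∑ (vecs k n) (λ c → 𝟙 (properOn? A S c) * (agree x y c * w c)) ≡ 0) ⊎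
    ∃ λ A′ → Nice A′ (S ∖ y) × (∀ (w : Vec (Fin k) n → ℕ) → (∀ c a → w (c [ y ]≔ a) ≡ w c) →
      k * ∑ (vecs k n) (λ c → 𝟙 (properOn? A S c) * (agree x y c * w c)) ≤
      ∑ (vecs k n) (λ c → 𝟙 (properOn? A′ (S ∖ y) c) * w c))
  merge-cases A {S} {x} {y} (¬col , conn) x≢y x∈ y∈ with adj A x y Bool.≟ true
  ... | yes xy  = inj₁ (adjacent-distinct A {S} x∈ y∈ xy)
  ... | no ¬xy  = inj₂ (M.merged , (M.merged-uncolourable {S = S} x∈ y∈ ¬col , M.merged-connected {S = S} x∈ y∈ conn)
                       , M.merged-count {S = S} x∈ y∈)
    where module M = Merge A x y x≢y ¬xy

  -- Colourings that agree on x and y live on a set with one vertex less, for which the bound has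
  -- one factor r less; if x and y are adjacent, there are none.
  pair-bound : (A : Graph n) {S : VSet n} {x y : Fin n} → Nice A S → x ≢ y → x ∈ˢ S → y ∈ˢ S →
    (∀ A′ → Nice A′ (S ∖ y) → UpperBound A′ (S ∖ y)) →
    r ^ k * (k ^ size S * (r * ∑ (vecs k n) (λ c → 𝟙 (properOn? A S c) * agree x y c))) ≤ rhs n (size S)
  pair-bound {n} A {S} {x} {y} nice x≢y x∈ y∈ IH with merge-cases A {S} nice x≢y x∈ y∈
  ... | inj₁ z = ≤-trans (≤-reflexive (trans (cong (λ m → r ^ k * (k ^ size S * (r * m))) (trans
          (∑-cong (vecs k n) (λ c → cong (𝟙 (properOn? A S c) *_) (sym (*-identityʳ (agree x y c))))) (z (λ _ → 1))))
          (e (r ^ k) (k ^ size S) r))) z≤n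
    where
    e : ∀ a b c → a * (b * (c * 0)) ≡ 0
    e = solve-∀
  ... | inj₂ (A′ , nice′ , count) = begin
    r ^ k * (k ^ size S * (r * m))            ≡⟨ cong (λ s → r ^ k * (k ^ s * (r * m))) sz ⟩
    r ^ k * (k ^ suc s′ * (r * m))            ≡⟨ e₁ (r ^ k) k (k ^ s′) r m ⟩
    r * (r ^ k * (k ^ s′ * (k * m)))          ≤⟨ *-monoʳ-≤ r (*-monoʳ-≤ (r ^ k) (*-monoʳ-≤ (k ^ s′) km)) ⟩
    r * lhs A′ (S ∖ y)                        ≤⟨ *-monoʳ-≤ r (proj₂ (IH A′ nice′)) ⟩
    r * rhs n s′                              ≡⟨ e₂ r (k !) (r ^ s′) (k ^ n) ⟩
    rhs n (suc s′)                            ≡⟨ cong (rhs n) sz ⟨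
    rhs n (size S)                            ∎
    where
    open ≤-Reasoning
    s′ = size (S ∖ y)
    m = ∑ (vecs k n) (λ c → 𝟙 (properOn? A S c) * agree x y c)
    sz : size S ≡ suc s′
    sz = size-Ins (Ins-∖ {D = S} {y} y∈)
    km : k * m ≤ #col k A′ (S ∖ y)
    km = subst₂ _≤_ (cong (k *_) (∑-cong (vecs k n) (λ c → cong (𝟙 (properOn? A S c) *_) (*-identityʳ _))))
      (∑-cong (vecs k n) (λ c → *-identityʳ _)) (count (λ _ → 1) (λ _ _ → refl))
    e₁ : ∀ a k b r m → a * (k * b * (r * m)) ≡ r * (a * (b * (k * m)))
    e₁ = solve-∀
    e₂ : ∀ r f a b → r * (f * (a * b)) ≡ f * (r * a * b)
    e₂ = solve-∀

  agree₃ : Fin n → Fin n → Fin n → Vec (Fin k) n → ℕ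
  agree₃ x y z c = agree x y c * agree x z c

  -- First y and then z is identified with x. Each identification saves a factor r, and the size
  -- condition for the last set, two vertices smaller than S, becomes `2 + k ≤ size S`. If an
  -- adjacent pair is met on the way, no colouring agrees on all three vertices.
  triple-bound : (A : Graph n) {S : VSet n} {x y z : Fin n} → Nice A S →
    Unique (x ∷ y ∷ z ∷ []) → x ∈ˢ S → y ∈ˢ S → z ∈ˢ S →
    (∀ A′ S′ → size S′ < size S → Nice A′ S′ → UpperBound A′ S′) →
    let m = ∑ (vecs k n) (λ c → 𝟙 (properOn? A S c) * agree₃ x y z c) in
    m ≡ 0 ⊎ (2 + k ≤ size S × r ^ k * (k ^ size S * (r * r * m)) ≤ rhs n (size S))
  triple-bound {n} A {S} {x} {y} {z} nice ((x≢y ∷ x≢z ∷ []) ∷ (y≢z ∷ []) ∷ [] ∷ []) x∈ y∈ z∈ IH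
    with merge-cases A {S} nice x≢y x∈ y∈
  ... | inj₁ zero-count = inj₁ (zero-count (agree x z))
  ... | inj₂ (A₁ , nice₁ , count₁) = second (merge-cases A₁ {S ∖ y} nice₁ x≢z (∈-∖ {S = S} y∈ x∈ x≢y) z∈₁)
    where
    open ≤-Reasoning
    m = ∑ (vecs k n) (λ c → 𝟙 (properOn? A S c) * agree₃ x y z c)
    m₁ = ∑ (vecs k n) (λ c → 𝟙 (properOn? A₁ (S ∖ y) c) * (agree x z c * 1))
    s″ = size ((S ∖ y) ∖ z)
    z∈₁ : z ∈ˢ (S ∖ y)
    z∈₁ = ∈-∖ {S = S} y∈ z∈ (y≢z ∘ sym)
    sz : size S ≡ 2 + s″
    sz = trans (size-Ins (Ins-∖ {D = S} {y} y∈)) (cong suc (size-Ins (Ins-∖ {D = S ∖ y} {z} z∈₁)))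
    km : k * m ≤ m₁
    km = ≤-trans (count₁ (agree x z) (agree-local x≢y (y≢z ∘ sym)))
      (≤-reflexive (∑-cong (vecs k n) (λ c → cong (𝟙 (properOn? A₁ (S ∖ y) c) *_) (sym (*-identityʳ (agree x z c))))))
    e₁ : ∀ a k b r m → a * (k * (k * b) * (r * r * m)) ≡ r * r * (a * (b * (k * (k * m))))
    e₁ = solve-∀
    e₂ : ∀ r f a b → r * r * (f * (a * b)) ≡ f * (r * (r * a) * b)
    e₂ = solve-∀
    second : _ → m ≡ 0 ⊎ (2 + k ≤ size S × r ^ k * (k ^ size S * (r * r * m)) ≤ rhs n (size S))
    second (inj₁ zero-count) = inj₁ (n≤0⇒n≡0 (≤-trans (m≤n*m m k) (≤-trans km (≤-reflexive (zero-count (λ _ → 1))))))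
    second (inj₂ (A₂ , nice₂ , count₂)) =
      let k≤ , bound = IH A₂ ((S ∖ y) ∖ z) (≤-trans (n≤1+n _) (≤-reflexive (sym sz))) nice₂
      in inj₂ (≤-trans (s≤s (s≤s k≤)) (≤-reflexive (sym sz)) , (begin
        r ^ k * (k ^ size S * (r * r * m))        ≡⟨ cong (λ s → r ^ k * (k ^ s * (r * r * m))) sz ⟩
        r ^ k * (k ^ (2 + s″) * (r * r * m))      ≡⟨ e₁ (r ^ k) k (k ^ s″) r m ⟩
        r * r * (r ^ k * (k ^ s″ * (k * (k * m)))) ≤⟨ *-monoʳ-≤ (r * r) (*-monoʳ-≤ (r ^ k) (*-monoʳ-≤ (k ^ s″) kkm)) ⟩
        r * r * lhs A₂ ((S ∖ y) ∖ z)              ≤⟨ *-monoʳ-≤ (r * r) bound ⟩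
        r * r * rhs n s″                          ≡⟨ e₂ r (k !) (r ^ s″) (k ^ n) ⟩
        rhs n (2 + s″)                            ≡⟨ cong (rhs n) sz ⟨
        rhs n (size S)                            ∎))
      where
      kkm : k * (k * m) ≤ #col k A₂ ((S ∖ y) ∖ z)
      kkm = ≤-trans (*-monoʳ-≤ k km) (≤-trans (count₂ (λ _ → 1) (λ _ _ → refl))
        (≤-reflexive (∑-cong (vecs k n) (λ c → *-identityʳ _))))

-- Bookkeeping of exponents

^-^-comm : ∀ x a b → (x ^ a) ^ b ≡ (x ^ b) ^ a
^-^-comm x a b = trans (^-*-assoc x a b) (trans (cong (x ^_) (*-comm a b)) (sym (^-*-assoc x b a)))

raise : ∀ {z b N} a m e → a * m ≡ e → z ^ a ≤ b ^ N → z ^ e ≤ (b ^ m) ^ N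
raise {z} {b} {N} a m e refl h = begin
  z ^ (a * m)   ≡⟨ ^-*-assoc z a m ⟨
  (z ^ a) ^ m   ≤⟨ ^-monoˡ-≤ m h ⟩
  (b ^ N) ^ m   ≡⟨ ^-^-comm b N m ⟩
  (b ^ m) ^ N   ∎
  where open ≤-Reasoning

split-indicator : ∀ {s m} → s ≡ 0 ⊎ s ≡ 1 → m ≡ 0 ⊎ m ≡ 1 → ∀ b →
  b * s + (b * ((1 ∸ s) * (1 ∸ m)) + b * ((1 ∸ s) * m)) ≡ b
split-indicator (inj₁ refl) (inj₁ refl) = solve-∀
split-indicator (inj₁ refl) (inj₂ refl) = solve-∀
split-indicator (inj₂ refl) (inj₁ refl) = solve-∀
split-indicator (inj₂ refl) (inj₂ refl) = solve-∀

-- Exactly one of the three exponents is 1 if b holds, and all are 0 otherwise. One uniform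
-- expression for all vertices can then be multiplied out, and the products become sums in the
-- exponents.
case-bound : ∀ z b₁ b₂ b₃ N e (b : Bool) {s m} → s ≡ 0 ⊎ s ≡ 1 → m ≡ 0 ⊎ m ≡ 1 →
  (b ≡ true → s ≡ 1 → z ^ e ≤ b₁ ^ N) → (b ≡ true → m ≡ 0 → z ^ e ≤ b₂ ^ N) → (b ≡ true → m ≡ 1 → z ^ e ≤ b₃ ^ N) →
  (z ^ ⟪ b ⟫) ^ e ≤ (b₁ ^ (⟪ b ⟫ * s) * (b₂ ^ (⟪ b ⟫ * ((1 ∸ s) * (1 ∸ m))) * b₃ ^ (⟪ b ⟫ * ((1 ∸ s) * m)))) ^ N
case-bound z b₁ b₂ b₃ N e false _ _ _ _ _ = ≤-reflexive (trans (^-zeroˡ e) (sym (^-zeroˡ N)))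
case-bound z b₁ b₂ b₃ N e true (inj₂ refl) _ f₁ _ _ =
  subst₂ (λ x y → x ^ e ≤ y ^ N) (sym (*-identityʳ z)) (sym (trans (*-identityʳ _) (*-identityʳ b₁))) (f₁ refl refl)
case-bound z b₁ b₂ b₃ N e true (inj₁ refl) (inj₁ refl) _ f₂ _ =
  subst₂ (λ x y → x ^ e ≤ y ^ N) (sym (*-identityʳ z)) (sym (trans (+-identityʳ _) (trans (*-identityʳ _) (*-identityʳ b₂)))) (f₂ refl refl)
case-bound z b₁ b₂ b₃ N e true (inj₁ refl) (inj₂ refl) _ _ f₃ =
  subst₂ (λ x y → x ^ e ≤ y ^ N) (sym (*-identityʳ z)) (sym (trans (+-identityʳ _) (trans (+-identityʳ _) (*-identityʳ b₃)))) (f₃ refl refl)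

∏∏-exp : {X Y : Set} (xs : List X) (ys : List Y) (b : ℕ) (f : X → Y → ℕ) →
  ∏ xs (λ x → ∏ ys (λ y → b ^ f x y)) ≡ b ^ ∑ xs (λ x → ∑ ys (f x))
∏∏-exp xs ys b f = trans (∏-cong xs (λ x → ∏-exp ys b (f x))) (∏-exp xs b (λ x → ∑ ys (f x)))

∏∏-* : {X Y : Set} (xs : List X) (ys : List Y) (f g : X → Y → ℕ) →
  ∏ xs (λ x → ∏ ys (λ y → f x y * g x y)) ≡ ∏ xs (λ x → ∏ ys (f x)) * ∏ xs (λ x → ∏ ys (g x))
∏∏-* xs ys f g = trans (∏-cong xs (λ x → ∏-* ys (f x) (g x))) (∏-* xs (λ x → ∏ ys (f x)) (λ x → ∏ ys (g x)))

∑∑-+ : {X Y : Set} (xs : List X) (ys : List Y) (f g : X → Y → ℕ) →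
  ∑ xs (λ x → ∑ ys (λ y → f x y + g x y)) ≡ ∑ xs (λ x → ∑ ys (f x)) + ∑ xs (λ x → ∑ ys (g x))
∑∑-+ xs ys f g = trans (∑-cong xs (λ x → ∑-+ ys (f x) (g x))) (∑-+ xs (λ x → ∑ ys (f x)) (λ x → ∑ ys (g x)))

-- The share of the representatives, F = k ! later on, cancels, and a k-th root is taken. Because E
-- + M = σ P, the power r^(12 σ P) splits into r^(12 E) and r^(12 M); dividing by r^(4 E) and r^(9
-- M) leaves a ratio k q / r² to the power 4 E and k / r to the power 3 M.
extract-powers : ∀ F r q k σ P E M .{{_ : NonZero F}} .{{_ : NonZero r}} .{{_ : NonZero k}} → E + M ≡ σ * P →
  ((F * r ^ σ) ^ P) ^ (12 * k) ≤
    (F ^ 12) ^ (k * P) * (((k * (r * q)) ^ (4 * k)) ^ E * ((k * r ^ 3) ^ (3 * k)) ^ M) →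
  (r * r) ^ (4 * E) * r ^ (3 * M) ≤ (k * q) ^ (4 * E) * k ^ (3 * M)
extract-powers F r q k σ P E M e h = *-cancelˡ-≤ (r ^ (4 * E) * (r ^ 3) ^ (3 * M))
    {{m*n≢0 _ _ {{m^n≢0 r (4 * E)}} {{m^n≢0 (r ^ 3) (3 * M) {{m^n≢0 r 3}}}}}} (begin
  r ^ (4 * E) * (r ^ 3) ^ (3 * M) * ((r * r) ^ (4 * E) * r ^ (3 * M))
    ≡⟨ s₁ (r ^ (4 * E)) _ _ _ ⟩
  (r ^ (4 * E) * (r * r) ^ (4 * E)) * ((r ^ 3) ^ (3 * M) * r ^ (3 * M))
    ≡⟨ cong₂ _*_ (^-distribʳ-* (4 * E) r (r * r)) (^-distribʳ-* (3 * M) (r ^ 3) r) ⟨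
  (r * (r * r)) ^ (4 * E) * (r ^ 3 * r) ^ (3 * M)
    ≡⟨ cong₂ _*_ (trans (cong (λ x → (r * (r * x)) ^ (4 * E)) (sym (*-identityʳ r))) (trans (^-*-assoc r 3 (4 * E)) (cong (r ^_) (x₁ E))))
                 (trans (cong (_^ (3 * M)) (*-comm (r ^ 3) r)) (trans (^-*-assoc r 4 (3 * M)) (cong (r ^_) (x₂ M)))) ⟩
  r ^ (12 * E) * r ^ (12 * M)
    ≡⟨ ^-distribˡ-+-* r (12 * E) (12 * M) ⟨
  r ^ (12 * E + 12 * M)
    ≡⟨ cong (r ^_) (trans (sym (*-distribˡ-+ 12 E M)) (cong (12 *_) e)) ⟩
  r ^ (12 * (σ * P))
    ≤⟨ ^-cancelˡ-≤ k root ⟩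
  (k * (r * q)) ^ (4 * E) * (k * r ^ 3) ^ (3 * M)
    ≡⟨ cong₂ _*_ (trans (cong (_^ (4 * E)) (x₃ k r q)) (^-distribʳ-* (4 * E) r (k * q)))
                 (trans (cong (_^ (3 * M)) (*-comm k (r ^ 3))) (^-distribʳ-* (3 * M) (r ^ 3) k)) ⟩
  (r ^ (4 * E) * (k * q) ^ (4 * E)) * ((r ^ 3) ^ (3 * M) * k ^ (3 * M))
    ≡⟨ s₁ (r ^ (4 * E)) _ _ _ ⟨
  r ^ (4 * E) * (r ^ 3) ^ (3 * M) * ((k * q) ^ (4 * E) * k ^ (3 * M)) ∎)
  where
  open ≤-Reasoning
  s₁ : ∀ a b c d → a * b * (c * d) ≡ (a * c) * (b * d)
  s₁ = solve-∀
  x₁ : ∀ E → 3 * (4 * E) ≡ 12 * E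
  x₁ = solve-∀
  x₂ : ∀ E → 4 * (3 * E) ≡ 12 * E
  x₂ = solve-∀
  x₃ : ∀ k r q → k * (r * q) ≡ r * (k * q)
  x₃ = solve-∀
  x₄ : ∀ P k → 12 * (k * P) ≡ P * (12 * k)
  x₄ = solve-∀
  x₅ : ∀ σ P k → σ * P * (12 * k) ≡ 12 * (σ * P) * k
  x₅ = solve-∀
  x₆ : ∀ a k E → a * k * E ≡ a * E * k
  x₆ = solve-∀
  Fp = (F ^ 12) ^ (k * P)
  lhs≡ : ((F * r ^ σ) ^ P) ^ (12 * k) ≡ Fp * (r ^ (12 * (σ * P))) ^ k
  lhs≡ = begin-equality
    ((F * r ^ σ) ^ P) ^ (12 * k)                       ≡⟨ cong (_^ (12 * k)) (^-distribʳ-* P F (r ^ σ)) ⟩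
    (F ^ P * (r ^ σ) ^ P) ^ (12 * k)                   ≡⟨ ^-distribʳ-* (12 * k) (F ^ P) _ ⟩
    (F ^ P) ^ (12 * k) * ((r ^ σ) ^ P) ^ (12 * k)      ≡⟨ cong₂ _*_
      (trans (^-*-assoc F P (12 * k)) (trans (cong (F ^_) (sym (x₄ P k))) (sym (^-*-assoc F 12 (k * P)))))
      (trans (cong (_^ (12 * k)) (^-*-assoc r σ P)) (trans (^-*-assoc r (σ * P) (12 * k))
        (trans (cong (r ^_) (x₅ σ P k)) (sym (^-*-assoc r (12 * (σ * P)) k))))) ⟩
    Fp * (r ^ (12 * (σ * P))) ^ k                      ∎
  pull : ∀ x a E → (x ^ (a * k)) ^ E ≡ (x ^ (a * E)) ^ k
  pull x a E = trans (^-*-assoc x (a * k) E) (trans (cong (x ^_) (x₆ a k E)) (sym (^-*-assoc x (a * E) k)))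
  root : (r ^ (12 * (σ * P))) ^ k ≤ ((k * (r * q)) ^ (4 * E) * (k * r ^ 3) ^ (3 * M)) ^ k
  root = *-cancelˡ-≤ Fp {{m^n≢0 (F ^ 12) (k * P) {{m^n≢0 F 12}}}} (begin
    Fp * (r ^ (12 * (σ * P))) ^ k      ≡⟨ lhs≡ ⟨
    ((F * r ^ σ) ^ P) ^ (12 * k)       ≤⟨ h ⟩
    Fp * (((k * (r * q)) ^ (4 * k)) ^ E * ((k * r ^ 3) ^ (3 * k)) ^ M)
      ≡⟨ cong (Fp *_) (trans (cong₂ _*_ (pull (k * (r * q)) 4 E) (pull (k * r ^ 3) 3 M)) (sym (^-distribʳ-* k _ _))) ⟩
    Fp * ((k * (r * q)) ^ (4 * E) * (k * r ^ 3) ^ (3 * M)) ^ k ∎)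

𝟙-binary : {P : Set} (p : Dec P) → 𝟙 p ≡ 0 ⊎ 𝟙 p ≡ 1
𝟙-binary (yes _) = inj₂ refl
𝟙-binary (no _)  = inj₁ refl

𝟙≡1⇒ : {P : Set} (p : Dec P) → 𝟙 p ≡ 1 → P
𝟙≡1⇒ (yes p) _ = p

⟪⟫-*-mono : ∀ b {x y} → (b ≡ true → x ≤ y) → ⟪ b ⟫ * x ≤ ⟪ b ⟫ * y
⟪⟫-*-mono false h = z≤n
⟪⟫-*-mono true  h = *-monoʳ-≤ 1 (h refl)

∏<-∸ : ∀ k → ∏< k (k ∸_) ≡ k !
∏<-∸ zero    = refl
∏<-∸ (suc k) = cong (suc k *_) (∏<-∸ k)

∑-cong-∈ : {X : Set} (xs : List X) {f g : X → ℕ} → (∀ {x} → x ∈ xs → f x ≡ g x) → ∑ xs f ≡ ∑ xs g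
∑-cong-∈ xs h = ≤-antisym (∑-mono-∈ xs (≤-reflexive ∘ h)) (∑-mono-∈ xs (≤-reflexive ∘ sym ∘ h))

-- Strictness for critical sets with more than k vertices

module Strictness {n : ℕ} (q : ℕ) (2≤q : 2 ≤ q) (A : Graph n) (T : VSet n) (crit : Critical A (suc q) T)
  (k<t : suc (suc q) < size T)
  (IH : ∀ (A′ : Graph n) (S′ : VSet n) → size S′ < size T → Bounds.Nice q A′ S′ → Bounds.UpperBound q A′ S′)
  (H : Bounds.rhs q n (size T) ≤ Bounds.lhs q A T) where

  open Bounds q

  P N σ : ℕ
  P = #col k A T
  N = length (labellings n)
  σ = size T ∸ k

  t≡ : size T ≡ σ + k
  t≡ = sym (m∸n+n≡m (<⇒≤ k<t))

  1≤σ : 1 ≤ σ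
  1≤σ = m<n⇒0<n∸m k<t

  nice : Nice A T
  nice = proj₁ crit , critical-connected A crit

  k!≢0 : NonZero (k !)
  k!≢0 = >-nonZero (1≤n! k)

  lower : k ! * r ^ σ * k ^ n ≤ k ^ size T * P
  lower = *-cancelˡ-≤ (r ^ k) {{m^n≢0 r k}} (≤-trans (≤-reflexive (trans (e (r ^ k) (k !) (r ^ σ) (k ^ n))
      (cong (λ x → k ! * (x * k ^ n)) (trans (sym (^-distribˡ-+-* r σ k)) (cong (r ^_) (sym t≡)))))) H)
    where
    e : ∀ a f b c → a * (f * b * c) ≡ f * (b * a * c)
    e = solve-∀

  1≤P : 1 ≤ P
  1≤P = n≢0⇒n>0 (λ P≡0 → <⇒≱ (≤-trans pos lower) (≤-reflexive (trans (cong (k ^ size T *_) P≡0) (*-zeroʳ (k ^ size T)))))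
    where
    pos : 1 ≤ k ! * r ^ σ * k ^ n
    pos = *-mono-≤ {1} {_} {1} (*-mono-≤ {1} {_} {1} (1≤n! k) (m^n>0 r σ)) (m^n>0 k n)

  Cs : List (Vec (Fin k) n)
  Cs = colourings A T k

  proper : ∀ {c} → c ∈ Cs → ProperOn A T c
  proper c∈ = proj₂ (∈-filter⁻ (properOn? A T) {xs = vecs k n} c∈)

  per-labelling : ∀ {ℓ} → ℓ ∈ labellings n →
    (k ! * r ^ σ) ^ P ≤ ∏ Cs (λ c → ∏ (allFin n) (λ u → #freeAt A T ℓ u c ^ ⟪ T u ⟫))
  per-labelling {ℓ} ℓ∈ = *-cancelˡ-≤ ((k ^ n) ^ P) {{m^n≢0 (k ^ n) P {{m^n≢0 k n}}}} (≤-trans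
    (≤-reflexive (trans (sym (^-distribʳ-* P (k ^ n) (k ! * r ^ σ))) (cong (_^ P) (*-comm (k ^ n) _))))
    (≤-trans (^-monoˡ-≤ P lower) (entropy-bound A T k ℓ (labelling-injective ℓ∈))))

  Z : Fin n → Vec (Fin k) n → ℕ
  Z u c = #freeProd A T u c

  averaged : ((k ! * r ^ σ) ^ P) ^ N ≤ ∏ Cs (λ c → ∏ (allFin n) (λ u → Z u c ^ ⟪ T u ⟫))
  averaged = begin
    ((k ! * r ^ σ) ^ P) ^ N
      ≡⟨ ∏-const (labellings n) _ ⟨
    ∏ (labellings n) (λ _ → (k ! * r ^ σ) ^ P)
      ≤⟨ ∏-mono-∈ (labellings n) per-labelling ⟩
    ∏ (labellings n) (λ ℓ → ∏ Cs (λ c → ∏ (allFin n) (λ u → #freeAt A T ℓ u c ^ ⟪ T u ⟫)))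
      ≡⟨ ∏-swap (labellings n) Cs (λ ℓ c → ∏ (allFin n) (λ u → #freeAt A T ℓ u c ^ ⟪ T u ⟫)) ⟩
    ∏ Cs (λ c → ∏ (labellings n) (λ ℓ → ∏ (allFin n) (λ u → #freeAt A T ℓ u c ^ ⟪ T u ⟫)))
      ≡⟨ ∏-cong Cs (λ c → trans (∏-swap (labellings n) (allFin n) (λ ℓ u → #freeAt A T ℓ u c ^ ⟪ T u ⟫))
           (∏-cong (allFin n) (λ u → ∏-^ (labellings n) (λ ℓ → #freeAt A T ℓ u c) ⟪ T u ⟫))) ⟩
    ∏ Cs (λ c → ∏ (allFin n) (λ u → Z u c ^ ⟪ T u ⟫)) ∎
    where open ≤-Reasoning

  Nbr : Fin n → Fin n → Set
  Nbr u y = y ∈ˢ T × Adj A u y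

  -- The three neighbours are fixed before any colouring is considered: `triple-bound` identifies
  -- the same three vertices for all colourings at once. The degree in T is at least r ≥ 3.
  Triple : Fin n → Fin n × Fin n × Fin n → Set
  Triple u (x , y , z) = u ∈ˢ T → Unique (x ∷ y ∷ z ∷ []) × All (Nbr u) (x ∷ y ∷ z ∷ [])

  triple : ∀ u → ∃ (Triple u)
  triple u with T u Bool.≟ true
  ... | no u∉  = (u , u , u) , λ u∈ → ⊥-elim (u∉ u∈)
  ... | yes u∈ with three-elements (λ j → T j ∧ adj A u j) (≤-trans (s≤s 2≤q) (critical-degree A crit u∈))
  ...   | x , y , z , uniq , all = (x , y , z) , λ _ → uniq , All.map ∧-true all

  -- Testing the chosen triple is enough: a monochromatic neighbourhood passes the test, and failing
  -- it exhibits two differently coloured neighbours, as `plain-bound` requires.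
  mono : Fin n → Vec (Fin k) n → ℕ
  mono u c = let (x , y , z) , _ = triple u in agree₃ x y z c

  mono-binary : ∀ u c → mono u c ≡ 0 ⊎ mono u c ≡ 1
  mono-binary u c with triple u
  ... | (x , y , z) , _ with 𝟙-binary (lookup c y Fin.≟ lookup c x) | 𝟙-binary (lookup c z Fin.≟ lookup c x)
  ...   | inj₁ e | _       = inj₁ (cong (_* agree x z c) e)
  ...   | inj₂ e | inj₁ e′ = inj₁ (cong₂ _*_ e e′)
  ...   | inj₂ e | inj₂ e′ = inj₂ (cong₂ _*_ e e′)

  Colourful : Vec (Fin k) n → Fin k → Fin n → Set
  Colourful c a v = v ∈ˢ T × lookup c v ≡ a × (∀ i → ∃ λ y → y ∈ˢ T × Adj A v y × lookup c y ≡ punchIn a i)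

  representatives : ∀ c → ∃ λ (x : Fin k → Fin n) → ProperOn A T c → ∀ a → Colourful c a (x a)
  representatives c with properOn? A T c
  ... | yes p = (λ a → proj₁ (colourful A (proj₁ crit) c p a)) , λ _ a → proj₂ (colourful A (proj₁ crit) c p a)
  ... | no ¬p = (λ _ → proj₁ (critical-nonempty A crit)) , λ p → ⊥-elim (¬p p)

  rep : Vec (Fin k) n → Fin k → Fin n
  rep c = proj₁ (representatives c)

  -- Only the chosen representative of each colour counts as special, even if more vertices see all
  -- other colours. So every colouring has exactly k special vertices and exactly σ others in T.
  special : Fin n → Vec (Fin k) n → ℕ
  special u c = 𝟙 (u Fin.≟ rep c (lookup c u))

  special-bound : ∀ {c} u → c ∈ Cs → special u c ≡ 1 → Z u c ^ k ≤ (k !) ^ N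
  special-bound {c} u c∈ sp with proj₂ (representatives c) (proper c∈) (lookup c u)
  ... | cf rewrite sym (𝟙≡1⇒ (u Fin.≟ rep c (lookup c u)) sp) =
    subst₂ (λ l f → Z u c ^ suc l ≤ f ^ N) len (trans (cong (λ l → ∏< (suc l) (k ∸_)) len) (∏<-∸ k))
      (rainbow-bound A T u ys (AllP.map⁺ (All.tabulate (λ {i} _ → proj₁ (proj₂ (see i)) , proj₁ (proj₂ (proj₂ (see i))))))
        c (subst Unique colours (Uniq.map⁺ (punchIn-injective (lookup c u) _ _) (Uniq.allFin⁺ r))))
    where
    see = proj₂ (proj₂ cf)
    ys = map (proj₁ ∘ see) (allFin r)
    len : length ys ≡ r
    len = trans (length-map (proj₁ ∘ see) (allFin r)) (length-tabulate {n = r} id)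
    colours : map (punchIn (lookup c u)) (allFin r) ≡ map (lookup c) ys
    colours = trans (map-cong (λ i → sym (proj₂ (proj₂ (proj₂ (see i))))) (allFin r)) (map-∘ (allFin r))

  pair-rainbow : ∀ {u y y′} c → Nbr u y → Nbr u y′ → lookup c y ≢ lookup c y′ → Z u c ^ 3 ≤ (k * (r * q)) ^ N
  pair-rainbow {u} {y} {y′} c y∈ y′∈ ne = ≤-trans
    (rainbow-bound A T u (y ∷ y′ ∷ []) (y∈ ∷ y′∈ ∷ []) c ((ne ∷ []) ∷ [] ∷ []))
    (≤-reflexive (cong (λ x → (k * (r * x)) ^ N) (*-identityʳ q)))

  plain-bound : ∀ c u → u ∈ˢ T → mono u c ≡ 0 → Z u c ^ 3 ≤ (k * (r * q)) ^ N
  plain-bound c u u∈ m≡0 with triple u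
  ... | (x , y , z) , tr with tr u∈
  ...   | _ , (x∈ ∷ y∈ ∷ z∈ ∷ []) with lookup c y Fin.≟ lookup c x | lookup c z Fin.≟ lookup c x
  ...     | no ne | _     = pair-rainbow c y∈ x∈ ne
  ...     | yes _ | no ne = pair-rainbow c z∈ x∈ ne

  mono-bound : ∀ c u → u ∈ˢ T → Z u c ^ 4 ≤ (k * r ^ 3) ^ N
  mono-bound c u u∈ with triple u
  ... | (x , y , z) , tr = let uniq , nbrs = tr u∈ in nbrs-bound A T u (x ∷ y ∷ z ∷ []) nbrs c uniq

  i₁ i₂ i₃ : Vec (Fin k) n → Fin n → ℕ
  i₁ c u = ⟪ T u ⟫ * special u c
  i₂ c u = ⟪ T u ⟫ * ((1 ∸ special u c) * (1 ∸ mono u c))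
  i₃ c u = ⟪ T u ⟫ * ((1 ∸ special u c) * mono u c)

  -- Bounds on the power 12 k, a common multiple of the exponents k, 3 and 4 in the three preceding lemmas.
  b₁ b₂ b₃ : ℕ
  b₁ = (k !) ^ 12
  b₂ = (k * (r * q)) ^ (4 * k)
  b₃ = (k * r ^ 3) ^ (3 * k)

  vertex-bound : ∀ {c} → c ∈ Cs → ∀ u →
    (Z u c ^ ⟪ T u ⟫) ^ (12 * k) ≤ (b₁ ^ i₁ c u * (b₂ ^ i₂ c u * b₃ ^ i₃ c u)) ^ N
  vertex-bound {c} c∈ u = case-bound (Z u c) b₁ b₂ b₃ N (12 * k) (T u)
    (𝟙-binary (u Fin.≟ rep c (lookup c u))) (mono-binary u c)
    (λ _ sp → raise {Z u c} {k !} {N} k 12 (12 * k) (*-comm k 12) (special-bound u c∈ sp))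
    (λ u∈ m≡0 → raise {Z u c} {k * (r * q)} {N} 3 (4 * k) (12 * k) (sym (*-assoc 3 4 k)) (plain-bound c u u∈ m≡0))
    (λ u∈ _ → raise {Z u c} {k * r ^ 3} {N} 4 (3 * k) (12 * k) (sym (*-assoc 4 3 k)) (mono-bound c u u∈))

  I₁ E M : ℕ
  I₁ = ∑ Cs (λ c → ∑ (allFin n) (i₁ c))
  E  = ∑ Cs (λ c → ∑ (allFin n) (i₂ c))
  M  = ∑ Cs (λ c → ∑ (allFin n) (i₃ c))

  combined : ((k ! * r ^ σ) ^ P) ^ (12 * k) ≤ b₁ ^ I₁ * (b₂ ^ E * b₃ ^ M)
  combined = ^-cancelˡ-≤ N {{>-nonZero (labellings-nonempty n)}} (begin
    (((k ! * r ^ σ) ^ P) ^ (12 * k)) ^ N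
      ≡⟨ ^-^-comm ((k ! * r ^ σ) ^ P) (12 * k) N ⟩
    (((k ! * r ^ σ) ^ P) ^ N) ^ (12 * k)
      ≤⟨ ^-monoˡ-≤ (12 * k) averaged ⟩
    ∏ Cs (λ c → ∏ (allFin n) (λ u → Z u c ^ ⟪ T u ⟫)) ^ (12 * k)
      ≡⟨ ∏-^ Cs (λ c → ∏ (allFin n) (λ u → Z u c ^ ⟪ T u ⟫)) (12 * k) ⟨
    ∏ Cs (λ c → ∏ (allFin n) (λ u → Z u c ^ ⟪ T u ⟫) ^ (12 * k))
      ≡⟨ ∏-cong Cs (λ c → ∏-^ (allFin n) (λ u → Z u c ^ ⟪ T u ⟫) (12 * k)) ⟨
    ∏ Cs (λ c → ∏ (allFin n) (λ u → (Z u c ^ ⟪ T u ⟫) ^ (12 * k)))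
      ≤⟨ ∏-mono-∈ Cs (λ c∈ → ∏-mono-∈ (allFin n) (λ {u} _ → vertex-bound c∈ u)) ⟩
    ∏ Cs (λ c → ∏ (allFin n) (λ u → β c u ^ N))
      ≡⟨ trans (∏-cong Cs (λ c → ∏-^ (allFin n) (β c) N)) (∏-^ Cs (λ c → ∏ (allFin n) (β c)) N) ⟩
    ∏ Cs (λ c → ∏ (allFin n) (β c)) ^ N
      ≡⟨ cong (_^ N) (trans (∏∏-* Cs (allFin n) (λ c u → b₁ ^ i₁ c u) (λ c u → b₂ ^ i₂ c u * b₃ ^ i₃ c u))
           (cong₂ _*_ (∏∏-exp Cs (allFin n) b₁ i₁)
             (trans (∏∏-* Cs (allFin n) (λ c u → b₂ ^ i₂ c u) (λ c u → b₃ ^ i₃ c u))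
               (cong₂ _*_ (∏∏-exp Cs (allFin n) b₂ i₂) (∏∏-exp Cs (allFin n) b₃ i₃))))) ⟩
    (b₁ ^ I₁ * (b₂ ^ E * b₃ ^ M)) ^ N ∎)
    where
    open ≤-Reasoning
    β : Vec (Fin k) n → Fin n → ℕ
    β c u = b₁ ^ i₁ c u * (b₂ ^ i₂ c u * b₃ ^ i₃ c u)

  ∑-Cs-const : ∀ m → ∑ Cs (λ _ → m) ≡ P * m
  ∑-Cs-const m = trans (∑-const Cs m) (cong (_* m) (length-colourings A T k))

  -- Counting by colours instead of vertices: a vertex is attributed to its own colour a, and for
  -- each a only `rep c a` remains.
  I₁≡ : I₁ ≡ k * P
  I₁≡ = trans (trans (∑-cong-∈ Cs (λ {c} c∈ → per-colouring c (proj₂ (representatives c) (proper c∈)))) (∑-Cs-const k)) (*-comm P k)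
    where
    open ≡-Reasoning
    swap₃ : ∀ x y z → x * (y * z) ≡ z * (x * y)
    swap₃ = solve-∀
    per-colouring : ∀ c → (∀ a → Colourful c a (rep c a)) → ∑ (allFin n) (i₁ c) ≡ k
    per-colouring c cf = begin
      ∑ (allFin n) (λ u → ⟪ T u ⟫ * 𝟙 (u Fin.≟ rep c (lookup c u)))
        ≡⟨ ∑-cong (allFin n) (λ u → sym (∑-δ k (lookup c u) (λ a → ⟪ T u ⟫ * 𝟙 (u Fin.≟ rep c a)))) ⟩
      ∑ (allFin n) (λ u → ∑ (allFin k) (λ a → 𝟙 (a Fin.≟ lookup c u) * (⟪ T u ⟫ * 𝟙 (u Fin.≟ rep c a))))
        ≡⟨ ∑-swap (allFin n) (allFin k) _ ⟩
      ∑ (allFin k) (λ a → ∑ (allFin n) (λ u → 𝟙 (a Fin.≟ lookup c u) * (⟪ T u ⟫ * 𝟙 (u Fin.≟ rep c a))))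
        ≡⟨ ∑-cong (allFin k) (λ a → trans
             (∑-cong (allFin n) (λ u → swap₃ (𝟙 (a Fin.≟ lookup c u)) ⟪ T u ⟫ (𝟙 (u Fin.≟ rep c a))))
             (trans (∑-δ n (rep c a) (λ u → 𝟙 (a Fin.≟ lookup c u) * ⟪ T u ⟫))
               (cong₂ _*_ (𝟙-yes (a Fin.≟ lookup c (rep c a)) (sym (proj₁ (proj₂ (cf a))))) (cong ⟪_⟫ (proj₁ (cf a)))))) ⟩
      ∑ (allFin k) (λ _ → 1)
        ≡⟨ trans (∑-allFin-const k 1) (*-identityʳ k) ⟩
      k ∎

  E+M≡ : E + M ≡ σ * P
  E+M≡ = +-cancelˡ-≡ (k * P) (E + M) (σ * P) (begin
    k * P + (E + M)                        ≡⟨ cong (_+ (E + M)) I₁≡ ⟨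
    I₁ + (E + M)                           ≡⟨ cong (I₁ +_) (∑∑-+ Cs (allFin n) i₂ i₃) ⟨
    I₁ + ∑ Cs (λ c → ∑ (allFin n) (λ u → i₂ c u + i₃ c u)) ≡⟨ ∑∑-+ Cs (allFin n) i₁ (λ c u → i₂ c u + i₃ c u) ⟨
    ∑ Cs (λ c → ∑ (allFin n) (λ u → i₁ c u + (i₂ c u + i₃ c u)))
      ≡⟨ ∑-cong Cs (λ c → ∑-cong (allFin n) (λ u →
           split-indicator (𝟙-binary (u Fin.≟ rep c (lookup c u))) (mono-binary u c) ⟪ T u ⟫)) ⟩
    ∑ Cs (λ _ → size T)                    ≡⟨ ∑-Cs-const (size T) ⟩
    P * size T                             ≡⟨ cong (P *_) t≡ ⟩
    P * (σ + k)                            ≡⟨ e P σ k ⟩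
    k * P + σ * P                          ∎)
    where
    open ≡-Reasoning
    e : ∀ P σ k → P * (σ + k) ≡ k * P + σ * P
    e = solve-∀

  #mono : Fin n → ℕ
  #mono u = ∑ Cs (mono u)

  -- The bound for agreeing triples is relative to `rhs`; the assumption `H` puts `rhs` below
  -- `lhs A T` and so turns it into a share of P.
  #mono-cases : ∀ u → u ∈ˢ T → #mono u ≡ 0 ⊎ (2 + k ≤ size T × r * r * #mono u ≤ P)
  #mono-cases u u∈ rewrite ∑-filter (properOn? A T) (vecs k n) (mono u) with triple u
  ... | (x , y , z) , tr with tr u∈
  ...   | uniq , (x∈ , _) ∷ (y∈ , _) ∷ (z∈ , _) ∷ [] with triple-bound A {T} nice uniq x∈ y∈ z∈ IH
  ...     | inj₁ e        = inj₁ e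
  ...     | inj₂ (le , b) = inj₂ (le , *-cancelˡ-≤ (k ^ size T) {{m^n≢0 k (size T)}}
                              (*-cancelˡ-≤ (r ^ k) {{m^n≢0 r k}} (≤-trans b H)))

  M≤ : M ≤ ∑ (allFin n) (λ u → ⟪ T u ⟫ * #mono u)
  M≤ = ≤-trans (∑-mono-∈ Cs (λ {c} _ → ∑-mono (allFin n) (λ u → *-monoʳ-≤ ⟪ T u ⟫ (drop (special u c) (mono u c)))))
    (≤-reflexive (trans (∑-swap Cs (allFin n) (λ c u → ⟪ T u ⟫ * mono u c))
      (∑-cong (allFin n) (λ u → ∑-*ˡ Cs ⟪ T u ⟫ (mono u)))))
    where
    drop : ∀ s m → (1 ∸ s) * m ≤ m
    drop zero    m = ≤-reflexive (+-identityʳ m)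
    drop (suc s) m rewrite 0∸n≡0 s = z≤n

  -- With |T| = k + 1, two identifications would leave only k - 1 vertices, too few to resist
  -- colouring with r colours.
  M-small : σ ≡ 1 → M ≡ 0
  M-small σ≡1 = n≤0⇒n≡0 (≤-trans M≤ (≤-reflexive (∑-zero (allFin n) _ pw)))
    where
    pw : ∀ u → ⟪ T u ⟫ * #mono u ≡ 0
    pw u = n≤0⇒n≡0 (≤-trans (⟪⟫-*-mono (T u) (none u)) (≤-reflexive (*-zeroʳ ⟪ T u ⟫)))
      where
      none : ∀ u → u ∈ˢ T → #mono u ≤ 0
      none u u∈ with #mono-cases u u∈
      ... | inj₁ e        = ≤-reflexive e
      ... | inj₂ (le , _) = ⊥-elim (<⇒≱ le (≤-reflexive (trans t≡ (cong (_+ k) σ≡1))))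

  M-bound : r * r * M ≤ (σ + k) * P
  M-bound = begin
    r * r * M                                             ≤⟨ *-monoʳ-≤ (r * r) M≤ ⟩
    r * r * ∑ (allFin n) (λ u → ⟪ T u ⟫ * #mono u)        ≡⟨ ∑-*ˡ (allFin n) (r * r) _ ⟨
    ∑ (allFin n) (λ u → r * r * (⟪ T u ⟫ * #mono u))      ≤⟨ ∑-mono (allFin n) pw ⟩
    ∑ (allFin n) (λ u → P * ⟪ T u ⟫)                      ≡⟨ ∑-*ˡ (allFin n) P (λ u → ⟪ T u ⟫) ⟩
    P * size T                                            ≡⟨ trans (*-comm P (size T)) (cong (_* P) t≡) ⟩
    (σ + k) * P                                           ∎
    where
    open ≤-Reasoning
    small : ∀ u → u ∈ˢ T → r * r * #mono u ≤ P
    small u u∈ with #mono-cases u u∈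
    ... | inj₁ e       = ≤-trans (≤-reflexive (trans (cong (r * r *_) e) (*-zeroʳ (r * r)))) z≤n
    ... | inj₂ (_ , b) = b
    pw : ∀ u → r * r * (⟪ T u ⟫ * #mono u) ≤ P * ⟪ T u ⟫
    pw u = subst₂ _≤_ (e (r * r) ⟪ T u ⟫ (#mono u)) (*-comm ⟪ T u ⟫ P) (⟪⟫-*-mono (T u) (small u))
      where
      e : ∀ a b c → b * (a * c) ≡ a * (b * c)
      e = solve-∀

  contradiction : ⊥
  contradiction = final-contradiction q E M P σ 2≤q 1≤P 1≤σ E+M≡ M-small M-bound
    (extract-powers (k !) r q k σ P E M {{k!≢0}} E+M≡
      (≤-trans combined (≤-reflexive (cong (λ i → b₁ ^ i * (b₂ ^ E * b₃ ^ M)) I₁≡))))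

-- The upper bound by induction and the case of equality

module Extremal (q : ℕ) (2≤q : 2 ≤ q) where

  open Bounds q

  SmallerBounded : ℕ → ℕ → Set
  SmallerBounded n s = ∀ (A : Graph n) S → size S < s → Nice A S → UpperBound A S

  critical-strict : (A : Graph n) {T : VSet n} → Critical A r T → k < size T → SmallerBounded n (size T) →
    lhs A T < rhs n (size T)
  critical-strict A {T} crit k<t IH = ≰⇒> (Strictness.contradiction q 2≤q A T crit k<t IH)

  clique-exact : (A : Graph n) (T : VSet n) → (∀ u v → u ∈ˢ T → v ∈ˢ T → u ≢ v → Adj A u v) → size T ≡ k →
    lhs A T ≡ rhs n (size T)
  clique-exact {n} A T clique sz = begin
    r ^ k * (k ^ size T * #col k A T)   ≡⟨ cong (λ s → r ^ k * (k ^ s * #col k A T)) sz ⟩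
    r ^ k * (k ^ k * #col k A T)        ≡⟨ cong (r ^ k *_) (trans (e (k ^ k) (#col k A T)) (#col-clique k 0 A T clique sz (+-identityʳ k))) ⟩
    r ^ k * (k ! * k ^ n)               ≡⟨ e′ (r ^ k) (k !) (k ^ n) ⟩
    rhs n k                             ≡⟨ cong (rhs n) sz ⟨
    rhs n (size T)                      ∎
    where
    open ≡-Reasoning
    e : ∀ a b → a * b ≡ b * (a * 1)
    e = solve-∀
    e′ : ∀ a b c → a * (b * c) ≡ b * (a * c)
    e′ = solve-∀

  critical-bound : (A : Graph n) {T : VSet n} → Critical A r T → SmallerBounded n (size T) → lhs A T ≤ rhs n (size T)
  critical-bound A {T} crit IH with m≤n⇒m<n∨m≡n (critical-size A crit)
  ... | inj₁ k<t = <⇒≤ (critical-strict A crit k<t IH)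
  ... | inj₂ k≡t = ≤-reflexive (clique-exact A T (critical-clique A crit (sym k≡t)) (sym k≡t))

  step-bound : ∀ d (A : Graph n) {D D′ : VSet n} → size D′ ≡ d + size D →
    k ^ d * #col k A D′ ≤ r ^ d * #col k A D → lhs A D′ ≤ r ^ d * lhs A D
  step-bound d A {D} {D′} sz h = begin
    r ^ k * (k ^ size D′ * #col k A D′)             ≡⟨ cong (λ s → r ^ k * (k ^ s * #col k A D′)) sz ⟩
    r ^ k * (k ^ (d + size D) * #col k A D′)        ≡⟨ cong (λ x → r ^ k * (x * #col k A D′)) (^-distribˡ-+-* k d (size D)) ⟩
    r ^ k * (k ^ d * k ^ size D * #col k A D′)      ≡⟨ e₁ (r ^ k) (k ^ d) (k ^ size D) _ ⟩
    r ^ k * k ^ size D * (k ^ d * #col k A D′)      ≤⟨ *-monoʳ-≤ (r ^ k * k ^ size D) h ⟩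
    r ^ k * k ^ size D * (r ^ d * #col k A D)       ≡⟨ e₂ (r ^ k) (k ^ size D) (r ^ d) _ ⟩
    r ^ d * (r ^ k * (k ^ size D * #col k A D))     ∎
    where
    open ≤-Reasoning
    e₁ : ∀ a b c d → a * (b * c * d) ≡ a * c * (b * d)
    e₁ = solve-∀
    e₂ : ∀ a b c d → a * b * (c * d) ≡ c * (a * (b * d))
    e₂ = solve-∀

  rhs-shift : ∀ n d s → r ^ d * rhs n s ≡ rhs n (d + s)
  rhs-shift n d s = trans (e (r ^ d) (k !) (r ^ s) (k ^ n)) (cong (λ x → k ! * (x * k ^ n)) (sym (^-distribˡ-+-* r d s)))
    where
    e : ∀ a b c d → a * (b * (c * d)) ≡ b * (a * c * d)
    e = solve-∀

  -- Induction on the size of S with the graph left variable, since the hypothesis is applied to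
  -- graphs after identification. The decrease comes from the identifications inside T, so T may be
  -- all of S.
  upper-bound : (A : Graph n) (S : VSet n) → Nice A S → UpperBound A S
  upper-bound {n} A S = go (suc (size S)) A S ≤-refl
    where
    go : ∀ s (A : Graph n) S → size S < s → Nice A S → UpperBound A S
    go (suc s) A S lt (¬col , conn) =
      let T , T⊆ , crit = ∃-critical A r S ¬col
          v , v∈ = critical-nonempty A crit
          T≤S = size-mono {D = T} {S} T⊆
          d = size S ∸ size T
          d+ = m∸n+n≡m T≤S
          IH : SmallerBounded n (size T)
          IH = λ A′ S′ lt′ → go s A′ S′ (≤-trans lt′ (≤-trans T≤S (s≤s⁻¹ lt)))
      in ≤-trans (critical-size A crit) T≤S ,
         (≤-trans (step-bound d A {T} {S} (sym d+) (#col-grow A conn d {T} T⊆ v∈ d+))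
         (≤-trans (*-monoʳ-≤ (r ^ d) (critical-bound A crit IH))
         (≤-reflexive (trans (rhs-shift n d (size T)) (cong (rhs n) d+)))))

  -- Equality in the upper bound; the other inequality is `upper-bound`.
  Tight : Graph n → VSet n → Set
  Tight {n} A D = rhs n (size D) ≤ lhs A D

  tight-down : (A : Graph n) {D D′ : VSet n} {v y : Fin n} → Ins D v D′ → y ∈ˢ D → Adj A y v → Tight A D′ → Tight A D
  tight-down {n} A {D} {D′} I y∈ yv tight = *-cancelˡ-≤ r (begin
    r * rhs n (size D)        ≡⟨ cong (_* rhs n (size D)) (*-identityʳ r) ⟨
    r ^ 1 * rhs n (size D)    ≡⟨ rhs-shift n 1 (size D) ⟩
    rhs n (suc (size D))      ≡⟨ cong (rhs n) (size-Ins I) ⟨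
    rhs n (size D′)           ≤⟨ tight ⟩
    lhs A D′                  ≤⟨ step-bound 1 A {D} {D′} (size-Ins I)
      (subst₂ (λ a b → a * #col k A D′ ≤ b * #col k A D) (sym (*-identityʳ k)) (sym (*-identityʳ r)) (#col-leaf A I y∈ yv)) ⟩
    r ^ 1 * lhs A D           ≡⟨ cong (_* lhs A D) (*-identityʳ r) ⟩
    r * lhs A D               ∎)
    where open ≤-Reasoning

  -- Colourings that agree on y and y′ factor through the identification of y and y′, so they are too few.
  two-nbrs-not-tight : (A : Graph n) {D D′ : VSet n} {v y y′ : Fin n} → Ins D v D′ → Nice A D → y ≢ y′ →
    y ∈ˢ D → y′ ∈ˢ D → Adj A v y → Adj A v y′ → ¬ Tight A D′
  two-nbrs-not-tight {n} A {D} {D′} {v} {y} {y′} I nice y≢y′ y∈ y′∈ vy vy′ tight =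
    -- On average v would have at most q + 1/r free colours, where tightness demands r = q + 1.
    -- Multiplied by r B, the shortfall is q B, which is positive.
    <⇒≱ (*-mono-≤ {1} {q} {1} {B} (≤-trans (s≤s z≤n) 2≤q) positive) (+-cancelˡ-≤ (r * (q * B) + B) (q * B) 0 (begin
    r * (q * B) + B + q * B           ≡⟨ e₁ q B ⟩
    r * (r * B)                       ≤⟨ *-monoʳ-≤ r tight′ ⟩
    r * (K * (k * #col k A D′))       ≤⟨ *-monoʳ-≤ r (*-monoʳ-≤ K count) ⟩
    r * (K * (q * P + Y))             ≡⟨ e₂ r K q P Y ⟩
    r * (q * (K * P)) + K * (r * Y)   ≤⟨ +-mono-≤ (*-monoʳ-≤ r (*-monoʳ-≤ q all)) pairs ⟩
    r * (q * B) + B                   ≡⟨ +-identityʳ _ ⟨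
    r * (q * B) + B + 0               ∎))
    where
    open ≤-Reasoning
    B = rhs n (size D)
    K = r ^ k * k ^ size D
    P = #col k A D
    Y = ∑ (vecs k n) (λ c → 𝟙 (properOn? A D c) * agree y y′ c)
    positive : 1 ≤ B
    positive = *-mono-≤ {1} {_} {1} (1≤n! k) (*-mono-≤ {1} {_} {1} (m^n>0 r (size D)) (m^n>0 k n))
    e₁ : ∀ q B → suc q * (q * B) + B + q * B ≡ suc q * (suc q * B)
    e₁ = solve-∀
    e₂ : ∀ r K q P Y → r * (K * (q * P + Y)) ≡ r * (q * (K * P)) + K * (r * Y)
    e₂ = solve-∀
    e₃ : ∀ a b c d → a * (b * c * d) ≡ a * c * (b * d)
    e₃ = solve-∀
    tight′ : r * B ≤ K * (k * #col k A D′)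
    tight′ = begin
      r * B                           ≡⟨ cong (_* B) (*-identityʳ r) ⟨
      r ^ 1 * B                       ≡⟨ rhs-shift n 1 (size D) ⟩
      rhs n (suc (size D))            ≡⟨ cong (rhs n) (size-Ins I) ⟨
      rhs n (size D′)                 ≤⟨ tight ⟩
      lhs A D′                        ≡⟨ cong (λ s → r ^ k * (k ^ s * #col k A D′)) (size-Ins I) ⟩
      r ^ k * (k * k ^ size D * #col k A D′) ≡⟨ e₃ (r ^ k) k (k ^ size D) _ ⟩
      K * (k * #col k A D′)           ∎
    all : K * P ≤ B
    all = ≤-trans (≤-reflexive (*-assoc (r ^ k) (k ^ size D) P)) (proj₂ (upper-bound A D nice))
    pairs : K * (r * Y) ≤ B
    pairs = ≤-trans (≤-reflexive (*-assoc (r ^ k) (k ^ size D) (r * Y)))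
      (pair-bound A {D} nice y≢y′ y∈ y′∈ (λ A′ → upper-bound A′ (D ∖ y′)))
    free : ∀ c → #free A D v c ≤ q + agree y y′ c
    free c with lookup c y′ Fin.≟ lookup c y
    ... | yes _  = subst (#free A D v c ≤_) (+-comm 1 q) (#free-upper₁ A D v c y∈ vy)
    ... | no ne  = subst (#free A D v c ≤_) (sym (+-identityʳ q)) (+-cancelʳ-≤ 2 _ q (subst (#free A D v c + 2 ≤_) (+-comm 2 q)
                     (#free-upper A D v c (y′ ∷ y ∷ []) ((y′∈ , vy′) ∷ (y∈ , vy) ∷ []) ((ne ∷ []) ∷ [] ∷ []))))
    count : k * #col k A D′ ≤ q * P + Y
    count = begin
      k * #col k A D′
        ≡⟨ #col-step₁ A I ⟩
      ∑ (vecs k n) (λ c → 𝟙 (properOn? A D c) * #free A D v c)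
        ≤⟨ ∑-mono (vecs k n) (λ c → ≤-trans (*-monoʳ-≤ (𝟙 (properOn? A D c)) (free c))
             (≤-reflexive (trans (*-distribˡ-+ (𝟙 (properOn? A D c)) q (agree y y′ c))
               (cong (_+ 𝟙 (properOn? A D c) * agree y y′ c) (*-comm (𝟙 (properOn? A D c)) q))))) ⟩
      ∑ (vecs k n) (λ c → q * 𝟙 (properOn? A D c) + 𝟙 (properOn? A D c) * agree y y′ c)
        ≡⟨ trans (∑-+ (vecs k n) (λ c → q * 𝟙 (properOn? A D c)) _)
             (cong (_+ Y) (∑-*ˡ (vecs k n) q (λ c → 𝟙 (properOn? A D c)))) ⟩
      q * P + Y ∎

  V : VSet n
  V _ = true

  size-V : ∀ n → size (V {n}) ≡ n
  size-V n = trans (∑-allFin-const n 1) (*-identityʳ n)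

  -- D grows to V along edges, and tightness is passed back down from V. A vertex y that completes a
  -- tight set has fewer than two neighbours in D; but if y were in C, its two or more neighbours in
  -- C would all lie in D.
  core-in-tight : (A : Graph n) {C : VSet n} → CutConn A V → Tight A V → (∀ v → v ∈ˢ C → ¬ (degIn A C v ≤ 1)) →
    ∀ j (D : VSet n) {u} → u ∈ˢ D → j + size D ≡ size (V {n}) → Nice A D → C ⊆ˢ D × Tight A D
  core-in-tight {n} A {C} connV tight core zero D u∈ e nice =
    (λ {v} _ → everything v) ,
    subst (λ s → rhs n s ≤ r ^ k * (k ^ s * #col k A D)) (sym e)
      (≤-trans tight (*-monoʳ-≤ (r ^ k) (*-monoʳ-≤ (k ^ size (V {n})) (#col-⊆ k A {D} {V} (λ _ → refl)))))
    where
    everything : ∀ v → v ∈ˢ D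
    everything v = ¬-not (λ Dv → 0≢1+n (trans (cong ⟪_⟫ (sym Dv))
      (∑-squeeze (allFin n) {λ u → ⟪ D u ⟫} {λ _ → 1} (λ u → ⟪⟫-mono {D u} {true} (λ _ → refl)) (≤-reflexive (sym e)) (∈-allFin v))))
  core-in-tight {n} A {C} connV tight core (suc j) D {u} u∈ e (¬col , conn)
    with ⊈⇒∃ {D = D} {V} (≤-trans (s≤s (m≤n+m _ j)) (≤-reflexive e))
  ... | w , _ , w∉ with connV D {u} {w} refl refl u∈ w∉
  ... | x , y , _ , _ , x∈ , y∉ , xy =
    let C⊆ , tight⊕ = core-in-tight A {C} connV tight core j (D ⊕ y) (old I u∈)
                        (trans (cong (j +_) (size-Ins I)) (trans (+-suc j (size D)) e))
                        ((λ (c , p) → ¬col (c , ProperOn-⊆ {A = A} {D} {D ⊕ y} {c} (old I) p)) , CutConn-⊕ A I x∈ xy conn)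
    in (λ {v} v∈ → stays C⊆ tight⊕ v v∈ (back I (C⊆ v∈))) , tight-down A I x∈ xy tight⊕
    where
    I = Ins-⊕ {D = D} {y} (false⇒∉ {D = D} y∉)
    stays : C ⊆ˢ (D ⊕ y) → Tight A (D ⊕ y) → ∀ v → v ∈ˢ C → v ≡ y ⊎ v ∈ˢ D → v ∈ˢ D
    stays C⊆ t v v∈ (inj₂ v∈D)  = v∈D
    stays C⊆ t v v∈ (inj₁ refl) =
      let a , b , a≢b , a∈ , b∈ = two-elements (λ j → D j ∧ adj A y j) (≤-trans (≰⇒> (core y v∈)) (degIn-mono A {C} {D} y inD))
      in ⊥-elim (two-nbrs-not-tight A I (¬col , conn) a≢b (proj₁ (∧-true a∈)) (proj₁ (∧-true b∈))
           (proj₂ (∧-true {D a} a∈)) (proj₂ (∧-true {D b} b∈)) t)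
      where
      inD : ∀ {z} → z ∈ˢ C → Adj A y z → z ∈ˢ D
      inD {z} z∈ yz with back I (C⊆ z∈)
      ... | inj₁ z≡y = ⊥-elim (adj-≢ A yz (sym z≡y))
      ... | inj₂ z∈D = z∈D

  delete-Ins : {A : Graph n} {S S′ : VSet n} → DeleteStep A S S′ → ∃ λ v → Ins S′ v S × degIn A S′ v ≤ 1
  delete-Ins {A = A} {S} {S′} (delete v v∈ deg eq) = v , I , ≤-trans (degIn-mono A {S′} {S} v (λ u∈ _ → old I u∈)) deg
    where I = Ins-delete {D = S} {S′} {v} v∈ eq

  -- A vertex that comes back with at most one neighbour finds at least r free colours, so the count
  -- grows by the full factor that the bound allows.
  tight-up : (A : Graph n) {S S′ : VSet n} → DeleteStep A S S′ → Tight A S′ → Tight A S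
  tight-up {n} A {S} {S′} step tight with delete-Ins step
  ... | v , I , deg = begin
    rhs n (size S)                            ≡⟨ cong (rhs n) (size-Ins I) ⟩
    rhs n (suc (size S′))                     ≡⟨ rhs-shift n 1 (size S′) ⟨
    r ^ 1 * rhs n (size S′)                   ≡⟨ cong (_* rhs n (size S′)) (*-identityʳ r) ⟩
    r * rhs n (size S′)                       ≤⟨ *-monoʳ-≤ r tight ⟩
    r * (r ^ k * (k ^ size S′ * #col k A S′)) ≡⟨ e₁ r (r ^ k) (k ^ size S′) _ ⟩
    r ^ k * k ^ size S′ * (r * #col k A S′)   ≤⟨ *-monoʳ-≤ (r ^ k * k ^ size S′) count ⟩
    r ^ k * k ^ size S′ * (k * #col k A S)    ≡⟨ e₂ (r ^ k) (k ^ size S′) k _ ⟩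
    r ^ k * (k * k ^ size S′ * #col k A S)    ≡⟨ cong (λ s → r ^ k * (k ^ s * #col k A S)) (size-Ins I) ⟨
    lhs A S                                   ∎
    where
    open ≤-Reasoning
    e₁ : ∀ a b c d → a * (b * (c * d)) ≡ b * c * (a * d)
    e₁ = solve-∀
    e₂ : ∀ a b c d → a * b * (c * d) ≡ a * (c * b * d)
    e₂ = solve-∀
    free : ∀ c → r ≤ #free A S′ v c
    free c = +-cancelʳ-≤ 1 r _ (≤-trans (≤-reflexive (+-comm r 1)) (≤-trans (#free-lower A S′ v c) (+-monoʳ-≤ _ deg)))
    count : r * #col k A S′ ≤ k * #col k A S
    count = ≤-trans (≤-reflexive (sym (∑-*ˡ (vecs k n) r _)))
      (≤-trans (∑-mono (vecs k n) (λ c → ≤-trans (≤-reflexive (*-comm r _)) (*-monoʳ-≤ (𝟙 (properOn? A S′ c)) (free c))))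
        (≤-reflexive (sym (#col-step₁ A I))))

  tight-chain : (A : Graph n) {S C : VSet n} → Star (DeleteStep A) S C → Tight A C → Tight A S
  tight-chain A ε          t = t
  tight-chain A (s ◅ rest) t = tight-up A s (tight-chain A rest t)

  core-uncolourable : (A : Graph n) {S C : VSet n} → Star (DeleteStep A) S C → ¬ ColOn A S r → ¬ ColOn A C r
  core-uncolourable A ε          ¬col = ¬col
  core-uncolourable A (s ◅ rest) ¬col with delete-Ins s
  ... | v , I , deg = core-uncolourable A rest (¬col ∘ ColOn-extend A I (≤-<-trans deg (s≤s (≤-trans (s≤s z≤n) 2≤q))))

  tight⇒clique : (A : Graph n) {C : VSet n} → Nice A V → IsTwoCore A C → Tight A V → IsClique A k C
  tight⇒clique {n} A {C} (¬col , conn) (chain , core) tight =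
    let T , T⊆V , crit = ∃-critical A r V ¬col
        u , u∈ = critical-nonempty A crit
        C⊆T , tightT = core-in-tight A {C} conn tight core (size (V {n}) ∸ size T) T {u} u∈
                         (m∸n+n≡m (size-mono {D = T} {V} T⊆V)) (proj₁ crit , critical-connected A crit)
        sizeT : size T ≡ k
        sizeT = ≤-antisym (≮⇒≥ (λ k<t → <⇒≱ (critical-strict A crit k<t (λ A′ S′ _ → upper-bound A′ S′)) tightT)) (critical-size A crit)
        T⊆C : T ⊆ˢ C
        -- If C missed v, it would lie in T without v and be r-colourable by criticality. But an
        -- r-colouring of C would extend back through the deletions, as each deleted vertex has at
        -- most one neighbour.
        T⊆C = λ {v} v∈ → ¬-not (λ v∉C → core-uncolourable A chain ¬col
          (let c , p = proj₂ crit {v} v∈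
           in c , ProperOn-⊆ {A = A} {C} {T ∖ v} {c}
                (λ {w} w∈ → ∈-∖ {S = T} v∈ (C⊆T w∈) (λ { refl → false⇒∉ {D = C} v∉C w∈ })) p))
    in trans (≤-antisym (size-mono {D = C} {T} C⊆T) (size-mono {D = T} {C} T⊆C)) sizeT ,
       λ a b a∈ b∈ → critical-clique A crit sizeT a b (C⊆T a∈) (C⊆T b∈)

  clique⇒tight : (A : Graph n) {C : VSet n} → IsTwoCore A C → IsClique A k C → Tight A V
  clique⇒tight A {C} (chain , _) (sz , clique) = tight-chain A chain (≤-reflexive (sym (clique-exact A C clique sz)))

  extremal : (A : Graph n) → Nice A V →
    chromPoly A k ≤ k ! * r ^ (n ∸ k) ×
    ((C : VSet n) → IsTwoCore A C → (chromPoly A k ≡ k ! * r ^ (n ∸ k) ⇔ IsClique A k C))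
  extremal {n} A nice = le , λ C core → mk⇔
    (λ e → tight⇒clique A nice core (subst₂ _≤_ (sym rhs≡) (sym lhs≡) (*-monoʳ-≤ F (≤-reflexive (sym e)))))
    (λ cl → ≤-antisym le (cancel (subst₂ _≤_ rhs≡ lhs≡ (clique⇒tight A core cl))))
    where
    F = r ^ k * k ^ n
    ub = upper-bound A V nice
    k≤n : k ≤ n
    k≤n = ≤-trans (proj₁ ub) (≤-reflexive (size-V n))
    lhs≡ : lhs A V ≡ F * chromPoly A k
    lhs≡ = trans (cong₂ (λ s p → r ^ k * (k ^ s * p)) (size-V n) (sym (chromPoly≡#col k A))) (sym (*-assoc (r ^ k) (k ^ n) _))
    rhs≡ : rhs n (size (V {n})) ≡ F * (k ! * r ^ (n ∸ k))
    rhs≡ = trans (cong (rhs n) (trans (size-V n) (sym (m∸n+n≡m k≤n))))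
      (trans (cong (λ x → k ! * (x * k ^ n)) (^-distribˡ-+-* r (n ∸ k) k)) (e (k !) (r ^ (n ∸ k)) (r ^ k) (k ^ n)))
      where
      e : ∀ f a b c → f * (a * b * c) ≡ b * c * (f * a)
      e = solve-∀
    cancel : ∀ {x y} → F * x ≤ F * y → x ≤ y
    cancel = *-cancelˡ-≤ F {{m*n≢0 (r ^ k) (k ^ n) {{m^n≢0 r k}} {{m^n≢0 k n}}}}
    le : chromPoly A k ≤ k ! * r ^ (n ∸ k)
    le = cancel (subst₂ _≤_ lhs≡ rhs≡ (proj₂ ub))

-- From walks to cuts, and the theorem

walk-crosses : (A : Graph n) (Q : VSet n) {u v : Fin n} → Star (Adj A) u v → Q u ≡ true → Q v ≡ false →
  ∃₂ λ x y → Q x ≡ true × Q y ≡ false × Adj A x y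
walk-crosses A Q ε Qu Qv = ⊥-elim (false⇒∉ {D = Q} Qv Qu)
walk-crosses A Q {u} (_◅_ {j = w} uw rest) Qu Qv with Q w in e
... | true  = walk-crosses A Q rest e Qv
... | false = u , w , Qu , e , uw

connected⇒cutConn : (A : Graph n) → Connected A → CutConn A (λ _ → true)
connected⇒cutConn A conn Q {u} {v} _ _ Qu Qv =
  let x , y , Qx , Qy , xy = walk-crosses A Q (conn u v) Qu Qv in x , y , refl , refl , Qx , Qy , xy

theorem1 : (k n : ℕ) → 4 ≤ k → (G : Graph n) → Connected G → ChromaticNumber G k →
    chromPoly G k ≤ (k !) * ((k ∸ 1) ^ (n ∸ k)) ×
    ((C : VSet n) → IsTwoCore G C →
    (chromPoly G k ≡ (k !) * ((k ∸ 1) ^ (n ∸ k)) ⇔ IsClique G k C))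
theorem1 (suc (suc q)) n (s≤s (s≤s 2≤q)) G conn (_ , minimal) =
  Extremal.extremal q 2≤q G
    ((λ (c , p) → minimal (suc q) ≤-refl (lookup c , λ i j → p i j refl refl)) , connected⇒cutConn G conn)
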